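{- Let $\vec\alpha=(\alpha_i)_{i\ge1}$, $\vec\beta=(\beta_i)_{i\ge1}$ be sequences of non-negative reals and $\gamma\ge0$ a real with $\gamma+\sum_i\alpha_i+\sum_i\beta_i=1$. Let $n\ge1$. Then the expected number of fixed points of a permutation in $S_n$ distributed as a $(\vec\alpha,\vec\beta,\gamma)$ shuffle is $$\gamma+\sum_{j=1}^n\Big[\sum_i\big((\alpha_i)^j+(-1)^{j+1}(\beta_i)^j\big)\Big],$$ which is the sum $\sum_{j=1}^n\tilde p_j(\vec\alpha,\vec\beta,\gamma)$ of the first $n$ extended power sum symmetric functions.
   Context: **$(\vec\alpha,\vec\beta,\gamma)$ shuffle.** This is the following probability measure on $S_n$. Choose a word $w_1\cdots w_n$ of integers with independent letters: each letter equals $i>0$ with probability $\alpha_i$, equals $-i<0$ with probability $\beta_i$ ($i\geq 1$), and equals $0$ with probability $\gamma$. Process the distinct letters occurring in the word in increasing order (usual order on $\mathbb Z$), assigning to the positions of each letter the next unused block of consecutive integers from $1,2,\dots,n$ (the block having as many elements as the letter has occurrences). Within the block of a negative letter, the integers are written under its occurrences in decreasing order from left to right. Within the block of a positive letter, they are written in increasing order from left to right. Within the block of the letter $0$, they are written in a uniformly random order (independent of everything else). Then $\pi(k)$ is the integer written under $w_k$. **Extended power sums.** $\tilde p_1(\vec\alpha,\vec\beta,\gamma)=\gamma+\sum_i\alpha_i+\sum_i\beta_i=1$, and for $m\ge2$, $\tilde p_m(\vec\alpha,\vec\beta,\gamma)=\sum_i\alpha_i^m+(-1)^{m+1}\sum_i\beta_i^m$.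 -}

module Defs where

open import Algebra.Bundles using (CommutativeRing; Semiring)
open import Algebra.Structures using (IsCommutativeRing)
open import Data.Bool.Base using (if_then_else_)
open import Data.Empty using (⊥)
open import Data.Fin.Base as Fin using (Fin; zero; suc; toℕ)
import Data.Fin.Properties as Fin
open import Data.Fin.Permutation as Perm
  using (Permutation′; _⟨$⟩ʳ_; insert; remove; insert-remove)
open import Data.Integer.Base as ℤ using (ℤ; +_; +0; +[1+_]; -[1+_])
import Data.Integer.Properties as ℤ
open import Data.List.Base as List using (List; []; _∷_; allFin; cartesianProductWith)
open import Data.List.Membership.Propositional using (_∈_)
open import Data.List.Membership.Propositional.Properties
  using (∈-cartesianProductWith⁺; ∈-allFin)
import Data.List.Properties as List
open import Data.List.Relation.Binary.Subset.Propositional using (_⊆_)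
open import Data.List.Relation.Unary.Any using (here)
open import Data.List.Relation.Unary.Unique.Propositional using (Unique)
open import Data.Nat.Base as ℕ using (ℕ; zero; suc; _!)
import Data.Nat.Properties as ℕ
open import Data.Product.Base using (_×_; _,_; proj₁; proj₂; ∃-syntax)
open import Data.Rational.Base as ℚ using (ℚ; 0ℚ; 1ℚ; ½)
import Data.Rational.Properties as ℚ
open import Data.Rational.Solver using (module +-*-Solver)
open import Data.Sum.Base using (inj₁; inj₂)
open import Data.Vec.Base as Vec using (Vec; lookup; count)
open import Level using (0ℓ)
open import Relation.Binary.PropositionalEquality
  using (_≡_; refl; sym; trans; cong; cong₂; subst; subst₂)
open import Relation.Binary.Structures using (IsEquivalence)
open import Relation.Nullary.Decidable using (Dec; does; yes; no; _×-dec_; _→-dec_)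

------------------------------------------------------------------------
-- Real numbers: Cauchy sequences of rationals, equal when their
-- difference tends to 0

private
  Eventually : (ℕ → Set) → Set
  Eventually P = ∃[ N ] (∀ n → N ℕ.≤ n → P n)

  eventually₂ : ∀ {P Q R : ℕ → Set} → (∀ {n} → P n → Q n → R n) →
                Eventually P → Eventually Q → Eventually R
  eventually₂ f (M , p) (N , q) = M ℕ.⊔ N , λ n le →
    f (p n (ℕ.≤-trans (ℕ.m≤m⊔n M N) le)) (q n (ℕ.≤-trans (ℕ.m≤n⊔m M N) le))

IsCauchy : (ℕ → ℚ) → Set
IsCauchy x = ∀ ε → 0ℚ ℚ.< ε →
  ∃[ N ] (∀ m n → N ℕ.≤ m → N ℕ.≤ n → ℚ.∣ x m ℚ.- x n ∣ ℚ.≤ ε)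

record ℝ : Set where
  constructor mkℝ
  field
    seq    : ℕ → ℚ
    cauchy : IsCauchy seq

open ℝ public

infix 4 _≈_ _≤_

_≈_ : ℝ → ℝ → Set
x ≈ y = ∀ ε → 0ℚ ℚ.< ε →
  ∃[ N ] (∀ n → N ℕ.≤ n → ℚ.∣ seq x n ℚ.- seq y n ∣ ℚ.≤ ε)

_≤_ : ℝ → ℝ → Set
x ≤ y = ∀ ε → 0ℚ ℚ.< ε →
  ∃[ N ] (∀ n → N ℕ.≤ n → seq x n ℚ.≤ seq y n ℚ.+ ε)

private
  half : ∀ {ε} → 0ℚ ℚ.< ε → 0ℚ ℚ.< ½ ℚ.* ε
  half {ε} 0<ε = subst (ℚ._< ½ ℚ.* ε) (ℚ.*-zeroʳ ½) (ℚ.*-monoʳ-<-pos ½ 0<ε)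

  ½+½ : ∀ ε → ½ ℚ.* ε ℚ.+ ½ ℚ.* ε ≡ ε
  ½+½ ε = trans (sym (ℚ.*-distribʳ-+ ε ½ ½)) (ℚ.*-identityˡ ε)

  ∣p-p∣≡0 : ∀ p → ℚ.∣ p ℚ.- p ∣ ≡ 0ℚ
  ∣p-p∣≡0 p = cong ℚ.∣_∣ (ℚ.+-inverseʳ p)

  ∣p-q∣≡∣q-p∣ : ∀ p q → ℚ.∣ p ℚ.- q ∣ ≡ ℚ.∣ q ℚ.- p ∣
  ∣p-q∣≡∣q-p∣ p q = trans (sym (ℚ.∣-p∣≡∣p∣ (p ℚ.- q))) (cong ℚ.∣_∣
    (solve 2 (λ a b → :- (a :- b) := b :- a) refl p q))
    where open +-*-Solver

  ∣∣-subst : ∀ {p q r} → p ≡ q → ℚ.∣ p ∣ ℚ.≤ r → ℚ.∣ q ∣ ℚ.≤ r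
  ∣∣-subst refl p≤r = p≤r

  triangle : ∀ p q r → ℚ.∣ p ℚ.- r ∣ ℚ.≤ ℚ.∣ p ℚ.- q ∣ ℚ.+ ℚ.∣ q ℚ.- r ∣
  triangle p q r = ∣∣-subst
    (solve 3 (λ a b c → (a :- b) :+ (b :- c) := a :- c) refl p q r)
    (ℚ.∣p+q∣≤∣p∣+∣q∣ (p ℚ.- q) (q ℚ.- r))
    where open +-*-Solver

  +-dist : ∀ p q r s → ℚ.∣ (p ℚ.+ q) ℚ.- (r ℚ.+ s) ∣ ℚ.≤ ℚ.∣ p ℚ.- r ∣ ℚ.+ ℚ.∣ q ℚ.- s ∣
  +-dist p q r s = ∣∣-subst
    (solve 4 (λ a b c d → (a :- c) :+ (b :- d) := (a :+ b) :- (c :+ d)) refl p q r s)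
    (ℚ.∣p+q∣≤∣p∣+∣q∣ (p ℚ.- r) (q ℚ.- s))
    where open +-*-Solver

  -‿dist : ∀ p q → ℚ.∣ (ℚ.- p) ℚ.- (ℚ.- q) ∣ ≡ ℚ.∣ p ℚ.- q ∣
  -‿dist p q = trans (cong ℚ.∣_∣
    (solve 2 (λ a b → (:- a) :- (:- b) := b :- a) refl p q)) (∣p-q∣≡∣q-p∣ q p)
    where open +-*-Solver

  *-dist : ∀ p q r s → ℚ.∣ p ℚ.* q ℚ.- r ℚ.* s ∣ ℚ.≤
           ℚ.∣ p ∣ ℚ.* ℚ.∣ q ℚ.- s ∣ ℚ.+ ℚ.∣ s ∣ ℚ.* ℚ.∣ p ℚ.- r ∣
  *-dist p q r s = subst₂ ℚ._≤_
    (cong ℚ.∣_∣ (solve 4 (λ a b c d → a :* (b :- d) :+ d :* (a :- c) := a :* b :- c :* d) refl p q r s))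
    (cong₂ ℚ._+_ (ℚ.∣p*q∣≡∣p∣*∣q∣ p (q ℚ.- s)) (ℚ.∣p*q∣≡∣p∣*∣q∣ s (p ℚ.- r)))
    (ℚ.∣p+q∣≤∣p∣+∣q∣ (p ℚ.* (q ℚ.- s)) (s ℚ.* (p ℚ.- r)))
    where open +-*-Solver

  ∣p∣≤∣q∣+∣p-q∣ : ∀ p q → ℚ.∣ p ∣ ℚ.≤ ℚ.∣ q ∣ ℚ.+ ℚ.∣ p ℚ.- q ∣
  ∣p∣≤∣q∣+∣p-q∣ p q = ∣∣-subst
    (solve 2 (λ a b → b :+ (a :- b) := a) refl p q)
    (ℚ.∣p+q∣≤∣p∣+∣q∣ q (p ℚ.- q))
    where open +-*-Solver

  p≤q+r⇒p-q≤r : ∀ {p q r} → p ℚ.≤ q ℚ.+ r → p ℚ.- q ℚ.≤ r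
  p≤q+r⇒p-q≤r {p} {q} {r} le = subst (p ℚ.- q ℚ.≤_)
    (solve 2 (λ b c → (b :+ c) :- b := c) refl q r) (ℚ.+-monoˡ-≤ (ℚ.- q) le)
    where open +-*-Solver

  ∣∣p∣-∣q∣∣≤∣p-q∣ : ∀ p q → ℚ.∣ ℚ.∣ p ∣ ℚ.- ℚ.∣ q ∣ ∣ ℚ.≤ ℚ.∣ p ℚ.- q ∣
  ∣∣p∣-∣q∣∣≤∣p-q∣ p q with ℚ.∣p∣≡p∨∣p∣≡-p (ℚ.∣ p ∣ ℚ.- ℚ.∣ q ∣)
  ... | inj₁ eq = subst (ℚ._≤ ℚ.∣ p ℚ.- q ∣) (sym eq) (p≤q+r⇒p-q≤r (∣p∣≤∣q∣+∣p-q∣ p q))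
  ... | inj₂ eq = subst₂ ℚ._≤_
    (sym (trans eq (solve 2 (λ a b → :- (a :- b) := b :- a) refl ℚ.∣ p ∣ ℚ.∣ q ∣)))
    (∣p-q∣≡∣q-p∣ q p) (p≤q+r⇒p-q≤r (∣p∣≤∣q∣+∣p-q∣ q p))
    where open +-*-Solver

  ≤½+½ : ∀ {p q r ε} → p ℚ.≤ q ℚ.+ r → q ℚ.≤ ½ ℚ.* ε → r ℚ.≤ ½ ℚ.* ε → p ℚ.≤ ε
  ≤½+½ {ε = ε} p≤ q≤ r≤ = subst (_ ℚ.≤_) (½+½ ε) (ℚ.≤-trans p≤ (ℚ.+-mono-≤ q≤ r≤))

  bound : ∀ x → ∃[ B ] (ℚ.Positive B × Eventually (λ n → ℚ.∣ seq x n ∣ ℚ.≤ B))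
  bound x with cauchy x 1ℚ (ℚ.positive⁻¹ 1ℚ)
  ... | N , close = B , pos , N , λ n N≤n → ℚ.≤-trans (∣p∣≤∣q∣+∣p-q∣ (seq x n) (seq x N))
                      (ℚ.+-monoʳ-≤ ℚ.∣ seq x N ∣ (close n N N≤n ℕ.≤-refl))
    where
    B = ℚ.∣ seq x N ∣ ℚ.+ 1ℚ
    pos : ℚ.Positive B
    pos = ℚ.nonNeg+pos⇒pos ℚ.∣ seq x N ∣ {{ℚ.∣-∣-nonNeg (seq x N)}} 1ℚ

  module _ (B : ℚ) (B>0 : ℚ.Positive B) where
    private instance
      B⁺ : ℚ.Positive B
      B⁺ = B>0
      B≢0 : ℚ.NonZero B
      B≢0 = ℚ.pos⇒nonZero B

    scale : ℚ → ℚ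
    scale ε = (ℚ.1/ B) ℚ.* (½ ℚ.* ε)

    scale-pos : ∀ {ε} → 0ℚ ℚ.< ε → 0ℚ ℚ.< scale ε
    scale-pos {ε} 0<ε = subst (ℚ._< scale ε) (ℚ.*-zeroʳ (ℚ.1/ B))
      (ℚ.*-monoʳ-<-pos (ℚ.1/ B) {{ℚ.1/pos⇒pos B}} (half 0<ε))

    scale-≤ : ∀ {p q ε} → 0ℚ ℚ.≤ q → p ℚ.≤ B → q ℚ.≤ scale ε → p ℚ.* q ℚ.≤ ½ ℚ.* ε
    scale-≤ {p} {q} {ε} 0≤q p≤B q≤ = ℚ.≤-trans
      (ℚ.*-monoʳ-≤-nonNeg q {{ℚ.nonNegative 0≤q}} p≤B)
      (subst (B ℚ.* q ℚ.≤_) eq (ℚ.*-monoˡ-≤-nonNeg B {{ℚ.pos⇒nonNeg B}} q≤))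
      where
      eq : B ℚ.* scale ε ≡ ½ ℚ.* ε
      eq = trans (sym (ℚ.*-assoc B (ℚ.1/ B) (½ ℚ.* ε)))
        (trans (cong (ℚ._* (½ ℚ.* ε)) (ℚ.*-inverseʳ B)) (ℚ.*-identityˡ (½ ℚ.* ε)))

  ≡⇒≈ : ∀ x y → (∀ n → seq x n ≡ seq y n) → x ≈ y
  ≡⇒≈ x y eq ε 0<ε = 0 , λ n _ → subst (ℚ._≤ ε)
    (sym (trans (cong (λ t → ℚ.∣ t ℚ.- seq y n ∣) (eq n)) (∣p-p∣≡0 (seq y n)))) (ℚ.<⇒≤ 0<ε)

-- The Cauchy and congruence proofs are abstract so that type checking never
-- unfolds them; the underlying rational sequences remain transparent.
abstract
  const-cauchy : ∀ p → IsCauchy (λ _ → p)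
  const-cauchy p ε 0<ε = 0 , λ _ _ _ _ →
    subst (ℚ._≤ ε) (sym (∣p-p∣≡0 p)) (ℚ.<⇒≤ 0<ε)

  +-cauchy : ∀ x y → IsCauchy (λ n → seq x n ℚ.+ seq y n)
  +-cauchy x y ε 0<ε =
    let M , p = cauchy x (½ ℚ.* ε) (half 0<ε)
        N , q = cauchy y (½ ℚ.* ε) (half 0<ε)
    in M ℕ.⊔ N , λ m n le le′ →
       ≤½+½ {ε = ε} (+-dist (seq x m) (seq y m) (seq x n) (seq y n))
         (p m n (ℕ.≤-trans (ℕ.m≤m⊔n M N) le) (ℕ.≤-trans (ℕ.m≤m⊔n M N) le′))
         (q m n (ℕ.≤-trans (ℕ.m≤n⊔m M N) le) (ℕ.≤-trans (ℕ.m≤n⊔m M N) le′))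

  -‿cauchy : ∀ x → IsCauchy (λ n → ℚ.- seq x n)
  -‿cauchy x ε 0<ε =
    let N , p = cauchy x ε 0<ε
    in N , λ m n le le′ →
       subst (ℚ._≤ ε) (sym (-‿dist (seq x m) (seq x n))) (p m n le le′)

  ∣∣-cauchy : ∀ x → IsCauchy (λ n → ℚ.∣ seq x n ∣)
  ∣∣-cauchy x ε 0<ε =
    let N , p = cauchy x ε 0<ε
    in N , λ m n le le′ →
       ℚ.≤-trans (∣∣p∣-∣q∣∣≤∣p-q∣ (seq x m) (seq x n)) (p m n le le′)

  *-cauchy : ∀ x y → IsCauchy (λ n → seq x n ℚ.* seq y n)
  *-cauchy x y ε 0<ε =
    let B , B>0 , M , b = bound x
        C , C>0 , N , c = bound y
        K , p = cauchy y (scale B B>0 ε) (scale-pos B B>0 0<ε)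
        L , q = cauchy x (scale C C>0 ε) (scale-pos C C>0 0<ε)
        T = (M ℕ.⊔ N) ℕ.⊔ (K ℕ.⊔ L)
        M≤T = ℕ.≤-trans (ℕ.m≤m⊔n M N) (ℕ.m≤m⊔n (M ℕ.⊔ N) (K ℕ.⊔ L))
        N≤T = ℕ.≤-trans (ℕ.m≤n⊔m M N) (ℕ.m≤m⊔n (M ℕ.⊔ N) (K ℕ.⊔ L))
        K≤T = ℕ.≤-trans (ℕ.m≤m⊔n K L) (ℕ.m≤n⊔m (M ℕ.⊔ N) (K ℕ.⊔ L))
        L≤T = ℕ.≤-trans (ℕ.m≤n⊔m K L) (ℕ.m≤n⊔m (M ℕ.⊔ N) (K ℕ.⊔ L))
    in T , λ m n le le′ →
       ≤½+½ {ε = ε} (*-dist (seq x m) (seq y m) (seq x n) (seq y n))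
         (scale-≤ B B>0 {ε = ε} (ℚ.0≤∣p∣ (seq y m ℚ.- seq y n)) (b m (ℕ.≤-trans M≤T le))
           (p m n (ℕ.≤-trans K≤T le) (ℕ.≤-trans K≤T le′)))
         (scale-≤ C C>0 {ε = ε} (ℚ.0≤∣p∣ (seq x m ℚ.- seq x n)) (c n (ℕ.≤-trans N≤T le′))
           (q m n (ℕ.≤-trans L≤T le) (ℕ.≤-trans L≤T le′)))

fromℚ : ℚ → ℝ
fromℚ p = mkℝ (λ _ → p) (const-cauchy p)

fromℕ : ℕ → ℝ
fromℕ n = fromℚ (+ n ℚ./ 1)

0# 1# : ℝ
0# = fromℚ 0ℚ
1# = fromℚ 1ℚ

infix  8 -_
infixl 7 _*_
infixl 6 _+_ _-_

_+_ : ℝ → ℝ → ℝ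
x + y = mkℝ (λ n → seq x n ℚ.+ seq y n) (+-cauchy x y)

_*_ : ℝ → ℝ → ℝ
x * y = mkℝ (λ n → seq x n ℚ.* seq y n) (*-cauchy x y)

-_ : ℝ → ℝ
- x = mkℝ (λ n → ℚ.- seq x n) (-‿cauchy x)

_-_ : ℝ → ℝ → ℝ
x - y = x + (- y)

∣_∣ : ℝ → ℝ
∣ x ∣ = mkℝ (λ n → ℚ.∣ seq x n ∣) (∣∣-cauchy x)

abstract
  ≈-isEquivalence : IsEquivalence _≈_
  ≈-isEquivalence = record
    { refl  = λ {x} → ≡⇒≈ x x (λ _ → refl)
    ; sym   = λ {x} {y} x≈y ε 0<ε →
        let N , p = x≈y ε 0<ε
        in N , λ n le → subst (ℚ._≤ ε) (∣p-q∣≡∣q-p∣ (seq x n) (seq y n)) (p n le)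
    ; trans = λ {x} {y} {z} x≈y y≈z ε 0<ε →
        eventually₂ (λ {n} → ≤½+½ {ε = ε} (triangle (seq x n) (seq y n) (seq z n)))
          (x≈y (½ ℚ.* ε) (half 0<ε)) (y≈z (½ ℚ.* ε) (half 0<ε))
    }

  +-cong : ∀ {x y u v} → x ≈ y → u ≈ v → x + u ≈ y + v
  +-cong {x} {y} {u} {v} x≈y u≈v ε 0<ε =
    eventually₂ (λ {n} → ≤½+½ {ε = ε} (+-dist (seq x n) (seq u n) (seq y n) (seq v n)))
      (x≈y (½ ℚ.* ε) (half 0<ε)) (u≈v (½ ℚ.* ε) (half 0<ε))

  -‿cong : ∀ {x y} → x ≈ y → - x ≈ - y
  -‿cong {x} {y} x≈y ε 0<ε =
    let N , p = x≈y ε 0<ε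
    in N , λ n le → subst (ℚ._≤ ε) (sym (-‿dist (seq x n) (seq y n))) (p n le)

  *-cong : ∀ {x y u v} → x ≈ y → u ≈ v → x * u ≈ y * v
  *-cong {x} {y} {u} {v} x≈y u≈v ε 0<ε =
    let B , B>0 , b = bound x
        C , C>0 , c = bound v
    in eventually₂ (λ {n} → ≤½+½ {ε = ε} (*-dist (seq x n) (seq u n) (seq y n) (seq v n)))
         (eventually₂ (λ {n} → scale-≤ B B>0 {ε = ε} (ℚ.0≤∣p∣ (seq u n ℚ.- seq v n)))
           b (u≈v (scale B B>0 ε) (scale-pos B B>0 0<ε)))
         (eventually₂ (λ {n} → scale-≤ C C>0 {ε = ε} (ℚ.0≤∣p∣ (seq x n ℚ.- seq y n)))
           c (x≈y (scale C C>0 ε) (scale-pos C C>0 0<ε)))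

  ℝ-isCommutativeRing : IsCommutativeRing _≈_ _+_ _*_ -_ 0# 1#
  ℝ-isCommutativeRing = record
    { isRing = record
      { +-isAbelianGroup = record
        { isGroup = record
          { isMonoid = record
            { isSemigroup = record
              { isMagma = record { isEquivalence = ≈-isEquivalence
                                 ; ∙-cong = λ {x} {y} {u} {v} → +-cong {x} {y} {u} {v} }
              ; assoc = λ x y z → ≡⇒≈ ((x + y) + z) (x + (y + z))
                  (λ n → ℚ.+-assoc (seq x n) (seq y n) (seq z n)) }
            ; identity = (λ x → ≡⇒≈ (0# + x) x (λ n → ℚ.+-identityˡ (seq x n)))
                       , (λ x → ≡⇒≈ (x + 0#) x (λ n → ℚ.+-identityʳ (seq x n))) }
          ; inverse = (λ x → ≡⇒≈ (- x + x) 0# (λ n → ℚ.+-inverseˡ (seq x n)))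
                    , (λ x → ≡⇒≈ (x + - x) 0# (λ n → ℚ.+-inverseʳ (seq x n)))
          ; ⁻¹-cong = λ {x} {y} → -‿cong {x} {y} }
        ; comm = λ x y → ≡⇒≈ (x + y) (y + x) (λ n → ℚ.+-comm (seq x n) (seq y n)) }
      ; *-cong = λ {x} {y} {u} {v} → *-cong {x} {y} {u} {v}
      ; *-assoc = λ x y z → ≡⇒≈ ((x * y) * z) (x * (y * z))
          (λ n → ℚ.*-assoc (seq x n) (seq y n) (seq z n))
      ; *-identity = (λ x → ≡⇒≈ (1# * x) x (λ n → ℚ.*-identityˡ (seq x n)))
                   , (λ x → ≡⇒≈ (x * 1#) x (λ n → ℚ.*-identityʳ (seq x n)))
      ; distrib = (λ x y z → ≡⇒≈ (x * (y + z)) (x * y + x * z)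
                    (λ n → ℚ.*-distribˡ-+ (seq x n) (seq y n) (seq z n)))
                , (λ x y z → ≡⇒≈ ((y + z) * x) (y * x + z * x)
                    (λ n → ℚ.*-distribʳ-+ (seq x n) (seq y n) (seq z n)))
      }
    ; *-comm = λ x y → ≡⇒≈ (x * y) (y * x) (λ n → ℚ.*-comm (seq x n) (seq y n))
    }

ℝ-commutativeRing : CommutativeRing 0ℓ 0ℓ
ℝ-commutativeRing = record { isCommutativeRing = ℝ-isCommutativeRing }

open import Algebra.Definitions.RawSemiring
  (Semiring.rawSemiring (CommutativeRing.semiring ℝ-commutativeRing)) public
  using (sum; _^_)

------------------------------------------------------------------------
-- Sums

Σ[1⋯_] : ℕ → (ℕ → ℝ) → ℝ
Σ[1⋯ n ] f = sum {n} (λ j → f (suc (toℕ j)))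

sumOver : {I : Set} → List I → (I → ℝ) → ℝ
sumOver xs f = List.foldr _+_ 0# (List.map f xs)

-- The series f 0 + f 1 + f 2 + ⋯ converges to s.
SeriesSum : (ℕ → ℝ) → ℝ → Set
SeriesSum f s = ∀ ε → 0ℚ ℚ.< ε →
  ∃[ N ] (∀ n → N ℕ.≤ n → ∣ sum {n} (λ i → f (toℕ i)) - s ∣ ≤ fromℚ ε)

-- Unconditional summation over an index set with no preferred order: the
-- finite partial sums converge to s along the finite subsets of I (given
-- as lists without repetition) ordered by inclusion.
HasSum : {I : Set} → (I → ℝ) → ℝ → Set
HasSum {I} f s = ∀ ε → 0ℚ ℚ.< ε →
  ∃[ F ] (∀ (G : List I) → Unique G → F ⊆ G → ∣ sumOver G f - s ∣ ≤ fromℚ ε)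

------------------------------------------------------------------------
-- The symmetric group

-- Each permutation of Fin (suc n) is determined by the image j of zero and
-- by the permutation left after deleting zero and j.
permutations : ∀ n → List (Permutation′ n)
permutations zero    = Perm.id ∷ []
permutations (suc n) = cartesianProductWith (insert zero) (allFin (suc n)) (permutations n)

permutations-complete : ∀ {n} (π : Permutation′ n) →
                        ∃[ ρ ] (ρ ∈ permutations n × ρ Perm.≈ π)
permutations-complete {zero}  π = Perm.id , here refl , λ ()
permutations-complete {suc n} π with permutations-complete (remove zero π)
... | ρ , ρ∈ , ρ≈ = insert zero (π ⟨$⟩ʳ zero) ρ
                  , ∈-cartesianProductWith⁺ (insert zero) (∈-allFin (π ⟨$⟩ʳ zero)) ρ∈
                  , eq
  where
  eq : insert zero (π ⟨$⟩ʳ zero) ρ Perm.≈ π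
  eq zero    = insert-remove zero π zero
  eq (suc i) = trans (cong (Fin.punchIn (π ⟨$⟩ʳ zero)) (ρ≈ i)) (insert-remove zero π (suc i))

private
  length-product : ∀ {A B C : Set} (f : A → B → C) xs ys →
    List.length (cartesianProductWith f xs ys) ≡ List.length xs ℕ.* List.length ys
  length-product f []       ys = refl
  length-product f (x ∷ xs) ys = trans (List.length-++ (List.map (f x) ys))
    (cong₂ ℕ._+_ (List.length-map (f x) ys) (length-product f xs ys))

-- Together with completeness, this shows that nothing is listed twice.
length-permutations : ∀ n → List.length (permutations n) ≡ n !
length-permutations zero    = refl
length-permutations (suc n) = trans
  (length-product (insert zero) (allFin (suc n)) (permutations n))
  (cong₂ ℕ._*_ (List.length-tabulate {n = suc n} (λ i → i)) (length-permutations n))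

fixedPoints : ∀ {n} → Permutation′ n → ℕ
fixedPoints {n} π = count (λ k → π ⟨$⟩ʳ k Fin.≟ k) (Vec.allFin n)

-- The expectation of X on S_n under the measure with point masses μ.
𝔼 : ∀ {n} → (Permutation′ n → ℝ) → (Permutation′ n → ℕ) → ℝ
𝔼 {n} μ X = sumOver (permutations n) (λ π → μ π * fromℕ (X π))

------------------------------------------------------------------------
-- The (α, β, γ) shuffle. Sequences are indexed from 0, so α i and β i
-- stand for the parameters with index i + 1; likewise permutations act on
-- {0, …, n - 1}.

Word : ℕ → Set
Word n = Vec ℤ n

letterProb : (α β : ℕ → ℝ) (γ : ℝ) → ℤ → ℝ
letterProb α β γ +0       = γ
letterProb α β γ +[1+ i ] = α i
letterProb α β γ -[1+ i ] = β i

wordProb : (α β : ℕ → ℝ) (γ : ℝ) → ∀ {n} → Word n → ℝ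
wordProb α β γ w = Vec.foldr′ _*_ 1# (Vec.map (letterProb α β γ) w)

below upTo : ∀ {n} → Word n → ℤ → ℕ
below w a = count (ℤ._<? a) w
upTo  w a = count (ℤ._≤? a) w

-- The letters smaller than a use up the integers 0, …, below w a - 1, so
-- the block of the letter a is {below w a, …, upTo w a - 1}.
InBlocks : ∀ {n} → Word n → Permutation′ n → Set
InBlocks w π = ∀ k →
  below w (lookup w k) ℕ.≤ toℕ (π ⟨$⟩ʳ k) × toℕ (π ⟨$⟩ʳ k) ℕ.< upTo w (lookup w k)

NegativeDecreasing : ∀ {n} → Word n → Permutation′ n → Set
NegativeDecreasing w π = ∀ k l → k Fin.< l → lookup w k ≡ lookup w l →
  lookup w k ℤ.< +0 → (π ⟨$⟩ʳ l) Fin.< (π ⟨$⟩ʳ k)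

PositiveIncreasing : ∀ {n} → Word n → Permutation′ n → Set
PositiveIncreasing w π = ∀ k l → k Fin.< l → lookup w k ≡ lookup w l →
  +0 ℤ.< lookup w k → (π ⟨$⟩ʳ k) Fin.< (π ⟨$⟩ʳ l)

-- The permutations that may be written under w; they differ from one
-- another only in the order of the integers in the block of 0.
Admissible : ∀ {n} → Word n → Permutation′ n → Set
Admissible w π = InBlocks w π × NegativeDecreasing w π × PositiveIncreasing w π

admissible? : ∀ {n} (w : Word n) (π : Permutation′ n) → Dec (Admissible w π)
admissible? w π =
  (Fin.all? λ k → (_ ℕ.≤? _) ×-dec (_ ℕ.<? _))
  ×-dec (Fin.all? λ k → Fin.all? λ l →
    (k Fin.<? l) →-dec (lookup w k ℤ.≟ lookup w l) →-dec (lookup w k ℤ.<? +0) →-dec (_ Fin.<? _))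
  ×-dec (Fin.all? λ k → Fin.all? λ l →
    (k Fin.<? l) →-dec (lookup w k ℤ.≟ lookup w l) →-dec (+0 ℤ.<? lookup w k) →-dec (_ Fin.<? _))

1/ℚ_! : ℕ → ℚ
1/ℚ m ! = (+ 1 ℚ./ (m !)) {{m ℕ.!≢0}}

-- The conditional probability of π given the word w: with m zeros in w,
-- each of the m ! orders of the block of 0 has probability 1 / m !.
arrangementProb : ∀ {n} → Word n → Permutation′ n → ℝ
arrangementProb w π =
  if does (admissible? w π) then fromℚ (1/ℚ zeros !) else 0#
  where zeros = count (ℤ._≟ +0) w

-- μ gives the point masses of the (α, β, γ) shuffle on S_n.
IsShuffle : (α β : ℕ → ℝ) (γ : ℝ) → ∀ {n} → (Permutation′ n → ℝ) → Set
IsShuffle α β γ {n} μ = ∀ π →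
  HasSum (λ (w : Word n) → wordProb α β γ w * arrangementProb w π) (μ π)

------------------------------------------------------------------------
-- Extended power sums

-- The m-th extended power sum of (α, β, γ), defined for m ≥ 1, is x.
IsPowerSum : (α β : ℕ → ℝ) (γ : ℝ) → ℕ → ℝ → Set
IsPowerSum α β γ 0 x = ⊥
IsPowerSum α β γ 1 x = ∃[ a ] ∃[ b ]
  (SeriesSum α a × SeriesSum β b × x ≈ γ + a + b)
IsPowerSum α β γ m@(suc (suc _)) x = ∃[ a ] ∃[ b ]
  (SeriesSum (λ i → α i ^ m) a × SeriesSum (λ i → β i ^ m) b ×
   x ≈ a + (- 1#) ^ suc m * b)

{-# OPTIONS --safe #-}

-- Insert a letter x at each of the n + 1 positions k of a word u of length n
-- and ask for the probability that k becomes a fixed point. Given the word,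
-- the value under position k is uniform on an interval of length c (c = 1
-- unless x = 0), so this is a counting problem, and walking through u shows
-- that the probabilities sum to 1 + ε f, where f is the number of fixed points
-- of u at letters x and ε is the sign of x. Averaging over u, with a finite
-- alphabet of total weight t, this gives for the expected number q(n) of fixed
-- points created by the insertion of x the recursion
-- q(n + 1) = t^(n+1) + ε w q(n), where w is the weight of x. Hence q(n) is the
-- sum of the (ε w)^j t^(n-j), and the expected number of fixed points is a
-- homogenisation of the power sums. Finally the alphabet grows to ℤ, so t → 1.

module Submission where

open import Algebra.Bundles using (CommutativeRing; CommutativeSemiring)
import Algebra.Properties.AbelianGroup as AbelianGroupProperties
import Algebra.Properties.CommutativeSemigroup as CommutativeSemigroupProperties
import Algebra.Properties.CommutativeSemiring.Exp as CommutativeSemiringExp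
import Algebra.Properties.Ring as RingProperties
import Algebra.Properties.Semiring.Exp as SemiringExp
import Algebra.Properties.Semiring.Mult as SemiringMult
import Algebra.Properties.Semiring.Sum as SemiringSum
import Algebra.Solver.Ring.NaturalCoefficients.Default as SemiringSolver
open import Data.Bool.Base using (true; false; if_then_else_)
open import Data.Fin.Base as Fin using (Fin; zero; suc; toℕ; punchIn; fromℕ<)
import Data.Fin.Properties as Fin
open import Data.Fin.Permutation
  using (Permutation′; _⟨$⟩ʳ_; _⟨$⟩ˡ_; insert; inverseʳ)
open import Data.Integer.Base as ℤ using (ℤ; +0; +[1+_]; -[1+_])
import Data.Integer.Properties as ℤ
import Data.Integer.Tactic.RingSolver as ℤ
open import Data.List.Base as List using (List; []; _∷_; _++_; cartesianProductWith)
open import Data.List.Membership.Propositional using (_∈_)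
open import Data.List.Membership.Propositional.Properties
  using (∈-∃++; ∈-++⁺ˡ; ∈-++⁺ʳ; ∈-++⁻; ∈-cartesianProductWith⁺; ∈-cartesianProductWith⁻)
open import Data.List.Relation.Binary.Subset.Propositional using (_⊆_)
open import Data.List.Relation.Unary.All as All using ()
open import Data.List.Relation.Unary.AllPairs using ([]; _∷_)
open import Data.List.Relation.Unary.Any using (here; there)
open import Data.List.Relation.Unary.Unique.Propositional using (Unique)
import Data.List.Relation.Unary.Unique.Propositional.Properties as Unique
open import Data.Nat.Base as ℕ using (ℕ; zero; suc; _!; z≤n; s≤s; z<s; s<s)
import Data.Nat.Coprimality as ℕ
import Data.Nat.Properties as ℕ
open import Data.Nat.Tactic.RingSolver using (solve-∀)
open import Data.Product.Base using (_×_; _,_; proj₁; proj₂; Σ-syntax; ∃-syntax)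
open import Data.Rational.Base as ℚ using (ℚ; 0ℚ; 1ℚ; ½; mkℚ)
import Data.Rational.Properties as ℚ
open import Data.Rational.Solver using (module +-*-Solver)
import Data.Rational.Unnormalised.Base as ℚᵘ
import Data.Rational.Unnormalised.Properties as ℚᵘ
open import Data.Sum.Base using (_⊎_; inj₁; inj₂)
open import Data.Vec.Base as Vec using (Vec; []; _∷_; lookup; count; insertAt)
import Data.Vec.Properties as Vec
open import Function.Base using (_∘_)
open import Function.Bundles using (mk⇔)
open import Level using (0ℓ)
open import Relation.Binary.Definitions using (tri<; tri≈; tri>)
open import Relation.Binary.PropositionalEquality as ≡ using (_≡_; _≢_)
import Relation.Binary.Reasoning.Setoid as SetoidReasoning
open import Relation.Nullary.Decidable
  using (Dec; does; yes; no; _×-dec_; _⊎-dec_; does-⇔; dec-true; dec-false)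
open import Relation.Nullary.Negation using (¬_; contradiction)
open import Relation.Unary using (Pred; Decidable)

open import Defs
  using (Word; below; upTo; InBlocks; NegativeDecreasing; PositiveIncreasing;
         Admissible; admissible?; permutations; fixedPoints)

-- The argument never evaluates the probability that a given position is fixed, only the sum over
-- all positions. A word is cut at a candidate position k into a letter x and the rest u, and the
-- sums are exchanged until x and u are held fixed while k runs. For nonzero x, the difference
-- between the inserted value and k changes by -1 as k passes a letter of u other than x, and by 0
-- (x positive) or -2 (x negative) as it passes a letter x. So it meets 0 once, up to a correction
-- at the letters x on a fixed point of u; this is the source of ε. The other obstacle is
-- constructive: a bounded monotone sequence of reals need not have a limit, yet the point masses
-- and the power sums must be produced as reals. Each is compared with something known to converge
-- (the masses with a power of the total weight, the series of powers with the series itself) such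
-- that the difference is monotone too. The computation for a finite alphabet is carried out over an
-- arbitrary commutative ring, so that limits enter only once the finite identity is complete.

module Sums {c ℓ} (S : CommutativeSemiring c ℓ) where
  open CommutativeSemiring S hiding (zero)
  open SemiringSum semiring public
    using (sum; sum-cong-≋; sum-init-last; ∑-distrib-+; ∑-comm;
           *-distribˡ-sum; *-distribʳ-sum)
  open CommutativeSemigroupProperties +-commutativeSemigroup using (interchange)
  open SetoidReasoning setoid

  private variable
    I J K : Set

  -- Spelled like `sumOver`, so that over the reals the two agree by computation and the results on
  -- `Σ` apply directly to the sums in `𝔼` and `HasSum`.
  Σ : List I → (I → Carrier) → Carrier
  Σ xs f = List.foldr _+_ 0# (List.map f xs)

  Σ-cong : ∀ (xs : List I) {f g} → (∀ i → f i ≈ g i) → Σ xs f ≈ Σ xs g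
  Σ-cong []       f≈g = refl
  Σ-cong (x ∷ xs) f≈g = +-cong (f≈g x) (Σ-cong xs f≈g)

  Σ-zero : ∀ (xs : List I) {f} → (∀ i → f i ≈ 0#) → Σ xs f ≈ 0#
  Σ-zero []       f≈0 = refl
  Σ-zero (x ∷ xs) f≈0 = trans (+-cong (f≈0 x) (Σ-zero xs f≈0)) (+-identityˡ 0#)

  Σ-distrib-+ : ∀ (xs : List I) f g → Σ xs (λ i → f i + g i) ≈ Σ xs f + Σ xs g
  Σ-distrib-+ []       f g = sym (+-identityˡ 0#)
  Σ-distrib-+ (x ∷ xs) f g = trans (+-congˡ (Σ-distrib-+ xs f g)) (interchange _ _ _ _)

  *-distribˡ-Σ : ∀ a (xs : List I) f → a * Σ xs f ≈ Σ xs (λ i → a * f i)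
  *-distribˡ-Σ a []       f = zeroʳ a
  *-distribˡ-Σ a (x ∷ xs) f = trans (distribˡ _ _ _) (+-congˡ (*-distribˡ-Σ a xs f))

  *-distribʳ-Σ : ∀ a (xs : List I) f → Σ xs f * a ≈ Σ xs (λ i → f i * a)
  *-distribʳ-Σ a xs f = trans (*-comm _ a) (trans (*-distribˡ-Σ a xs f) (Σ-cong xs λ i → *-comm a (f i)))

  Σ-comm : ∀ (xs : List I) (ys : List J) (f : I → J → Carrier) →
           Σ xs (λ i → Σ ys (f i)) ≈ Σ ys (λ j → Σ xs (λ i → f i j))
  Σ-comm []       ys f = sym (Σ-zero ys λ _ → refl)
  Σ-comm (x ∷ xs) ys f = trans (+-congˡ (Σ-comm xs ys f)) (sym (Σ-distrib-+ ys (f x) _))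

  Σ-sum-comm : ∀ (xs : List I) {n} (f : I → Fin n → Carrier) →
               Σ xs (λ i → sum (f i)) ≈ sum (λ k → Σ xs (λ i → f i k))
  Σ-sum-comm xs {zero}  f = Σ-zero xs λ _ → refl
  Σ-sum-comm xs {suc n} f = trans
    (Σ-distrib-+ xs (λ i → f i zero) _) (+-congˡ (Σ-sum-comm xs (λ i k → f i (suc k))))

  Σ-++ : ∀ (xs ys : List I) f → Σ (xs ++ ys) f ≈ Σ xs f + Σ ys f
  Σ-++ []       ys f = sym (+-identityˡ _)
  Σ-++ (x ∷ xs) ys f = trans (+-congˡ (Σ-++ xs ys f)) (sym (+-assoc _ _ _))

  Σ-map : ∀ (h : J → I) xs f → Σ (List.map h xs) f ≈ Σ xs (λ j → f (h j))
  Σ-map h []       f = refl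
  Σ-map h (x ∷ xs) f = +-congˡ (Σ-map h xs f)

  Σ-cartesianProductWith : ∀ (h : I → J → K) xs ys f →
    Σ (cartesianProductWith h xs ys) f ≈ Σ xs (λ i → Σ ys (λ j → f (h i j)))
  Σ-cartesianProductWith h []       ys f = refl
  Σ-cartesianProductWith h (x ∷ xs) ys f = trans (Σ-++ (List.map (h x) ys) _ f)
    (+-cong (Σ-map (h x) ys f) (Σ-cartesianProductWith h xs ys f))

  Σ-tabulate : ∀ {n} (h : Fin n → I) f → Σ (List.tabulate h) f ≈ sum (λ k → f (h k))
  Σ-tabulate {n = zero}  h f = refl
  Σ-tabulate {n = suc n} h f = +-congˡ (Σ-tabulate (λ k → h (suc k)) f)

-- Indicators and counting in the natural numbers

module Counting where
  open import Data.Nat.Base using (_+_; _*_; _≤_; _<_)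
  open import Data.Nat.Properties using (_≤?_; _<?_; _≟_)
  open ≡ using (refl; sym; trans; cong; cong₂; subst)
  open Sums ℕ.+-*-commutativeSemiring public
  open ≡.≡-Reasoning

  private variable
    P Q : Set
    n : ℕ

  ⟦_⟧ : Dec P → ℕ
  ⟦ P? ⟧ = if does P? then 1 else 0

  ⟦⟧-cong : (P → Q) → (Q → P) → (P? : Dec P) (Q? : Dec Q) → ⟦ P? ⟧ ≡ ⟦ Q? ⟧
  ⟦⟧-cong f g P? Q? = cong (λ b → if b then 1 else 0) (does-⇔ (mk⇔ f g) P? Q?)

  ⟦⟧-true : (P? : Dec P) → P → ⟦ P? ⟧ ≡ 1
  ⟦⟧-true P? p = cong (λ b → if b then 1 else 0) (dec-true P? p)

  ⟦⟧-false : (P? : Dec P) → ¬ P → ⟦ P? ⟧ ≡ 0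
  ⟦⟧-false P? ¬p = cong (λ b → if b then 1 else 0) (dec-false P? ¬p)

  ⟦⟧-× : (P? : Dec P) (Q? : Dec Q) → ⟦ P? ×-dec Q? ⟧ ≡ ⟦ P? ⟧ * ⟦ Q? ⟧
  ⟦⟧-× (yes _) Q? = sym (ℕ.*-identityˡ _)
  ⟦⟧-× (no _)  Q? = refl

  ⟦⟧-mono : (P → Q) → (P? : Dec P) (Q? : Dec Q) → ⟦ P? ⟧ ≤ ⟦ Q? ⟧
  ⟦⟧-mono f (yes p) Q? = ℕ.≤-reflexive (sym (⟦⟧-true Q? (f p)))
  ⟦⟧-mono f (no _)  Q? = z≤n

  module _ {A : Set} {R : Pred A 0ℓ} (R? : Decidable R) where

    count-∷ : ∀ x (xs : Vec A n) → count R? (x ∷ xs) ≡ ⟦ R? x ⟧ + count R? xs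
    count-∷ x xs with does (R? x)
    ... | true  = refl
    ... | false = refl

    count-yes : ∀ {x} (xs : Vec A n) → R x → count R? (x ∷ xs) ≡ suc (count R? xs)
    count-yes {x = x} xs r = trans (count-∷ x xs) (cong (_+ count R? xs) (⟦⟧-true (R? x) r))

    count-no : ∀ {x} (xs : Vec A n) → ¬ R x → count R? (x ∷ xs) ≡ count R? xs
    count-no {x = x} xs ¬r = trans (count-∷ x xs) (cong (_+ count R? xs) (⟦⟧-false (R? x) ¬r))

    count-insertAt : ∀ (xs : Vec A n) k x → count R? (insertAt xs k x) ≡ count R? (x ∷ xs)
    count-insertAt xs       zero    x = refl
    count-insertAt (y ∷ xs) (suc k) x = begin
      count R? (y ∷ insertAt xs k x)           ≡⟨ count-∷ y (insertAt xs k x) ⟩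
      ⟦ R? y ⟧ + count R? (insertAt xs k x)    ≡⟨ cong (⟦ R? y ⟧ +_) (count-insertAt xs k x) ⟩
      ⟦ R? y ⟧ + count R? (x ∷ xs)             ≡⟨ cong (⟦ R? y ⟧ +_) (count-∷ x xs) ⟩
      ⟦ R? y ⟧ + (⟦ R? x ⟧ + count R? xs)      ≡⟨ swap ⟦ R? y ⟧ ⟦ R? x ⟧ (count R? xs) ⟩
      ⟦ R? x ⟧ + (⟦ R? y ⟧ + count R? xs)      ≡⟨ cong (⟦ R? x ⟧ +_) (count-∷ y xs) ⟨
      ⟦ R? x ⟧ + count R? (y ∷ xs)             ≡⟨ count-∷ x (y ∷ xs) ⟨
      count R? (x ∷ y ∷ xs)                    ∎
      where
      swap : ∀ a b c → a + (b + c) ≡ b + (a + c)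
      swap = solve-∀

  count-mono : ∀ {A : Set} {R S : Pred A 0ℓ} (R? : Decidable R) (S? : Decidable S) →
               (∀ {x} → R x → S x) → (xs : Vec A n) → count R? xs ≤ count S? xs
  count-mono R? S? R⇒S []       = z≤n
  count-mono R? S? R⇒S (x ∷ xs) = ℕ.≤-trans (ℕ.≤-reflexive (count-∷ R? x xs))
    (ℕ.≤-trans (ℕ.+-mono-≤ (⟦⟧-mono R⇒S (R? x) (S? x)) (count-mono R? S? R⇒S xs))
      (ℕ.≤-reflexive (sym (count-∷ S? x xs))))

  sum-const : ∀ n a → sum {n} (λ _ → a) ≡ n * a
  sum-const zero    a = refl
  sum-const (suc n) a = cong (a +_) (sum-const n a)

  sum-pick : ∀ m n → m < n → sum {n} (λ k → ⟦ m ≟ toℕ k ⟧) ≡ 1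
  sum-pick zero    (suc n) _         =
    cong suc (trans (sum-cong-≋ {n} λ k → ⟦⟧-false (0 ≟ suc (toℕ k)) λ ()) (trans (sum-const n 0) (ℕ.*-zeroʳ n)))
  sum-pick (suc m) (suc n) (s<s m<n) = trans
    (cong (_+ sum {n} (λ k → ⟦ suc m ≟ suc (toℕ k) ⟧)) (⟦⟧-false (suc m ≟ 0) λ ()))
    (trans (sum-cong-≋ {n} λ k → ⟦⟧-cong ℕ.suc-injective (cong suc) (suc m ≟ suc (toℕ k)) (m ≟ toℕ k))
      (sum-pick m n m<n))

  InInterval : ℕ → ℕ → ℕ → Set
  InInterval lo c j = lo ≤ j × j < lo + c

  inInterval? : ∀ lo c j → Dec (InInterval lo c j)
  inInterval? lo c j = (lo ≤? j) ×-dec (j <? lo + c)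

  sum-interval : ∀ {n} lo c (g : ℕ → ℕ) → lo + c ≤ n →
    sum {n} (λ j → ⟦ inInterval? lo c (toℕ j) ⟧ * g (toℕ j)) ≡ sum {c} (λ i → g (lo + toℕ i))
  sum-interval {n}     zero     zero    g _        = trans
    (sum-cong-≋ {n} λ j → cong (_* g (toℕ j)) (⟦⟧-false (inInterval? 0 0 (toℕ j)) λ ()))
    (trans (sum-const n 0) (ℕ.*-zeroʳ n))
  sum-interval {suc n} zero     (suc c) g (s≤s le) = cong₂ _+_
    (trans (cong (_* g 0) (⟦⟧-true (inInterval? 0 (suc c) 0) (z≤n , z<s))) (ℕ.*-identityˡ (g 0)))
    (trans (sum-cong-≋ {n} λ j → cong (_* g (suc (toℕ j))) (⟦⟧-cong
        (λ { (_ , s<s lt) → z≤n , lt }) (λ { (_ , lt) → z≤n , s<s lt })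
        (inInterval? 0 (suc c) (suc (toℕ j))) (inInterval? 0 c (toℕ j))))
      (sum-interval {n} 0 c (g ∘ suc) le))
  sum-interval {suc n} (suc lo) c       g (s≤s le) = cong₂ _+_
    (cong (_* g 0) (⟦⟧-false (inInterval? (suc lo) c 0) λ ()))
    (trans (sum-cong-≋ {n} λ j → cong (_* g (suc (toℕ j))) (⟦⟧-cong
        (λ { (s≤s le , s<s lt) → le , lt }) (λ { (le , lt) → s≤s le , s<s lt })
        (inInterval? (suc lo) c (suc (toℕ j))) (inInterval? lo c (toℕ j))))
      (sum-interval {n} lo c (g ∘ suc) le))

  -- The effect of `punchIn j` on underlying naturals, freed from bounds so that it can be
  -- translated and summed over.
  bump : ℕ → ℕ → ℕ
  bump j r = ⟦ j ≤? r ⟧ + r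

  bump-≤ : ∀ {j r} → j ≤ r → bump j r ≡ suc r
  bump-≤ {j} {r} j≤r = cong (_+ r) (⟦⟧-true (j ≤? r) j≤r)

  bump-> : ∀ {j r} → r < j → bump j r ≡ r
  bump-> {j} {r} r<j = cong (_+ r) (⟦⟧-false (j ≤? r) (ℕ.<⇒≱ r<j))

  bump-suc : ∀ j r → bump (suc j) (suc r) ≡ suc (bump j r)
  bump-suc j r = trans
    (cong (_+ suc r) (⟦⟧-cong ℕ.≤-pred s≤s (suc j ≤? suc r) (j ≤? r))) (ℕ.+-suc _ r)

  bump-+ : ∀ b j r → bump (b + j) (b + r) ≡ b + bump j r
  bump-+ zero    j r = refl
  bump-+ (suc b) j r = trans (bump-suc (b + j) (b + r)) (cong suc (bump-+ b j r))

  toℕ-punchIn : ∀ (j : Fin (suc n)) r → toℕ (punchIn j r) ≡ bump (toℕ j) (toℕ r)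
  toℕ-punchIn zero    r       = sym (bump-≤ {0} {toℕ r} z≤n)
  toℕ-punchIn (suc j) zero    = sym (bump-> {suc (toℕ j)} {0} z<s)
  toℕ-punchIn (suc j) (suc r) = trans (cong suc (toℕ-punchIn j r)) (sym (bump-suc (toℕ j) (toℕ r)))

  -- For fixed a, `bump a` enumerates the numbers from 0 to c with a left out. Each of these numbers
  -- is therefore hit for all values of a but one, that is c times. This is what makes the value
  -- under a later zero uniform once the value of an earlier zero has been chosen.
  sum-bump : ∀ c (g : ℕ → ℕ) →
    sum {suc c} (λ a → sum {c} (λ i → g (bump (toℕ a) (toℕ i)))) ≡ c * sum {suc c} (λ i → g (toℕ i))
  sum-bump zero    g = refl
  sum-bump (suc c) g = begin
    sum {suc c} (λ i → g (bump 0 (toℕ i))) +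
      sum {suc c} (λ a → g (bump (suc (toℕ a)) 0) + sum {c} (λ i → g (bump (suc (toℕ a)) (suc (toℕ i)))))
      ≡⟨ cong₂ _+_
           (sum-cong-≋ {suc c} λ i → cong g (bump-≤ {0} {toℕ i} z≤n))
           (sum-cong-≋ {suc c} λ a → cong₂ _+_ (cong g (bump-> {suc (toℕ a)} {0} z<s))
              (sum-cong-≋ {c} λ i → cong g (bump-suc (toℕ a) (toℕ i)))) ⟩
    S + sum {suc c} (λ a → g 0 + sum {c} (λ i → g (suc (bump (toℕ a) (toℕ i)))))
      ≡⟨ cong (S +_) (trans (∑-distrib-+ {suc c} (λ _ → g 0) (λ a → sum {c} (λ i → g (suc (bump (toℕ a) (toℕ i))))))
           (cong₂ _+_ (sum-const (suc c) (g 0)) (sum-bump c (g ∘ suc)))) ⟩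
    S + (suc c * g 0 + c * S)
      ≡⟨ rearrange c (g 0) S ⟩
    suc c * (g 0 + S) ∎
    where
    S = sum {suc c} (λ i → g (suc (toℕ i)))
    rearrange : ∀ c x y → y + (suc c * x + c * y) ≡ suc c * (x + y)
    rearrange = solve-∀

-- Blocks of a word, and how a permutation is built from its first letter

module Blocks where
  open import Data.Nat.Base using (_+_; _*_; _≤_; _<_)
  open import Data.Nat.Properties using (_≤?_)
  open ≡ using (refl; sym; trans; cong; cong₂; subst)
  open Counting
  open ≡.≡-Reasoning

  private variable
    n : ℕ

  zeros : Word n → ℕ
  zeros = count (ℤ._≟ +0)

  upTo≤below : ∀ (v : Word n) {x y} → x ℤ.< y → upTo v x ≤ below v y
  upTo≤below v x<y = count-mono (ℤ._≤? _) (ℤ._<? _) (λ z≤x → ℤ.≤-<-trans z≤x x<y) v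

  below≤upTo : ∀ (v : Word n) x → below v x ≤ upTo v x
  below≤upTo v x = count-mono (ℤ._<? x) (ℤ._≤? x) ℤ.<⇒≤ v

  block-unique : ∀ (w : Word n) a b {t} → below w a ≤ t → t < upTo w a →
                 below w b ≤ t → t < upTo w b → a ≡ b
  block-unique w a b la ua lb ub with ℤ.<-cmp a b
  ... | tri< a<b _ _ = contradiction (ℕ.<-≤-trans ua (ℕ.≤-trans (upTo≤below w a<b) lb)) (ℕ.<-irrefl refl)
  ... | tri≈ _ a≡b _ = a≡b
  ... | tri> _ _ b<a = contradiction (ℕ.<-≤-trans ub (ℕ.≤-trans (upTo≤below w b<a) la)) (ℕ.<-irrefl refl)

  upTo-zero : ∀ (v : Word n) → upTo v +0 ≡ below v +0 + zeros v
  upTo-zero []      = refl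
  upTo-zero (x ∷ v) = begin
    upTo (x ∷ v) +0                                        ≡⟨ count-∷ (ℤ._≤? +0) x v ⟩
    ⟦ x ℤ.≤? +0 ⟧ + upTo v +0                              ≡⟨ cong₂ _+_ (split x) (upTo-zero v) ⟩
    (⟦ x ℤ.<? +0 ⟧ + ⟦ x ℤ.≟ +0 ⟧) + (below v +0 + zeros v) ≡⟨ swap ⟦ x ℤ.<? +0 ⟧ ⟦ x ℤ.≟ +0 ⟧ (below v +0) (zeros v) ⟩
    (⟦ x ℤ.<? +0 ⟧ + below v +0) + (⟦ x ℤ.≟ +0 ⟧ + zeros v) ≡⟨ cong₂ _+_ (count-∷ (ℤ._<? +0) x v) (count-∷ (ℤ._≟ +0) x v) ⟨
    below (x ∷ v) +0 + zeros (x ∷ v)                       ∎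
    where
    split : ∀ x → ⟦ x ℤ.≤? +0 ⟧ ≡ ⟦ x ℤ.<? +0 ⟧ + ⟦ x ℤ.≟ +0 ⟧
    split +0       = refl
    split +[1+ i ] = refl
    split -[1+ i ] = refl
    swap : ∀ a b c d → (a + b) + (c + d) ≡ (a + c) + (b + d)
    swap = solve-∀

  -- The values which the first letter of x ∷ v may carry form an interval.
  lo : ℤ → Word n → ℕ
  lo x@(ℤ.+ _)    v = below v x
  lo x@(-[1+ _ ]) v = upTo v x

  size : ℤ → Word n → ℕ
  size +0 v = suc (zeros v)
  size _  v = 1

  Slot : ℤ → Word n → ℕ → Set
  Slot x v = InInterval (lo x v) (size x v)

  slot? : ∀ x (v : Word n) j → Dec (Slot x v j)
  slot? x v = inInterval? (lo x v) (size x v)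

  below≤lo : ∀ x (v : Word n) → below v x ≤ lo x v
  below≤lo (ℤ.+ _)      v = ℕ.≤-refl
  below≤lo (-[1+ i ]) v = below≤upTo v -[1+ i ]

  lo+size≤ : ∀ x (v : Word n) → lo x v + size x v ≤ suc (upTo v x)
  lo+size≤ +0 v = ℕ.≤-reflexive (trans (ℕ.+-suc _ _) (cong suc (sym (upTo-zero v))))
  lo+size≤ +[1+ i ] v = ℕ.≤-trans (ℕ.≤-reflexive (ℕ.+-comm _ 1)) (s≤s (below≤upTo v +[1+ i ]))
  lo+size≤ (-[1+ i ]) v = ℕ.≤-reflexive (ℕ.+-comm _ 1)

  lo+size≤suc-n : ∀ x (v : Word n) → lo x v + size x v ≤ suc n
  lo+size≤suc-n x v = ℕ.≤-trans (lo+size≤ x v) (s≤s (Vec.count≤n (ℤ._≤? x) v))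

  slot-below : ∀ x (v : Word n) {j} → Slot x v j → below v x ≤ j
  slot-below x v (l , _) = ℕ.≤-trans (below≤lo x v) l

  slot-upTo : ∀ x (v : Word n) {j} → Slot x v j → j ≤ upTo v x
  slot-upTo x v (_ , u) = ℕ.≤-pred (ℕ.<-≤-trans u (lo+size≤ x v))

  -- The new value j lies in the block of `x` or just past its end. If `x` is smaller than `y`, then
  -- j is at most r, so the block of `y` and the value r both move up by one; if `x` is larger,
  -- neither moves. If the letters agree, the block gains one place at its end, and `bump` raises r
  -- by at most one.
  block-∷⁺ : ∀ x (v : Word n) y {j r} → below v x ≤ j → j ≤ upTo v x →
             below v y ≤ r → r < upTo v y →
             below (x ∷ v) y ≤ bump j r × bump j r < upTo (x ∷ v) y
  block-∷⁺ x v y {j} {r} x≤j j≤x y≤r r<y with ℤ.<-cmp x y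
  ... | tri< x<y _ _
    rewrite count-yes (ℤ._<? y) v x<y | count-yes (ℤ._≤? y) v (ℤ.<⇒≤ x<y)
          | bump-≤ (ℕ.≤-trans j≤x (ℕ.≤-trans (upTo≤below v x<y) y≤r)) = s≤s y≤r , s<s r<y
  ... | tri≈ x≮x refl _
    rewrite count-no (ℤ._<? x) v x≮x | count-yes (ℤ._≤? x) v (ℤ.≤-refl {x})
    = ℕ.≤-trans y≤r (ℕ.m≤n+m r _) , s≤s (ℕ.≤-trans (ℕ.+-monoˡ-≤ r (⟦⟧≤1 (j ≤? r))) r<y)
    where
    ⟦⟧≤1 : ∀ {P : Set} (P? : Dec P) → ⟦ P? ⟧ ≤ 1
    ⟦⟧≤1 (yes _) = ℕ.≤-refl
    ⟦⟧≤1 (no _)  = z≤n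
  ... | tri> x≮y _ y<x
    rewrite count-no (ℤ._<? y) v x≮y | count-no (ℤ._≤? y) v (ℤ.<⇒≱ y<x)
          | bump-> (ℕ.<-≤-trans r<y (ℕ.≤-trans (upTo≤below v y<x) x≤j)) = y≤r , r<y

  -- For distinct letters, the order of `x` and `y` already decides whether `bump` raises r, so the
  -- branches in which `j ≤? r` answers otherwise contradict the position of j relative to the block
  -- of `x`.
  block-∷⁻ : ∀ x (v : Word n) y {j r} → below v x ≤ j → j ≤ upTo v x →
             below (x ∷ v) y ≤ bump j r → bump j r < upTo (x ∷ v) y →
             below v y ≤ r × r < upTo v y
  block-∷⁻ x v y {j} {r} x≤j j≤x y≤r r<y with ℤ.<-cmp x y | j ≤? r
  ... | tri< x<y _ _ | yes j≤r
    rewrite bump-≤ j≤r | count-yes (ℤ._<? y) v x<y | count-yes (ℤ._≤? y) v (ℤ.<⇒≤ x<y) = ℕ.≤-pred y≤r , ℕ.≤-pred r<y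
  ... | tri< x<y _ _ | no j≰r
    rewrite bump-> (ℕ.≰⇒> j≰r) | count-yes (ℤ._<? y) v x<y = contradiction
      (ℕ.≤-trans j≤x (ℕ.≤-trans (upTo≤below v x<y) (ℕ.<⇒≤ y≤r))) j≰r
  ... | tri≈ x≮x refl _ | yes j≤r
    rewrite bump-≤ j≤r | count-yes (ℤ._≤? x) v (ℤ.≤-refl {x}) = ℕ.≤-trans x≤j j≤r , ℕ.≤-pred r<y
  ... | tri≈ x≮x refl _ | no j≰r
    rewrite bump-> (ℕ.≰⇒> j≰r) | count-no (ℤ._<? x) v x≮x = y≤r , ℕ.<-≤-trans (ℕ.≰⇒> j≰r) j≤x
  ... | tri> x≮y _ y<x | yes j≤r
    rewrite bump-≤ j≤r | count-no (ℤ._≤? y) v (ℤ.<⇒≱ y<x) = contradiction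
      (ℕ.≤-trans (ℕ.<⇒≤ r<y) (ℕ.≤-trans (upTo≤below v y<x) (ℕ.≤-trans x≤j j≤r))) (ℕ.<⇒≱ (ℕ.n<1+n r))
  ... | tri> x≮y _ y<x | no j≰r
    rewrite bump-> (ℕ.≰⇒> j≰r) | count-no (ℤ._<? y) v x≮y | count-no (ℤ._≤? y) v (ℤ.<⇒≱ y<x) = y≤r , r<y

  punchIn-mono-< : ∀ (j : Fin (suc n)) {r s} → r Fin.< s → punchIn j r Fin.< punchIn j s
  punchIn-mono-< j {r} {s} r<s = ℕ.≰⇒> λ le → ℕ.<⇒≱ r<s (Fin.punchIn-cancel-≤ j s r le)

  punchIn-cancel-< : ∀ (j : Fin (suc n)) {r s} → punchIn j r Fin.< punchIn j s → r Fin.< s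
  punchIn-cancel-< j {r} {s} lt = ℕ.≰⇒> λ le → ℕ.<⇒≱ lt (Fin.punchIn-mono-≤ j s r le)

  -- Conditions between later letters survive because `punchIn` is strictly monotone. Those
  -- involving the first letter hold because the slot of a signed letter is the extreme place of its
  -- enlarged block: the last one for a negative letter, which must carry the largest value, and the
  -- first one for a positive letter.
  admissible-∷⁺ : ∀ x (v : Word n) j ρ → Slot x v (toℕ j) → Admissible v ρ →
                  Admissible (x ∷ v) (insert zero j ρ)
  admissible-∷⁺ {n} x v j ρ slot (blocks , decreasing , increasing) = blocks′ , decreasing′ , increasing′
    where
    blocks′ : InBlocks (x ∷ v) (insert zero j ρ)
    blocks′ zero =
      ℕ.≤-trans (ℕ.≤-reflexive (count-no (ℤ._<? x) v (ℤ.<-irrefl refl))) (slot-below x v slot) ,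
      ℕ.<-≤-trans (s≤s (slot-upTo x v slot)) (ℕ.≤-reflexive (sym (count-yes (ℤ._≤? x) v ℤ.≤-refl)))
    blocks′ (suc k) rewrite toℕ-punchIn j (ρ ⟨$⟩ʳ k) =
      block-∷⁺ x v (lookup v k) (slot-below x v slot) (slot-upTo x v slot) (proj₁ (blocks k)) (proj₂ (blocks k))

    first-decreasing : ∀ x l → Slot x v (toℕ j) → x ≡ lookup v l → x ℤ.< +0 → punchIn j (ρ ⟨$⟩ʳ l) Fin.< j
    first-decreasing (-[1+ i ]) l (upTo≤j , _) x≡ _ = subst (_< toℕ j)
      (sym (trans (toℕ-punchIn j (ρ ⟨$⟩ʳ l)) (bump-> lt))) lt
      where
      lt : toℕ (ρ ⟨$⟩ʳ l) < toℕ j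
      lt = ℕ.<-≤-trans (proj₂ (blocks l)) (subst (λ y → upTo v y ≤ toℕ j) x≡ upTo≤j)
    first-decreasing (ℤ.+ _) l _ _ (ℤ.+<+ ())

    first-increasing : ∀ x l → Slot x v (toℕ j) → x ≡ lookup v l → +0 ℤ.< x → j Fin.< punchIn j (ρ ⟨$⟩ʳ l)
    first-increasing +[1+ i ] l (_ , j<) x≡ _ = subst (toℕ j <_)
      (sym (trans (toℕ-punchIn j (ρ ⟨$⟩ʳ l)) (bump-≤ le))) (s≤s le)
      where
      le : toℕ j ≤ toℕ (ρ ⟨$⟩ʳ l)
      le = ℕ.≤-trans (ℕ.≤-pred (ℕ.≤-trans j< (ℕ.≤-reflexive (ℕ.+-comm _ 1))))
             (subst (λ y → below v y ≤ toℕ (ρ ⟨$⟩ʳ l)) (sym x≡) (proj₁ (blocks l)))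
    first-increasing +0 l _ _ (ℤ.+<+ ())
    first-increasing (-[1+ i ]) l _ _ ()

    decreasing′ : NegativeDecreasing (x ∷ v) (insert zero j ρ)
    decreasing′ zero    (suc l) _         eq x<0 = first-decreasing x l slot eq x<0
    decreasing′ (suc k) (suc l) (s<s k<l) eq y<0 = punchIn-mono-< j (decreasing k l k<l eq y<0)

    increasing′ : PositiveIncreasing (x ∷ v) (insert zero j ρ)
    increasing′ zero    (suc l) _         eq 0<x = first-increasing x l slot eq 0<x
    increasing′ (suc k) (suc l) (s<s k<l) eq 0<y = punchIn-mono-< j (increasing k l k<l eq 0<y)

  -- In each of the two signed cases the extreme value t of the block of x is
  -- attained, at a letter of the same block, hence at a letter x.
  admissible⇒slot : ∀ x (v : Word n) π → Admissible (x ∷ v) π → Slot x v (toℕ (π ⟨$⟩ʳ zero))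
  admissible⇒slot {n} x v π (blocks , decreasing , increasing) = go x refl
    where
    w = x ∷ v
    j = toℕ (π ⟨$⟩ʳ zero)

    below-w : below w x ≡ below v x
    below-w = count-no (ℤ._<? x) v (ℤ.<-irrefl refl)

    upTo-w : upTo w x ≡ suc (upTo v x)
    upTo-w = count-yes (ℤ._≤? x) v ℤ.≤-refl

    below≤j : below v x ≤ j
    below≤j = ℕ.≤-trans (ℕ.≤-reflexive (sym below-w)) (proj₁ (blocks zero))

    j<upTo : j < suc (upTo v x)
    j<upTo = ℕ.<-≤-trans (proj₂ (blocks zero)) (ℕ.≤-reflexive upTo-w)

    attained : ∀ t → below v x ≤ t → t ≤ upTo v x → ∀ {A : Set} →
               (t ≡ j → A) →
               (∀ k → toℕ (π ⟨$⟩ʳ suc k) ≡ t → x ≡ lookup v k → A) → A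
    attained t below≤t t≤upTo {A} first later =
      case (π ⟨$⟩ˡ s) (trans (cong toℕ (inverseʳ π)) (Fin.toℕ-fromℕ< t<suc-n))
      where
      t<suc-n : t < suc n
      t<suc-n = s≤s (ℕ.≤-trans t≤upTo (Vec.count≤n (ℤ._≤? x) v))
      s : Fin (suc n)
      s = fromℕ< t<suc-n
      case : ∀ k → toℕ (π ⟨$⟩ʳ k) ≡ t → A
      case zero    eq = first (sym eq)
      case (suc k) eq = later k eq (block-unique w x (lookup v k)
        (ℕ.≤-trans (ℕ.≤-reflexive below-w) below≤t)
        (ℕ.<-≤-trans (s≤s t≤upTo) (ℕ.≤-reflexive (sym upTo-w)))
        (subst (below w (lookup v k) ≤_) eq (proj₁ (blocks (suc k))))
        (subst (_< upTo w (lookup v k)) eq (proj₂ (blocks (suc k)))))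

    go : ∀ y → y ≡ x → Slot y v j
    go +0 refl = below≤j , ℕ.<-≤-trans j<upTo
      (ℕ.≤-reflexive (trans (cong suc (upTo-zero v)) (sym (ℕ.+-suc _ _))))
    go +[1+ i ] refl = below≤j , ℕ.≤-trans (s≤s j≤below) (ℕ.≤-reflexive (ℕ.+-comm 1 _))
      where
      j≤below : j ≤ below v x
      j≤below = attained (below v x) ℕ.≤-refl (below≤upTo v x) (λ eq → ℕ.≤-reflexive (sym eq))
        λ k eq x≡ → subst (j ≤_) eq (ℕ.<⇒≤ (increasing zero (suc k) z<s x≡ (ℤ.+<+ z<s)))
    go (-[1+ i ]) refl = upTo≤j , ℕ.≤-trans j<upTo (ℕ.≤-reflexive (ℕ.+-comm 1 _))
      where
      upTo≤j : upTo v x ≤ j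
      upTo≤j = attained (upTo v x) (below≤upTo v x) ℕ.≤-refl ℕ.≤-reflexive
        λ k eq x≡ → subst (_≤ j) eq (ℕ.<⇒≤ (decreasing zero (suc k) z<s x≡ ℤ.-<+))

  admissible-∷⁻ : ∀ x (v : Word n) j ρ → Admissible (x ∷ v) (insert zero j ρ) →
                  Slot x v (toℕ j) × Admissible v ρ
  admissible-∷⁻ x v j ρ adm@(blocks , decreasing , increasing) = slot ,
    (λ k → block-∷⁻ x v (lookup v k) (slot-below x v slot) (slot-upTo x v slot)
       (subst (below (x ∷ v) (lookup v k) ≤_) (toℕ-punchIn j (ρ ⟨$⟩ʳ k)) (proj₁ (blocks (suc k))))
       (subst (_< upTo (x ∷ v) (lookup v k)) (toℕ-punchIn j (ρ ⟨$⟩ʳ k)) (proj₂ (blocks (suc k))))) ,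
    (λ k l k<l eq y<0 → punchIn-cancel-< j (decreasing (suc k) (suc l) (s<s k<l) eq y<0)) ,
    (λ k l k<l eq 0<y → punchIn-cancel-< j (increasing (suc k) (suc l) (s<s k<l) eq 0<y))
    where
    slot : Slot x v (toℕ j)
    slot = admissible⇒slot x v (insert zero j ρ) adm

-- Counting admissible permutations; the value under an inserted letter

module Insertion where
  open import Data.Nat.Base using (_+_; _*_; _≤_; _<_)
  open import Data.Nat.Properties using (_≤?_; _≟_)
  open ≡ using (refl; sym; trans; cong; cong₂; subst)
  open Counting
  open Blocks
  open ≡.≡-Reasoning

  private variable
    n : ℕ

  -- All admissible permutations have the same conditional probability 1 / `zeros w` !, so this is
  -- the conditional expectation of `F` given `w`, multiplied by `zeros w` !. The multiple keeps the
  -- combinatorics inside the naturals.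
  Σ-admissible : Word n → (Permutation′ n → ℕ) → ℕ
  Σ-admissible {n} w F = Σ (permutations n) (λ π → ⟦ admissible? w π ⟧ * F π)

  Σ-admissible-cong : ∀ (w : Word n) {F G} → (∀ π → F π ≡ G π) → Σ-admissible w F ≡ Σ-admissible w G
  Σ-admissible-cong {n} w F≡G = Σ-cong (permutations n) λ π → cong (⟦ admissible? w π ⟧ *_) (F≡G π)

  Σ-admissible-*ˡ : ∀ (w : Word n) a F → Σ-admissible w (λ π → a * F π) ≡ a * Σ-admissible w F
  Σ-admissible-*ˡ {n} w a F = trans
    (Σ-cong (permutations n) λ π → swap ⟦ admissible? w π ⟧ a (F π))
    (sym (*-distribˡ-Σ a (permutations n) _))
    where
    swap : ∀ a b c → a * (b * c) ≡ b * (a * c)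
    swap = solve-∀

  -- `permutations` is itself generated by `insert zero`, and the indicator of admissibility splits
  -- into a condition on j and a condition on the remaining permutation, by `admissible-∷⁺` and
  -- `admissible-∷⁻`.
  Σ-admissible-∷ : ∀ x (v : Word n) F → Σ-admissible (x ∷ v) F ≡
    sum {suc n} (λ j → ⟦ slot? x v (toℕ j) ⟧ * Σ-admissible v (F ∘ insert zero j))
  Σ-admissible-∷ {n} x v F = begin
    Σ-admissible (x ∷ v) F
      ≡⟨ Σ-cartesianProductWith (insert zero) (List.allFin (suc n)) (permutations n) _ ⟩
    Σ (List.allFin (suc n)) (λ j → Σ (permutations n) (λ ρ →
      ⟦ admissible? (x ∷ v) (insert zero j ρ) ⟧ * F (insert zero j ρ)))
      ≡⟨ Σ-tabulate (λ j → j) (λ j → Σ (permutations n) (λ ρ →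
           ⟦ admissible? (x ∷ v) (insert zero j ρ) ⟧ * F (insert zero j ρ))) ⟩
    sum {suc n} (λ j → Σ (permutations n) (λ ρ →
      ⟦ admissible? (x ∷ v) (insert zero j ρ) ⟧ * F (insert zero j ρ)))
      ≡⟨ sum-cong-≋ {suc n} (λ j → trans
           (Σ-cong (permutations n) λ ρ → factor j ρ)
           (sym (*-distribˡ-Σ ⟦ slot? x v (toℕ j) ⟧ (permutations n)
             (λ ρ → ⟦ admissible? v ρ ⟧ * F (insert zero j ρ))))) ⟩
    sum {suc n} (λ j → ⟦ slot? x v (toℕ j) ⟧ * Σ-admissible v (F ∘ insert zero j)) ∎
    where
    factor : ∀ j ρ → ⟦ admissible? (x ∷ v) (insert zero j ρ) ⟧ * F (insert zero j ρ) ≡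
                     ⟦ slot? x v (toℕ j) ⟧ * (⟦ admissible? v ρ ⟧ * F (insert zero j ρ))
    factor j ρ = trans
      (cong (_* F (insert zero j ρ)) (trans
        (⟦⟧-cong (admissible-∷⁻ x v j ρ) (λ { (slot , adm) → admissible-∷⁺ x v j ρ slot adm })
          (admissible? (x ∷ v) (insert zero j ρ)) (slot? x v (toℕ j) ×-dec admissible? v ρ))
        (⟦⟧-× (slot? x v (toℕ j)) (admissible? v ρ))))
      (ℕ.*-assoc ⟦ slot? x v (toℕ j) ⟧ _ _)

  sum-slots : ∀ x (v : Word n) (g : ℕ → ℕ) →
    sum {suc n} (λ j → ⟦ slot? x v (toℕ j) ⟧ * g (toℕ j)) ≡ sum {size x v} (λ i → g (lo x v + toℕ i))
  sum-slots x v g = sum-interval (lo x v) (size x v) g (lo+size≤suc-n x v)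

  size*zeros! : ∀ x (v : Word n) → size x v * zeros v ! ≡ zeros (x ∷ v) !
  size*zeros! +0         v = refl
  size*zeros! +[1+ i ]   v = ℕ.*-identityˡ _
  size*zeros! (-[1+ i ]) v = ℕ.*-identityˡ _

  Σ-admissible-1 : ∀ (w : Word n) → Σ-admissible w (λ _ → 1) ≡ zeros w !
  Σ-admissible-1 []      = refl
  Σ-admissible-1 {suc n} (x ∷ v) = begin
    Σ-admissible (x ∷ v) (λ _ → 1)
      ≡⟨ Σ-admissible-∷ x v (λ _ → 1) ⟩
    sum {suc n} (λ j → ⟦ slot? x v (toℕ j) ⟧ * Σ-admissible v (λ _ → 1))
      ≡⟨ sum-slots x v (λ _ → Σ-admissible v (λ _ → 1)) ⟩
    sum {size x v} (λ _ → Σ-admissible v (λ _ → 1))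
      ≡⟨ sum-const (size x v) _ ⟩
    size x v * Σ-admissible v (λ _ → 1)
      ≡⟨ cong (size x v *_) (Σ-admissible-1 v) ⟩
    size x v * zeros v !
      ≡⟨ size*zeros! x v ⟩
    zeros (x ∷ v) ! ∎

  -- Putting y in front of a word raises the values of its letters x by one.
  Before : ℤ → ℤ → Set
  Before y x = y ℤ.< x ⊎ (y ≡ x × +0 ℤ.< x)

  before? : ∀ y x → Dec (Before y x)
  before? y x = (y ℤ.<? x) ⊎-dec ((y ℤ.≟ x) ×-dec (+0 ℤ.<? x))

  -- The least value which the letter x may carry at position k of
  -- insertAt u k x.
  start : Word n → Fin (suc n) → ℤ → ℕ
  start u       zero    x = lo x u
  start (y ∷ u) (suc k) x = ⟦ before? y x ⟧ + start u k x

  before⇒≤ : ∀ {y x} → Before y x → y ℤ.≤ x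
  before⇒≤ (inj₁ y<x)          = ℤ.<⇒≤ y<x
  before⇒≤ (inj₂ (≡.refl , _)) = ℤ.≤-refl

  -- The zeros are in random order, so the interval of an inserted zero is the whole block of 0,
  -- wherever the zero is placed.
  start-zero : ∀ (u : Word n) k → start u k +0 ≡ below u +0
  start-zero u       zero    = refl
  start-zero (y ∷ u) (suc k) = trans
    (cong₂ _+_ (⟦⟧-cong (λ { (inj₁ y<0) → y<0 ; (inj₂ (_ , ℤ.+<+ ())) }) inj₁ (before? y +0) (y ℤ.<? +0))
      (start-zero u k))
    (sym (count-∷ (ℤ._<? +0) y u))

  -- Two zeros are the only pair of letters of which one affects the size of the interval of the
  -- other. In all other cases the sizes agree by computation once the signs are known, which is why
  -- `pair` runs through the signs.
  data Pair : ℤ → ℤ → Set where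
    both-zero : Pair +0 +0
    other     : ∀ {y x} → (y ≡ +0 → x ≢ +0) →
                (∀ {n} (u : Word n) → size x (y ∷ u) ≡ size x u ×
                                              size y (x ∷ u) ≡ size y u) → Pair y x

  pair : ∀ y x → Pair y x
  pair +0         +0         = both-zero
  pair +0         +[1+ _ ]   = other (λ _ ()) λ _ → refl , refl
  pair +0         (-[1+ _ ]) = other (λ _ ()) λ _ → refl , refl
  pair +[1+ _ ]   +0         = other (λ ()) λ _ → refl , refl
  pair +[1+ _ ]   +[1+ _ ]   = other (λ ()) λ _ → refl , refl
  pair +[1+ _ ]   (-[1+ _ ]) = other (λ ()) λ _ → refl , refl
  pair (-[1+ _ ]) +0         = other (λ ()) λ _ → refl , refl
  pair (-[1+ _ ]) +[1+ _ ]   = other (λ ()) λ _ → refl , refl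
  pair (-[1+ _ ]) (-[1+ _ ]) = other (λ ()) λ _ → refl , refl

  below≤start : ∀ (u : Word n) k x → below u x ≤ start u k x
  below≤start u       zero    x = below≤lo x u
  below≤start (y ∷ u) (suc k) x = ℕ.≤-trans (ℕ.≤-reflexive (count-∷ (ℤ._<? x) y u))
    (ℕ.+-mono-≤ (⟦⟧-mono inj₁ (y ℤ.<? x) (before? y x)) (below≤start u k x))

  start+size≤ : ∀ (u : Word n) k x → start u k x + size x u ≤ suc (upTo u x)
  start+size≤ u       zero    x = lo+size≤ x u
  start+size≤ (y ∷ u) (suc k) x with pair y x
  ... | both-zero = ℕ.≤-trans (ℕ.≤-reflexive (ℕ.+-suc (start u k +0) (suc (zeros u))))
    (s≤s (start+size≤ u k +0))
  ... | other _ sizes = ℕ.≤-trans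
    (ℕ.≤-reflexive (trans (cong (⟦ before? y x ⟧ + start u k x +_) (proj₁ (sizes u)))
      (ℕ.+-assoc ⟦ before? y x ⟧ _ _)))
    (ℕ.≤-trans (ℕ.+-mono-≤ (⟦⟧-mono before⇒≤ (before? y x) (y ℤ.≤? x)) (start+size≤ u k x))
      (ℕ.≤-reflexive (trans (ℕ.+-suc _ _) (cong suc (sym (count-∷ (ℤ._≤? x) y u))))))

  size-insertAt : ∀ y (u : Word n) k x → size y (insertAt u k x) ≡ size y (x ∷ u)
  size-insertAt +0         u k x = cong suc (count-insertAt (ℤ._≟ +0) u k x)
  size-insertAt +[1+ _ ]   u k x = refl
  size-insertAt (-[1+ _ ]) u k x = refl

  below-insertAt-≮ : ∀ (u : Word n) k x y → ¬ (x ℤ.< y) → below (insertAt u k x) y ≡ below u y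
  below-insertAt-≮ u k x y x≮y = trans (count-insertAt (ℤ._<? y) u k x) (count-no (ℤ._<? y) u x≮y)

  upTo-insertAt : ∀ (u : Word n) k x → upTo (insertAt u k x) x ≡ suc (upTo u x)
  upTo-insertAt u k x = trans (count-insertAt (ℤ._≤? x) u k x) (count-yes (ℤ._≤? x) u ℤ.≤-refl)

  slot≤start : ∀ y (u : Word n) k x {j} → Before y x → Slot y (insertAt u k x) j → j ≤ start u k x
  slot≤start y u k x (inj₁ y<x) slot = ℕ.≤-trans (slot-upTo y (insertAt u k x) slot)
    (ℕ.≤-trans (upTo≤below (insertAt u k x) y<x)
      (ℕ.≤-trans (ℕ.≤-reflexive (below-insertAt-≮ u k x x (ℤ.<-irrefl refl))) (below≤start u k x)))
  slot≤start +[1+ i ] u k x (inj₂ (refl , _)) (_ , j<) =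
    ℕ.≤-trans (ℕ.≤-pred (ℕ.<-≤-trans j< (ℕ.≤-reflexive (ℕ.+-comm _ 1))))
      (ℕ.≤-trans (ℕ.≤-reflexive (below-insertAt-≮ u k x x (ℤ.<-irrefl refl))) (below≤start u k x))
  slot≤start +0 u k x (inj₂ (refl , ℤ.+<+ ())) _
  slot≤start (-[1+ _ ]) u k x (inj₂ (refl , ())) _

  start+size≤slot : ∀ y (u : Word n) k x {j} → (y ≡ +0 → x ≢ +0) → ¬ Before y x →
                    Slot y (insertAt u k x) j → start u k x + size x u ≤ j
  start+size≤slot y u k x {j} not-both ¬before slot@(lo≤j , _) =
    ℕ.≤-trans (start+size≤ u k x) (ℕ.≤-trans (ℕ.≤-reflexive (sym (upTo-insertAt u k x))) upTo≤j)
    where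
    v = insertAt u k x
    upTo≤j : upTo v x ≤ j
    upTo≤j with ℤ.<-cmp x y
    ... | tri< x<y _ _ = ℕ.≤-trans (upTo≤below v x<y) (slot-below y v slot)
    ... | tri> _ _ y<x = contradiction (inj₁ y<x) ¬before
    ... | tri≈ _ x≡y _ = negative x
      (λ x≡0 → not-both (trans (sym x≡y) x≡0) x≡0)
      (λ 0<x → ¬before (inj₂ (sym x≡y , 0<x)))
      (subst (λ z → lo z v ≤ j) (sym x≡y) lo≤j)
      where
      negative : ∀ z → z ≢ +0 → ¬ (+0 ℤ.< z) → lo z v ≤ j → upTo v z ≤ j
      negative +0         z≢0 _   _  = contradiction refl z≢0
      negative +[1+ _ ]   _   0≮z _  = contradiction (ℤ.+<+ z<s) 0≮z
      negative (-[1+ _ ]) _   _   le = le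

  slot-member : ∀ y (v : Word n) (a : Fin (size y v)) → Slot y v (lo y v + toℕ a)
  slot-member y v a = ℕ.m≤m+n _ _ , ℕ.+-monoʳ-< _ (Fin.toℕ<n a)

  -- Unless both letters are zero, the value of the front letter `y` lies on one side of the whole
  -- interval of `x`. Hence `bump` acts on that interval as a translation, by one if `y` comes
  -- before `x` and by nothing otherwise.
  bump-slot : ∀ y (u : Word n) k x {j} i → (y ≡ +0 → x ≢ +0) → Slot y (insertAt u k x) j →
              i < size x u → bump j (start u k x + i) ≡ ⟦ before? y x ⟧ + start u k x + i
  bump-slot y u k x {j} i not-both slot i<size with before? y x
  ... | yes before = trans
    (bump-≤ (ℕ.≤-trans (slot≤start y u k x before slot) (ℕ.m≤m+n _ i)))
    (cong (λ b → b + start u k x + i) (sym (⟦⟧-true (before? y x) before)))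
  ... | no ¬before = trans
    (bump-> (ℕ.<-≤-trans (ℕ.+-monoʳ-< (start u k x) i<size) (start+size≤slot y u k x not-both ¬before slot)))
    (cong (λ b → b + start u k x + i) (sym (⟦⟧-false (before? y x) ¬before)))

  Σ-admissible-const : ∀ (w : Word n) a → Σ-admissible w (λ _ → a) ≡ zeros w ! * a
  Σ-admissible-const w a = begin
    Σ-admissible w (λ _ → a)      ≡⟨ Σ-admissible-cong w (λ _ → sym (ℕ.*-identityʳ a)) ⟩
    Σ-admissible w (λ _ → a * 1)  ≡⟨ Σ-admissible-*ˡ w a (λ _ → 1) ⟩
    a * Σ-admissible w (λ _ → 1)  ≡⟨ cong (a *_) (Σ-admissible-1 w) ⟩
    a * zeros w !                 ≡⟨ ℕ.*-comm a _ ⟩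
    zeros w ! * a                 ∎

  -- Given the word, the value under position k is uniform on an interval.
  value-distribution : ∀ (u : Word n) k x (f : ℕ → ℕ) →
    Σ-admissible (insertAt u k x) (λ π → f (toℕ (π ⟨$⟩ʳ k))) ≡
    zeros u ! * sum {size x u} (λ i → f (start u k x + toℕ i))
  value-distribution {n} u zero x f = begin
    Σ-admissible (x ∷ u) (λ π → f (toℕ (π ⟨$⟩ʳ zero)))
      ≡⟨ Σ-admissible-∷ x u _ ⟩
    sum {suc n} (λ j → ⟦ slot? x u (toℕ j) ⟧ * Σ-admissible u (λ _ → f (toℕ j)))
      ≡⟨ sum-cong-≋ {suc n} (λ j → cong (⟦ slot? x u (toℕ j) ⟧ *_) (Σ-admissible-const u (f (toℕ j)))) ⟩
    sum {suc n} (λ j → ⟦ slot? x u (toℕ j) ⟧ * (zeros u ! * f (toℕ j)))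
      ≡⟨ sum-slots x u (λ j → zeros u ! * f j) ⟩
    sum {size x u} (λ i → zeros u ! * f (lo x u + toℕ i))
      ≡⟨ *-distribˡ-sum {size x u} (zeros u !) (λ i → f (lo x u + toℕ i)) ⟨
    zeros u ! * sum {size x u} (λ i → f (lo x u + toℕ i)) ∎
  value-distribution {suc n} (y ∷ u) (suc k) x f = begin
    Σ-admissible (y ∷ v) (λ π → f (toℕ (π ⟨$⟩ʳ suc k)))
      ≡⟨ Σ-admissible-∷ y v _ ⟩
    sum {suc (suc n)} (λ j → ⟦ slot? y v (toℕ j) ⟧ * Σ-admissible v (λ ρ → f (toℕ (punchIn j (ρ ⟨$⟩ʳ k)))))
      ≡⟨ sum-cong-≋ {suc (suc n)} (λ j → cong (⟦ slot? y v (toℕ j) ⟧ *_) (trans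
           (Σ-admissible-cong v (λ ρ → cong f (toℕ-punchIn j (ρ ⟨$⟩ʳ k))))
           (value-distribution u k x (f ∘ bump (toℕ j))))) ⟩
    sum {suc (suc n)} (λ j → ⟦ slot? y v (toℕ j) ⟧ * (zeros u ! * values (toℕ j)))
      ≡⟨ sum-slots y v (λ j → zeros u ! * values j) ⟩
    sum {size y v} (λ a → zeros u ! * values (lo y v + toℕ a))
      ≡⟨ *-distribˡ-sum {size y v} (zeros u !) (λ a → values (lo y v + toℕ a)) ⟨
    zeros u ! * sum {size y v} (λ a → values (lo y v + toℕ a))
      ≡⟨ finish y x v refl (pair y x) ⟩
    zeros (y ∷ u) ! * sum {size x (y ∷ u)} (λ i → f (start (y ∷ u) (suc k) x + toℕ i)) ∎
    where
    v = insertAt u k x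

    regroup : ∀ a b c → a * (b * c) ≡ b * a * c
    regroup = solve-∀

    values : ℕ → ℕ
    values j = sum {size x u} (λ i → f (bump j (start u k x + toℕ i)))

    -- The letters and the word are generalised here so that matching on `Pair` can replace both
    -- letters by `+0`.
    finish : ∀ y x v → v ≡ insertAt u k x → Pair y x →
      zeros u ! * sum {size y v} (λ a → sum {size x u} (λ i → f (bump (lo y v + toℕ a) (start u k x + toℕ i)))) ≡
      zeros (y ∷ u) ! * sum {size x (y ∷ u)} (λ i → f (start (y ∷ u) (suc k) x + toℕ i))
    finish y x v refl (other not-both sizes) = begin
      zeros u ! * sum {size y v} (λ a → sum {size x u} (λ i → f (bump (lo y v + toℕ a) (start u k x + toℕ i))))
        ≡⟨ cong (zeros u ! *_) (sum-cong-≋ {size y v} λ a → sum-cong-≋ {size x u} λ i →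
             cong f (bump-slot y u k x (toℕ i) not-both (slot-member y v a) (Fin.toℕ<n i))) ⟩
      zeros u ! * sum {size y v} (λ a → T (size x u))
        ≡⟨ cong (zeros u ! *_) (sum-const (size y v) (T (size x u))) ⟩
      zeros u ! * (size y v * T (size x u))
        ≡⟨ cong₂ (λ c d → zeros u ! * (c * T d))
             (trans (size-insertAt y u k x) (proj₂ (sizes u))) (sym (proj₁ (sizes u))) ⟩
      zeros u ! * (size y u * T (size x (y ∷ u)))
        ≡⟨ regroup (zeros u !) (size y u) (T (size x (y ∷ u))) ⟩
      size y u * zeros u ! * T (size x (y ∷ u))
        ≡⟨ cong (_* T (size x (y ∷ u))) (size*zeros! y u) ⟩
      zeros (y ∷ u) ! * T (size x (y ∷ u)) ∎
      where
      T : ℕ → ℕ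
      T c = sum {c} (λ i → f (start (y ∷ u) (suc k) x + toℕ i))
    -- The front zero takes any of the `suc c` places of the common block and the zero at position k
    -- any of the c places left. The factor c produced by `sum-bump` completes `zeros u !` to the
    -- factorial for one more zero.
    finish .+0 .+0 v refl both-zero = begin
      zeros u ! * sum {size +0 v} (λ a → sum {c} (λ i → f (bump (below v +0 + toℕ a) (start u k +0 + toℕ i))))
        ≡⟨ cong₂ (λ d b → zeros u ! * sum {d} (λ a → sum {c} (λ i → f (bump (b + toℕ a) (start u k +0 + toℕ i)))))
             (size-insertAt +0 u k +0)
             (trans (below-insertAt-≮ u k +0 +0 λ { (ℤ.+<+ ()) }) (sym (start-zero u k))) ⟩
      zeros u ! * sum {suc c} (λ a → sum {c} (λ i → f (bump (start u k +0 + toℕ a) (start u k +0 + toℕ i))))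
        ≡⟨ cong (zeros u ! *_) (sum-cong-≋ {suc c} λ a → sum-cong-≋ {c} λ i →
             cong f (bump-+ (start u k +0) (toℕ a) (toℕ i))) ⟩
      zeros u ! * sum {suc c} (λ a → sum {c} (λ i → f (start u k +0 + bump (toℕ a) (toℕ i))))
        ≡⟨ cong (zeros u ! *_) (sum-bump c (λ i → f (start u k +0 + i))) ⟩
      zeros u ! * (c * sum {suc c} (λ i → f (start u k +0 + toℕ i)))
        ≡⟨ regroup (zeros u !) c (sum {suc c} (λ i → f (start u k +0 + toℕ i))) ⟩
      c * zeros u ! * sum {suc c} (λ i → f (start u k +0 + toℕ i)) ∎
      where
      c = suc (zeros u)

  -- Counting the fixed points created by an insertion

  -- The value start of the letter x put back at position k, after the letter
  -- at position k has been deleted from the word.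
  startWithout : Word n → Fin n → ℤ → ℕ
  startWithout (y ∷ u) zero    x = lo x u
  startWithout (y ∷ u) (suc k) x = ⟦ before? y x ⟧ + startWithout u k x

  startWithout-insertAt : ∀ (u : Word n) k y x → startWithout (insertAt u k y) k x ≡ start u k x
  startWithout-insertAt u       zero    y x = refl
  startWithout-insertAt (z ∷ u) (suc k) y x = cong (⟦ before? z x ⟧ +_) (startWithout-insertAt u k y x)

  -- The offset d makes the induction on the word possible: skipping a letter
  -- that is not Before x raises it by one. Fixed points correspond to d = 0.
  insertions : ℕ → Word n → ℤ → ℕ
  insertions {n} d u x = sum {suc n} (λ k → ⟦ start u k x ≟ toℕ k + d ⟧)

  -- For nonzero `x`, `startWithout` at a letter `x` is the value which that letter carries, so d =
  -- 0 counts the fixed points of `u` at letters `x`.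
  occurrences : ℕ → Word n → ℤ → ℕ
  occurrences {n} d u x = sum {n} (λ k → ⟦ lookup u k ℤ.≟ x ⟧ * ⟦ startWithout u k x ≟ toℕ k + d ⟧)

  match-before : ∀ {y x} s k d → Before y x →
                 ⟦ ⟦ before? y x ⟧ + s ≟ suc (k + d) ⟧ ≡ ⟦ s ≟ k + d ⟧
  match-before {y} {x} s k d before = trans
    (cong (λ b → ⟦ b + s ≟ suc (k + d) ⟧) (⟦⟧-true (before? y x) before))
    (⟦⟧-cong ℕ.suc-injective (cong suc) (suc s ≟ suc (k + d)) (s ≟ k + d))

  match-after : ∀ {y x} s k d → ¬ Before y x →
                ⟦ ⟦ before? y x ⟧ + s ≟ suc (k + d) ⟧ ≡ ⟦ s ≟ k + suc d ⟧
  match-after {y} {x} s k d ¬before = trans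
    (cong (λ b → ⟦ b + s ≟ suc (k + d) ⟧) (⟦⟧-false (before? y x) ¬before))
    (cong (λ m → ⟦ s ≟ m ⟧) (sym (ℕ.+-suc k d)))

  insertions-before : ∀ d y (u : Word n) x → Before y x →
    insertions d (y ∷ u) x ≡ ⟦ lo x (y ∷ u) ≟ d ⟧ + insertions d u x
  insertions-before {n} d y u x before = cong (⟦ lo x (y ∷ u) ≟ d ⟧ +_)
    (sum-cong-≋ {suc n} λ k → match-before (start u k x) (toℕ k) d before)

  insertions-after : ∀ d y (u : Word n) x → ¬ Before y x →
    insertions d (y ∷ u) x ≡ ⟦ lo x (y ∷ u) ≟ d ⟧ + insertions (suc d) u x
  insertions-after {n} d y u x ¬before = cong (⟦ lo x (y ∷ u) ≟ d ⟧ +_)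
    (sum-cong-≋ {suc n} λ k → match-after (start u k x) (toℕ k) d ¬before)

  occurrences-before : ∀ d y (u : Word n) x → Before y x →
    occurrences d (y ∷ u) x ≡ ⟦ y ℤ.≟ x ⟧ * ⟦ lo x u ≟ d ⟧ + occurrences d u x
  occurrences-before {n} d y u x before = cong (⟦ y ℤ.≟ x ⟧ * ⟦ lo x u ≟ d ⟧ +_)
    (sum-cong-≋ {n} λ k → cong (⟦ lookup u k ℤ.≟ x ⟧ *_) (match-before (startWithout u k x) (toℕ k) d before))

  occurrences-after : ∀ d y (u : Word n) x → ¬ Before y x →
    occurrences d (y ∷ u) x ≡ ⟦ y ℤ.≟ x ⟧ * ⟦ lo x u ≟ d ⟧ + occurrences (suc d) u x
  occurrences-after {n} d y u x ¬before = cong (⟦ y ℤ.≟ x ⟧ * ⟦ lo x u ≟ d ⟧ +_)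
    (sum-cong-≋ {n} λ k → cong (⟦ lookup u k ℤ.≟ x ⟧ *_) (match-after (startWithout u k x) (toℕ k) d ¬before))

  ≤?-suc : ∀ d b → ⟦ d ≤? suc b ⟧ ≡ ⟦ suc b ≟ d ⟧ + ⟦ d ≤? b ⟧
  ≤?-suc d b with ℕ.<-cmp d (suc b)
  ... | tri< d<sb d≢sb _ = trans (⟦⟧-true (d ≤? suc b) (ℕ.<⇒≤ d<sb))
    (sym (cong₂ _+_ (⟦⟧-false (suc b ≟ d) (λ eq → d≢sb (sym eq))) (⟦⟧-true (d ≤? b) (ℕ.≤-pred d<sb))))
  ... | tri≈ _ refl _ = trans (⟦⟧-true (suc b ≤? suc b) ℕ.≤-refl)
    (sym (cong₂ _+_ (⟦⟧-true (suc b ≟ suc b) refl) (⟦⟧-false (suc b ≤? b) (ℕ.<⇒≱ ℕ.≤-refl))))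
  ... | tri> d≮sb d≢sb sb<d = trans (⟦⟧-false (d ≤? suc b) (ℕ.<⇒≱ sb<d))
    (sym (cong₂ _+_ (⟦⟧-false (suc b ≟ d) (λ eq → d≢sb (sym eq)))
      (⟦⟧-false (d ≤? b) λ d≤b → d≮sb (s≤s d≤b))))

  ≤?-split : ∀ d b → ⟦ d ≤? b ⟧ ≡ ⟦ b ≟ d ⟧ + ⟦ suc d ≤? b ⟧
  ≤?-split d b with ℕ.<-cmp d b
  ... | tri< d<b d≢b _ = trans (⟦⟧-true (d ≤? b) (ℕ.<⇒≤ d<b))
    (sym (cong₂ _+_ (⟦⟧-false (b ≟ d) (λ eq → d≢b (sym eq))) (⟦⟧-true (suc d ≤? b) d<b)))
  ... | tri≈ _ refl _ = trans (⟦⟧-true (b ≤? b) ℕ.≤-refl)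
    (sym (cong₂ _+_ (⟦⟧-true (b ≟ b) refl) (⟦⟧-false (suc b ≤? b) (ℕ.<⇒≱ ℕ.≤-refl))))
  ... | tri> _ d≢b b<d = trans (⟦⟧-false (d ≤? b) (ℕ.<⇒≱ b<d))
    (sym (cong₂ _+_ (⟦⟧-false (b ≟ d) (λ eq → d≢b (sym eq)))
      (⟦⟧-false (suc d ≤? b) λ d<b → ℕ.<⇒≱ b<d (ℕ.<⇒≤ d<b))))

  -- Follow the height `start u k x` - k as k grows. It begins at `below u x`, ends at or below 0,
  -- drops by one past a letter other than `x` and stays level past a letter `x`. A level d up to
  -- `below u x` is therefore met once, and once more for every letter `x` passed at that level; at
  -- such a letter `startWithout` equals `start`, so these are the terms of `occurrences`.
  insertions-positive : ∀ d (u : Word n) i → let x = +[1+ i ] in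
    insertions d u x ≡ ⟦ d ≤? below u x ⟧ + occurrences d u x
  insertions-positive d [] i = cong (_+ 0)
    (⟦⟧-cong (λ { refl → z≤n }) (λ { z≤n → refl }) (0 ≟ d) (d ≤? 0))
  insertions-positive d (y ∷ u) i with ℤ.<-cmp y +[1+ i ]
  ... | tri< y<x y≢x _ = begin
    insertions d (y ∷ u) x
      ≡⟨ insertions-before d y u x (inj₁ y<x) ⟩
    ⟦ below (y ∷ u) x ≟ d ⟧ + insertions d u x
      ≡⟨ cong₂ (λ b c → ⟦ b ≟ d ⟧ + c) below-∷ (insertions-positive d u i) ⟩
    ⟦ suc (below u x) ≟ d ⟧ + (⟦ d ≤? below u x ⟧ + occurrences d u x)
      ≡⟨ ℕ.+-assoc ⟦ suc (below u x) ≟ d ⟧ _ _ ⟨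
    ⟦ suc (below u x) ≟ d ⟧ + ⟦ d ≤? below u x ⟧ + occurrences d u x
      ≡⟨ cong₂ _+_ (trans (sym (≤?-suc d (below u x))) (cong (λ b → ⟦ d ≤? b ⟧) (sym below-∷)))
           (sym (trans (occurrences-before d y u x (inj₁ y<x))
             (cong (λ b → b * ⟦ lo x u ≟ d ⟧ + occurrences d u x) (⟦⟧-false (y ℤ.≟ x) y≢x)))) ⟩
    ⟦ d ≤? below (y ∷ u) x ⟧ + occurrences d (y ∷ u) x ∎
    where
    x = +[1+ i ]
    below-∷ : below (y ∷ u) x ≡ suc (below u x)
    below-∷ = count-yes (ℤ._<? x) u y<x
  ... | tri≈ y≮x y≡x _ = begin
    insertions d (y ∷ u) x
      ≡⟨ insertions-before d y u x before ⟩
    ⟦ below (y ∷ u) x ≟ d ⟧ + insertions d u x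
      ≡⟨ cong₂ (λ b c → ⟦ b ≟ d ⟧ + c) below-∷ (insertions-positive d u i) ⟩
    ⟦ below u x ≟ d ⟧ + (⟦ d ≤? below u x ⟧ + occurrences d u x)
      ≡⟨ rearrange ⟦ below u x ≟ d ⟧ ⟦ d ≤? below u x ⟧ _ ⟩
    ⟦ d ≤? below u x ⟧ + (1 * ⟦ below u x ≟ d ⟧ + occurrences d u x)
      ≡⟨ cong₂ _+_ (cong (λ b → ⟦ d ≤? b ⟧) (sym below-∷))
           (sym (trans (occurrences-before d y u x before)
             (cong (λ b → b * ⟦ lo x u ≟ d ⟧ + occurrences d u x) (⟦⟧-true (y ℤ.≟ x) y≡x)))) ⟩
    ⟦ d ≤? below (y ∷ u) x ⟧ + occurrences d (y ∷ u) x ∎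
    where
    x = +[1+ i ]
    before : Before y x
    before = inj₂ (y≡x , ℤ.+<+ z<s)
    below-∷ : below (y ∷ u) x ≡ below u x
    below-∷ = count-no (ℤ._<? x) u y≮x
    rearrange : ∀ a b c → a + (b + c) ≡ b + (1 * a + c)
    rearrange = solve-∀
  ... | tri> y≮x y≢x _ = begin
    insertions d (y ∷ u) x
      ≡⟨ insertions-after d y u x ¬before ⟩
    ⟦ below (y ∷ u) x ≟ d ⟧ + insertions (suc d) u x
      ≡⟨ cong₂ (λ b c → ⟦ b ≟ d ⟧ + c) below-∷ (insertions-positive (suc d) u i) ⟩
    ⟦ below u x ≟ d ⟧ + (⟦ suc d ≤? below u x ⟧ + occurrences (suc d) u x)
      ≡⟨ ℕ.+-assoc ⟦ below u x ≟ d ⟧ _ _ ⟨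
    ⟦ below u x ≟ d ⟧ + ⟦ suc d ≤? below u x ⟧ + occurrences (suc d) u x
      ≡⟨ cong₂ _+_ (trans (sym (≤?-split d (below u x))) (cong (λ b → ⟦ d ≤? b ⟧) (sym below-∷)))
           (sym (trans (occurrences-after d y u x ¬before)
             (cong (λ b → b * ⟦ lo x u ≟ d ⟧ + occurrences (suc d) u x) (⟦⟧-false (y ℤ.≟ x) y≢x)))) ⟩
    ⟦ d ≤? below (y ∷ u) x ⟧ + occurrences d (y ∷ u) x ∎
    where
    x = +[1+ i ]
    ¬before : ¬ Before y x
    ¬before (inj₁ y<x)       = y≮x y<x
    ¬before (inj₂ (y≡x , _)) = y≢x y≡x
    below-∷ : below (y ∷ u) x ≡ below u x
    below-∷ = count-no (ℤ._<? x) u y≮x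

  -- The height `start u k x` - k now begins at `upTo u x` and drops by one past a letter other than
  -- `x`, but by two past a letter `x`. So a level d up to `upTo u x` is either met once or jumped
  -- over once. The level jumped over at a letter `x` is the one given by `startWithout`, and
  -- `occurrences` records the jump.
  insertions-negative : ∀ d (u : Word n) i → let x = -[1+ i ] in
    insertions d u x + occurrences d u x ≡ ⟦ d ≤? upTo u x ⟧
  insertions-negative d [] i = trans (trans (ℕ.+-identityʳ _) (ℕ.+-identityʳ _))
    (⟦⟧-cong (λ { refl → z≤n }) (λ { z≤n → refl }) (0 ≟ d) (d ≤? 0))
  insertions-negative d (y ∷ u) i with ℤ.<-cmp y -[1+ i ]
  ... | tri< y<x y≢x _ = begin
    insertions d (y ∷ u) x + occurrences d (y ∷ u) x
      ≡⟨ cong₂ _+_ (insertions-before d y u x (inj₁ y<x))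
           (trans (occurrences-before d y u x (inj₁ y<x))
             (cong (λ b → b * ⟦ lo x u ≟ d ⟧ + occurrences d u x) (⟦⟧-false (y ℤ.≟ x) y≢x))) ⟩
    ⟦ upTo (y ∷ u) x ≟ d ⟧ + insertions d u x + occurrences d u x
      ≡⟨ ℕ.+-assoc ⟦ upTo (y ∷ u) x ≟ d ⟧ _ _ ⟩
    ⟦ upTo (y ∷ u) x ≟ d ⟧ + (insertions d u x + occurrences d u x)
      ≡⟨ cong₂ (λ b c → ⟦ b ≟ d ⟧ + c) upTo-∷ (insertions-negative d u i) ⟩
    ⟦ suc (upTo u x) ≟ d ⟧ + ⟦ d ≤? upTo u x ⟧
      ≡⟨ ≤?-suc d (upTo u x) ⟨
    ⟦ d ≤? suc (upTo u x) ⟧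
      ≡⟨ cong (λ b → ⟦ d ≤? b ⟧) upTo-∷ ⟨
    ⟦ d ≤? upTo (y ∷ u) x ⟧ ∎
    where
    x = -[1+ i ]
    upTo-∷ : upTo (y ∷ u) x ≡ suc (upTo u x)
    upTo-∷ = count-yes (ℤ._≤? x) u (ℤ.<⇒≤ y<x)
  ... | tri≈ y≮x y≡x _ = begin
    insertions d (y ∷ u) x + occurrences d (y ∷ u) x
      ≡⟨ cong₂ _+_ (insertions-after d y u x ¬before)
           (trans (occurrences-after d y u x ¬before)
             (cong (λ b → b * ⟦ lo x u ≟ d ⟧ + occurrences (suc d) u x) (⟦⟧-true (y ℤ.≟ x) y≡x))) ⟩
    ⟦ upTo (y ∷ u) x ≟ d ⟧ + insertions (suc d) u x + (1 * ⟦ upTo u x ≟ d ⟧ + occurrences (suc d) u x)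
      ≡⟨ rearrange ⟦ upTo (y ∷ u) x ≟ d ⟧ (insertions (suc d) u x) ⟦ upTo u x ≟ d ⟧ _ ⟩
    ⟦ upTo (y ∷ u) x ≟ d ⟧ + (⟦ upTo u x ≟ d ⟧ + (insertions (suc d) u x + occurrences (suc d) u x))
      ≡⟨ cong₂ (λ b c → ⟦ b ≟ d ⟧ + (⟦ upTo u x ≟ d ⟧ + c)) upTo-∷ (insertions-negative (suc d) u i) ⟩
    ⟦ suc (upTo u x) ≟ d ⟧ + (⟦ upTo u x ≟ d ⟧ + ⟦ suc d ≤? upTo u x ⟧)
      ≡⟨ cong (⟦ suc (upTo u x) ≟ d ⟧ +_) (≤?-split d (upTo u x)) ⟨
    ⟦ suc (upTo u x) ≟ d ⟧ + ⟦ d ≤? upTo u x ⟧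
      ≡⟨ ≤?-suc d (upTo u x) ⟨
    ⟦ d ≤? suc (upTo u x) ⟧
      ≡⟨ cong (λ b → ⟦ d ≤? b ⟧) upTo-∷ ⟨
    ⟦ d ≤? upTo (y ∷ u) x ⟧ ∎
    where
    x = -[1+ i ]
    ¬before : ¬ Before y x
    ¬before (inj₁ y<x)       = y≮x y<x
    ¬before (inj₂ (_ , ()))
    upTo-∷ : upTo (y ∷ u) x ≡ suc (upTo u x)
    upTo-∷ = count-yes (ℤ._≤? x) u (ℤ.≤-reflexive y≡x)
    rearrange : ∀ a b c e → a + b + (1 * c + e) ≡ a + (c + (b + e))
    rearrange = solve-∀
  ... | tri> y≮x y≢x x<y = begin
    insertions d (y ∷ u) x + occurrences d (y ∷ u) x
      ≡⟨ cong₂ _+_ (insertions-after d y u x ¬before)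
           (trans (occurrences-after d y u x ¬before)
             (cong (λ b → b * ⟦ lo x u ≟ d ⟧ + occurrences (suc d) u x) (⟦⟧-false (y ℤ.≟ x) y≢x))) ⟩
    ⟦ upTo (y ∷ u) x ≟ d ⟧ + insertions (suc d) u x + occurrences (suc d) u x
      ≡⟨ ℕ.+-assoc ⟦ upTo (y ∷ u) x ≟ d ⟧ _ _ ⟩
    ⟦ upTo (y ∷ u) x ≟ d ⟧ + (insertions (suc d) u x + occurrences (suc d) u x)
      ≡⟨ cong₂ (λ b c → ⟦ b ≟ d ⟧ + c) upTo-∷ (insertions-negative (suc d) u i) ⟩
    ⟦ upTo u x ≟ d ⟧ + ⟦ suc d ≤? upTo u x ⟧
      ≡⟨ ≤?-split d (upTo u x) ⟨
    ⟦ d ≤? upTo u x ⟧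
      ≡⟨ cong (λ b → ⟦ d ≤? b ⟧) upTo-∷ ⟨
    ⟦ d ≤? upTo (y ∷ u) x ⟧ ∎
    where
    x = -[1+ i ]
    ¬before : ¬ Before y x
    ¬before (inj₁ y<x)       = y≮x y<x
    ¬before (inj₂ (_ , ()))
    upTo-∷ : upTo (y ∷ u) x ≡ upTo u x
    upTo-∷ = count-no (ℤ._≤? x) u (ℤ.<⇒≱ x<y)

  -- Divided by `size x u`, this is the sum over k of the probability that an `x` inserted at k
  -- becomes a fixed point.
  insertedFixedPoints : ℤ → Word n → ℕ
  insertedFixedPoints {n} x u =
    sum {suc n} (λ k → sum {size x u} (λ i → ⟦ start u k x + toℕ i ≟ toℕ k ⟧))

  Σ-insertedFixedPoints : ∀ x (u : Word n) →
    sum {suc n} (λ k → Σ-admissible (insertAt u k x) (λ π → ⟦ toℕ (π ⟨$⟩ʳ k) ≟ toℕ k ⟧)) ≡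
    zeros u ! * insertedFixedPoints x u
  Σ-insertedFixedPoints {n} x u = trans
    (sum-cong-≋ {suc n} λ k → value-distribution u k x (λ i → ⟦ i ≟ toℕ k ⟧))
    (sym (*-distribˡ-sum {suc n} (zeros u !)
      (λ k → sum {size x u} (λ i → ⟦ start u k x + toℕ i ≟ toℕ k ⟧))))

  -- The interval does not depend on k and lies within the range of the positions, so each of its
  -- values is matched by exactly one k. After division by the size of the interval the contribution
  -- is 1.
  insertedFixedPoints-zero : ∀ (u : Word n) → insertedFixedPoints +0 u ≡ suc (zeros u)
  insertedFixedPoints-zero {n} u = begin
    sum {suc n} (λ k → sum {c} (λ i → ⟦ start u k +0 + toℕ i ≟ toℕ k ⟧))
      ≡⟨ sum-cong-≋ {suc n} (λ k → sum-cong-≋ {c} λ i → cong (λ b → ⟦ b + toℕ i ≟ toℕ k ⟧) (start-zero u k)) ⟩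
    sum {suc n} (λ k → sum {c} (λ i → ⟦ below u +0 + toℕ i ≟ toℕ k ⟧))
      ≡⟨ ∑-comm {suc n} {c} (λ k i → ⟦ below u +0 + toℕ i ≟ toℕ k ⟧) ⟩
    sum {c} (λ i → sum {suc n} (λ k → ⟦ below u +0 + toℕ i ≟ toℕ k ⟧))
      ≡⟨ sum-cong-≋ {c} (λ i → sum-pick (below u +0 + toℕ i) (suc n)
           (ℕ.<-≤-trans (ℕ.+-monoʳ-< (below u +0) (Fin.toℕ<n i)) (lo+size≤suc-n +0 u))) ⟩
    sum {c} (λ _ → 1)
      ≡⟨ trans (sum-const c 1) (ℕ.*-identityʳ c) ⟩
    c ∎
    where c = suc (zeros u)

  insertedFixedPoints-signed : ∀ (u : Word n) x → size x u ≡ 1 →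
                               insertedFixedPoints x u ≡ insertions 0 u x
  insertedFixedPoints-signed {n} u x size≡1 = sum-cong-≋ {suc n} λ k → trans
    (cong (λ c → sum {c} (λ i → ⟦ start u k x + toℕ i ≟ toℕ k ⟧)) size≡1)
    (trans (ℕ.+-identityʳ _)
      (cong₂ (λ a b → ⟦ a ≟ b ⟧) (ℕ.+-identityʳ (start u k x)) (sym (ℕ.+-identityʳ (toℕ k)))))

module FixedPoints where
  open Counting
  open Insertion
  open import Data.Nat.Properties using (_≟_)
  open ≡ using (refl; trans; cong)

  count-tabulate : ∀ {A : Set} {R : Pred A 0ℓ} (R? : Decidable R) {n} (f : Fin n → A) →
                   count R? (Vec.tabulate f) ≡ sum {n} (λ k → ⟦ R? (f k) ⟧)
  count-tabulate R? {zero}  f = refl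
  count-tabulate R? {suc n} f = trans (count-∷ R? (f zero) (Vec.tabulate (f ∘ suc)))
    (cong (⟦ R? (f zero) ⟧ ℕ.+_) (count-tabulate R? (f ∘ suc)))

  fixedPoints≡sum : ∀ {n} (π : Permutation′ n) →
                    fixedPoints π ≡ sum {n} (λ k → ⟦ toℕ (π ⟨$⟩ʳ k) ≟ toℕ k ⟧)
  fixedPoints≡sum {n} π = trans (count-tabulate (λ k → π ⟨$⟩ʳ k Fin.≟ k) (λ k → k))
    (sum-cong-≋ {n} λ k → ⟦⟧-cong (cong toℕ) Fin.toℕ-injective (π ⟨$⟩ʳ k Fin.≟ k) (toℕ (π ⟨$⟩ʳ k) ≟ toℕ k))

  Σ-admissible-fixedPoints : ∀ {n} (w : Word n) → Σ-admissible w fixedPoints ≡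
    sum {n} (λ k → Σ-admissible w (λ π → ⟦ toℕ (π ⟨$⟩ʳ k) ≟ toℕ k ⟧))
  Σ-admissible-fixedPoints {n} w = trans
    (Σ-cong (permutations n) λ π → trans (cong (⟦ admissible? w π ⟧ ℕ.*_) (fixedPoints≡sum π))
      (*-distribˡ-sum {n} ⟦ admissible? w π ⟧ (λ k → ⟦ toℕ (π ⟨$⟩ʳ k) ≟ toℕ k ⟧)))
    (Σ-sum-comm (permutations n) (λ π k → ⟦ admissible? w π ⟧ ℕ.* ⟦ toℕ (π ⟨$⟩ʳ k) ≟ toℕ k ⟧))

-- Weighted sums over the words in a finite alphabet

words : List ℤ → ∀ n → List (Word n)
words L zero    = [] ∷ []
words L (suc n) = cartesianProductWith _∷_ L (words L n)

module WordSums {c ℓ} (R : CommutativeRing c ℓ) (weight : ℤ → CommutativeRing.Carrier R) where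
  open CommutativeRing R hiding (zero)
  open Sums commutativeSemiring
  open SemiringMult semiring using (×-homo-+; ×1-homo-*; ×-congˡ)
    renaming (_×_ to _×ᴿ_)
  open SemiringExp semiring using (_^_)
  open RingProperties ring using (-‿distribˡ-*)
  open SetoidReasoning setoid hiding (start)
  open Counting using (⟦_⟧; ⟦⟧-true; ⟦⟧-false)
  open Blocks using (zeros)
  open Insertion
  open FixedPoints
  open SemiringSolver commutativeSemiring using (solve; _:=_; _:*_; _:+_)

  private variable
    n : ℕ

  fromNat : ℕ → Carrier
  fromNat n = n ×ᴿ 1#

  fromNat-cong : ∀ {m n} → m ≡ n → fromNat m ≈ fromNat n
  fromNat-cong = ×-congˡ

  fromNat-+ : ∀ m n → fromNat (m ℕ.+ n) ≈ fromNat m + fromNat n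
  fromNat-+ = ×-homo-+ 1#

  fromNat-* : ∀ m n → fromNat (m ℕ.* n) ≈ fromNat m * fromNat n
  fromNat-* = ×1-homo-*

  fromNat-sum : ∀ n f → fromNat (Counting.sum {n} f) ≈ sum {n} (λ k → fromNat (f k))
  fromNat-sum zero    f = refl
  fromNat-sum (suc n) f = trans (fromNat-+ (f zero) _) (+-congˡ (fromNat-sum n (f ∘ suc)))

  fromNat-Σ : ∀ {I : Set} (xs : List I) f → fromNat (Counting.Σ xs f) ≈ Σ xs (λ i → fromNat (f i))
  fromNat-Σ []       f = refl
  fromNat-Σ (x ∷ xs) f = trans (fromNat-+ (f x) _) (+-congˡ (fromNat-Σ xs f))

  Σ-cong-∈ : ∀ {I : Set} (xs : List I) {f g : I → Carrier} → (∀ {i} → i ∈ xs → f i ≈ g i) → Σ xs f ≈ Σ xs g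
  Σ-cong-∈ []       f≈g = refl
  Σ-cong-∈ (x ∷ xs) f≈g = +-cong (f≈g (here ≡.refl)) (Σ-cong-∈ xs λ i∈ → f≈g (there i∈))

  Σ-pick : ∀ {L} x → Unique L → x ∈ L → (f : ℤ → Carrier) →
           Σ L (λ y → fromNat ⟦ y ℤ.≟ x ⟧ * f y) ≈ f x
  Σ-pick {x ∷ L} .x (x∉L ∷ _) (here ≡.refl) f = begin
    fromNat ⟦ x ℤ.≟ x ⟧ * f x + Σ L (λ y → fromNat ⟦ y ℤ.≟ x ⟧ * f y)
      ≈⟨ +-cong
           (*-congʳ (trans (fromNat-cong (⟦⟧-true (x ℤ.≟ x) ≡.refl)) (+-identityʳ 1#)))
           (trans (Σ-cong-∈ L λ {y} y∈L → *-congʳ (fromNat-cong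
              (⟦⟧-false (y ℤ.≟ x) λ y≡x → All.lookup x∉L y∈L (≡.sym y≡x))))
             (Σ-zero L λ y → zeroˡ (f y))) ⟩
    1# * f x + 0#
      ≈⟨ trans (+-identityʳ _) (*-identityˡ _) ⟩
    f x ∎
  Σ-pick {z ∷ L} x (z∉L ∷ unique) (there x∈L) f = trans
    (+-cong
      (trans (*-congʳ (fromNat-cong (⟦⟧-false (z ℤ.≟ x) (All.lookup z∉L x∈L)))) (zeroˡ (f z)))
      (Σ-pick x unique x∈L f))
    (+-identityˡ _)

  wordWeight : Word n → Carrier
  wordWeight w = Vec.foldr′ _*_ 1# (Vec.map weight w)

  wordWeight-insertAt : ∀ (u : Word n) k x → wordWeight (insertAt u k x) ≈ weight x * wordWeight u
  wordWeight-insertAt u       zero    x = refl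
  wordWeight-insertAt (y ∷ u) (suc k) x = trans (*-congˡ (wordWeight-insertAt u k x))
    (solve 3 (λ a b c → a :* (b :* c) := b :* (a :* c)) refl (weight y) (weight x) (wordWeight u))

  module _ (L : List ℤ) where

    total : Carrier
    total = Σ L weight

    Σ-words-∷ : ∀ (H : Word (suc n) → Carrier) →
      Σ (words L (suc n)) H ≈ Σ L (λ x → Σ (words L n) (λ u → H (x ∷ u)))
    Σ-words-∷ {n} H = Σ-cartesianProductWith _∷_ L (words L n) H

    -- Any position can play the part of the first one, since the letters range over `L`
    -- independently. This exchanges marking position k of a longer word for inserting a letter at
    -- k.
    Σ-words-insertAt : ∀ (k : Fin (suc n)) (H : Word (suc n) → Carrier) →
      Σ (words L (suc n)) H ≈ Σ L (λ x → Σ (words L n) (λ u → H (insertAt u k x)))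
    Σ-words-insertAt zero H = Σ-words-∷ H
    Σ-words-insertAt {suc n} (suc k) H = begin
      Σ (words L (suc (suc n))) H
        ≈⟨ Σ-words-∷ H ⟩
      Σ L (λ y → Σ (words L (suc n)) (λ v → H (y ∷ v)))
        ≈⟨ Σ-cong L (λ y → Σ-words-insertAt k (λ v → H (y ∷ v))) ⟩
      Σ L (λ y → Σ L (λ x → Σ (words L n) (λ u → H (y ∷ insertAt u k x))))
        ≈⟨ Σ-comm L L (λ y x → Σ (words L n) (λ u → H (y ∷ insertAt u k x))) ⟩
      Σ L (λ x → Σ L (λ y → Σ (words L n) (λ u → H (y ∷ insertAt u k x))))
        ≈⟨ Σ-cong L (λ x → Σ-words-∷ (λ u → H (insertAt u (suc k) x))) ⟨
      Σ L (λ x → Σ (words L (suc n)) (λ u → H (insertAt u (suc k) x))) ∎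

    Σ-wordWeight : ∀ n → Σ (words L n) wordWeight ≈ total ^ n
    Σ-wordWeight zero    = +-identityʳ 1#
    Σ-wordWeight (suc n) = begin
      Σ (words L (suc n)) wordWeight
        ≈⟨ Σ-words-∷ wordWeight ⟩
      Σ L (λ x → Σ (words L n) (λ u → weight x * wordWeight u))
        ≈⟨ Σ-cong L (λ x → *-distribˡ-Σ (weight x) (words L n) wordWeight) ⟨
      Σ L (λ x → weight x * Σ (words L n) wordWeight)
        ≈⟨ Σ-cong L (λ x → *-congˡ (Σ-wordWeight n)) ⟩
      Σ L (λ x → weight x * total ^ n)
        ≈⟨ *-distribʳ-Σ (total ^ n) L weight ⟨
      total * total ^ n ∎

    -- The complete homogeneous symmetric polynomial of degree n in t and total.
    geometric : Carrier → ℕ → Carrier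
    geometric t n = sum {suc n} (λ j → t ^ toℕ j * total ^ (n ℕ.∸ toℕ j))

    geometric-suc : ∀ t n → geometric t (suc n) ≈ total ^ suc n + t * geometric t n
    geometric-suc t n = +-cong (*-identityˡ _) (trans
      (sum-cong-≋ {suc n} λ j → *-assoc t (t ^ toℕ j) (total ^ (n ℕ.∸ toℕ j)))
      (sym (*-distribˡ-sum {suc n} t (λ j → t ^ toℕ j * total ^ (n ℕ.∸ toℕ j)))))

    geometric-unique : ∀ t (q : ℕ → Carrier) → q 0 ≈ 1# →
      (∀ n → q (suc n) ≈ total ^ suc n + t * q n) → ∀ n → q n ≈ geometric t n
    geometric-unique t q q0 qs zero    = trans q0 (sym (trans (+-identityʳ _) (*-identityˡ 1#)))
    geometric-unique t q q0 qs (suc n) = trans (qs n)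
      (trans (+-congˡ (*-congˡ (geometric-unique t q q0 qs n))) (sym (geometric-suc t n)))

    -- These are not normalised: the words of length n have mass `total ^ n`, which need not be 1
    -- for a finite alphabet.
    meanInsertions meanOccurrences : ∀ n → ℤ → Carrier
    meanInsertions  n x = Σ (words L n) (λ u → wordWeight u * fromNat (insertions 0 u x))
    meanOccurrences n x = Σ (words L n) (λ u → wordWeight u * fromNat (occurrences 0 u x))

    meanOccurrences-zero : ∀ x → meanOccurrences 0 x ≈ 0#
    meanOccurrences-zero x = trans (+-identityʳ _) (zeroʳ 1#)

    -- A letter `x` on a fixed point, once deleted, leaves a shorter word together with a position
    -- at which inserting `x` gives a fixed point, and conversely. The deleted letter accounts for
    -- the factor `weight x`. This closes the recursion in the length of the word.
    meanOccurrences-suc : ∀ {x} n → Unique L → x ∈ L →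
                          meanOccurrences (suc n) x ≈ weight x * meanInsertions n x
    meanOccurrences-suc {x} n unique x∈L = begin
      Σ (words L (suc n)) (λ w → wordWeight w * fromNat (occurrences 0 w x))
        ≈⟨ Σ-cong (words L (suc n)) (λ w → trans
             (*-congˡ (fromNat-sum (suc n) (λ k → term w k)))
             (*-distribˡ-sum {suc n} (wordWeight w) (λ k → fromNat (term w k)))) ⟩
      Σ (words L (suc n)) (λ w → sum {suc n} (λ k → wordWeight w * fromNat (term w k)))
        ≈⟨ Σ-sum-comm (words L (suc n)) {suc n} (λ w k → wordWeight w * fromNat (term w k)) ⟩
      sum {suc n} (λ k → Σ (words L (suc n)) (λ w → wordWeight w * fromNat (term w k)))
        ≈⟨ sum-cong-≋ {suc n} (λ k → trans
             (Σ-words-insertAt k (λ w → wordWeight w * fromNat (term w k)))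
             (trans (Σ-cong L λ y → atLetter k y)
               (Σ-pick x unique x∈L (λ y → weight y * Σ (words L n) (λ u → wordWeight u * fromNat (hit u k)))))) ⟩
      sum {suc n} (λ k → weight x * Σ (words L n) (λ u → wordWeight u * fromNat (hit u k)))
        ≈⟨ *-distribˡ-sum {suc n} (weight x) (λ k → Σ (words L n) (λ u → wordWeight u * fromNat (hit u k))) ⟨
      weight x * sum {suc n} (λ k → Σ (words L n) (λ u → wordWeight u * fromNat (hit u k)))
        ≈⟨ *-congˡ (Σ-sum-comm (words L n) {suc n} (λ u k → wordWeight u * fromNat (hit u k))) ⟨
      weight x * Σ (words L n) (λ u → sum {suc n} (λ k → wordWeight u * fromNat (hit u k)))
        ≈⟨ *-congˡ (Σ-cong (words L n) λ u → trans
             (sym (*-distribˡ-sum {suc n} (wordWeight u) (λ k → fromNat (hit u k))))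
             (*-congˡ (sym (fromNat-sum (suc n) (hit u))))) ⟩
      weight x * meanInsertions n x ∎
      where
      term : Word (suc n) → Fin (suc n) → ℕ
      term w k = ⟦ lookup w k ℤ.≟ x ⟧ ℕ.* ⟦ startWithout w k x ℕ.≟ toℕ k ℕ.+ 0 ⟧

      hit : Word n → Fin (suc n) → ℕ
      hit u k = ⟦ start u k x ℕ.≟ toℕ k ℕ.+ 0 ⟧

      atLetter : ∀ k y →
        Σ (words L n) (λ u → wordWeight (insertAt u k y) * fromNat (term (insertAt u k y) k)) ≈
        fromNat ⟦ y ℤ.≟ x ⟧ * (weight y * Σ (words L n) (λ u → wordWeight u * fromNat (hit u k)))
      atLetter k y = begin
        Σ (words L n) (λ u → wordWeight (insertAt u k y) * fromNat (term (insertAt u k y) k))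
          ≈⟨ Σ-cong (words L n) (λ u → trans
               (*-cong (wordWeight-insertAt u k y) (trans
                 (fromNat-cong (≡.cong₂ (λ z m → ⟦ z ℤ.≟ x ⟧ ℕ.* ⟦ m ℕ.≟ toℕ k ℕ.+ 0 ⟧)
                   (Vec.insertAt-lookup u k y) (startWithout-insertAt u k y x)))
                 (fromNat-* ⟦ y ℤ.≟ x ⟧ (hit u k))))
               (solve 4 (λ a b d e → (a :* b) :* (d :* e) := (d :* a) :* (b :* e)) refl
                 (weight y) (wordWeight u) (fromNat ⟦ y ℤ.≟ x ⟧) (fromNat (hit u k)))) ⟩
        Σ (words L n) (λ u → fromNat ⟦ y ℤ.≟ x ⟧ * weight y * (wordWeight u * fromNat (hit u k)))
          ≈⟨ *-distribˡ-Σ (fromNat ⟦ y ℤ.≟ x ⟧ * weight y) (words L n) (λ u → wordWeight u * fromNat (hit u k)) ⟨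
        fromNat ⟦ y ℤ.≟ x ⟧ * weight y * Σ (words L n) (λ u → wordWeight u * fromNat (hit u k))
          ≈⟨ *-assoc _ _ _ ⟩
        fromNat ⟦ y ℤ.≟ x ⟧ * (weight y * Σ (words L n) (λ u → wordWeight u * fromNat (hit u k))) ∎

    meanInsertions-positive : ∀ n i → let x = +[1+ i ] in
      meanInsertions n x ≈ total ^ n + meanOccurrences n x
    meanInsertions-positive n i = begin
      Σ (words L n) (λ u → wordWeight u * fromNat (insertions 0 u +[1+ i ]))
        ≈⟨ Σ-cong (words L n) (λ u → trans (*-congˡ (fromNat-cong (insertions-positive 0 u i)))
             (trans (distribˡ _ 1# _) (+-congʳ (*-identityʳ _)))) ⟩
      Σ (words L n) (λ u → wordWeight u + wordWeight u * fromNat (occurrences 0 u +[1+ i ]))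
        ≈⟨ Σ-distrib-+ (words L n) wordWeight _ ⟩
      Σ (words L n) wordWeight + meanOccurrences n +[1+ i ]
        ≈⟨ +-congʳ (Σ-wordWeight n) ⟩
      total ^ n + meanOccurrences n +[1+ i ] ∎

    meanInsertions-negative : ∀ n i → let x = -[1+ i ] in
      meanInsertions n x + meanOccurrences n x ≈ total ^ n
    meanInsertions-negative n i = begin
      meanInsertions n x + meanOccurrences n x
        ≈⟨ Σ-distrib-+ (words L n) _ _ ⟨
      Σ (words L n) (λ u → wordWeight u * fromNat (insertions 0 u x) + wordWeight u * fromNat (occurrences 0 u x))
        ≈⟨ Σ-cong (words L n) (λ u → trans (sym (distribˡ _ _ _)) (trans
             (*-congˡ (trans (sym (fromNat-+ (insertions 0 u x) (occurrences 0 u x)))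
               (trans (fromNat-cong (insertions-negative 0 u i)) (+-identityʳ 1#))))
             (*-identityʳ _))) ⟩
      Σ (words L n) wordWeight
        ≈⟨ Σ-wordWeight n ⟩
      total ^ n ∎
      where x = -[1+ i ]

    meanInsertions-positive-geometric : ∀ n i → let x = +[1+ i ] in Unique L → x ∈ L →
      meanInsertions n x ≈ geometric (weight x) n
    meanInsertions-positive-geometric n i unique x∈L = geometric-unique (weight x)
      (λ n → meanInsertions n x)
      (trans (meanInsertions-positive 0 i) (trans (+-congˡ (meanOccurrences-zero x)) (+-identityʳ 1#)))
      (λ n → trans (meanInsertions-positive (suc n) i) (+-congˡ (meanOccurrences-suc n unique x∈L)))
      n
      where x = +[1+ i ]

    meanInsertions-negative-geometric : ∀ n i → let x = -[1+ i ] in Unique L → x ∈ L →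
      meanInsertions n x ≈ geometric (- weight x) n
    meanInsertions-negative-geometric n i unique x∈L = geometric-unique (- weight x)
      (λ n → meanInsertions n x)
      (trans (sym (trans (+-congˡ (meanOccurrences-zero x)) (+-identityʳ _))) (meanInsertions-negative 0 i))
      (λ n → begin
        meanInsertions (suc n) x
          ≈⟨ trans (+-assoc _ _ _) (trans (+-congˡ (-‿inverseʳ _)) (+-identityʳ _)) ⟨
        meanInsertions (suc n) x + meanOccurrences (suc n) x - meanOccurrences (suc n) x
          ≈⟨ +-cong (meanInsertions-negative (suc n) i)
               (trans (-‿cong (meanOccurrences-suc n unique x∈L)) (-‿distribˡ-* (weight x) _)) ⟩
        total ^ suc n + - weight x * meanInsertions n x ∎)
      n
      where x = -[1+ i ]

    module _ (1/_! : ℕ → Carrier) (1/!*! : ∀ m → 1/ m ! * fromNat (m !) ≈ 1#) where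

      -- The contribution of an inserted letter, averaged over the remaining n letters. For 0 it is
      -- 1 whatever the word, so that only the mass of the words is left.
      letterMean : ℕ → ℤ → Carrier
      letterMean n +0         = total ^ n
      letterMean n +[1+ i ]   = geometric (weight +[1+ i ]) n
      letterMean n (-[1+ i ]) = geometric (- weight -[1+ i ]) n

      cancel-! : ∀ m {p q} → p ≡ q → 1/ m ! * fromNat (m ! ℕ.* p) ≈ fromNat q
      cancel-! m {p} ≡.refl = trans (*-congˡ (fromNat-* (m !) p))
        (trans (sym (*-assoc _ _ _)) (trans (*-congʳ (1/!*! m)) (*-identityˡ _)))

      insertedMean : ∀ n x → Unique L → x ∈ L →
        Σ (words L n) (λ u → wordWeight u *
          (1/ zeros (x ∷ u) ! * fromNat (zeros u ! ℕ.* insertedFixedPoints x u))) ≈ letterMean n x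
      insertedMean n +0 unique x∈L = trans
        (Σ-cong (words L n) λ u → trans
          (*-congˡ (trans
            (*-congˡ (fromNat-cong (≡.trans (≡.cong (zeros u ! ℕ.*_) (insertedFixedPoints-zero u))
              (ℕ.*-comm (zeros u !) _))))
            (1/!*! (suc (zeros u)))))
          (*-identityʳ _))
        (Σ-wordWeight n)
      insertedMean n +[1+ i ] unique x∈L = trans
        (Σ-cong (words L n) λ u → *-congˡ (cancel-! (zeros u) (insertedFixedPoints-signed u +[1+ i ] ≡.refl)))
        (meanInsertions-positive-geometric n i unique x∈L)
      insertedMean n (-[1+ i ]) unique x∈L = trans
        (Σ-cong (words L n) λ u → *-congˡ (cancel-! (zeros u) (insertedFixedPoints-signed u -[1+ i ] ≡.refl)))
        (meanInsertions-negative-geometric n i unique x∈L)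

      -- By linearity the sum runs over positions k and words. Splitting the word at k and moving
      -- the sum over k inside, past the letter and the remaining word, leaves the sum over all
      -- insertion positions, which the counting results evaluate.
      fixedPoints-mean : ∀ n → Unique L →
        Σ (words L (suc n)) (λ w → wordWeight w * (1/ zeros w ! * fromNat (Σ-admissible w fixedPoints))) ≈
        Σ L (λ x → weight x * letterMean n x)
      fixedPoints-mean n unique = begin
        Σ (words L (suc n)) (λ w → wordWeight w * (1/ zeros w ! * fromNat (Σ-admissible w fixedPoints)))
          ≈⟨ Σ-cong (words L (suc n)) (λ w → *-congˡ (*-congˡ (trans
               (fromNat-cong (Σ-admissible-fixedPoints w)) (fromNat-sum (suc n) (fixing w))))) ⟩
        Σ (words L (suc n)) (λ w → wordWeight w * (1/ zeros w ! * sum {suc n} (λ k → fromNat (fixing w k))))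
          ≈⟨ Σ-cong (words L (suc n)) (λ w → trans
               (*-congˡ (*-distribˡ-sum {suc n} (1/ zeros w !) (λ k → fromNat (fixing w k))))
               (*-distribˡ-sum {suc n} (wordWeight w) (λ k → 1/ zeros w ! * fromNat (fixing w k)))) ⟩
        Σ (words L (suc n)) (λ w → sum {suc n} (λ k → term w k))
          ≈⟨ Σ-sum-comm (words L (suc n)) {suc n} term ⟩
        sum {suc n} (λ k → Σ (words L (suc n)) (λ w → term w k))
          ≈⟨ sum-cong-≋ {suc n} (λ k → trans (Σ-words-insertAt k (λ w → term w k))
               (Σ-cong L λ x → Σ-cong (words L n) λ u → inserted k x u)) ⟩
        sum {suc n} (λ k → Σ L (λ x → Σ (words L n) (λ u → term′ x u k)))
          ≈⟨ Σ-sum-comm L {suc n} (λ x k → Σ (words L n) (λ u → term′ x u k)) ⟨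
        Σ L (λ x → sum {suc n} (λ k → Σ (words L n) (λ u → term′ x u k)))
          ≈⟨ Σ-cong-∈ L (λ {x} x∈L → trans
               (sym (Σ-sum-comm (words L n) {suc n} (λ u k → term′ x u k)))
               (trans (Σ-cong (words L n) λ u → collect x u)
                 (trans (sym (*-distribˡ-Σ (weight x) (words L n) _))
                   (*-congˡ (insertedMean n x unique x∈L))))) ⟩
        Σ L (λ x → weight x * letterMean n x) ∎
        where
        fixing : Word (suc n) → Fin (suc n) → ℕ
        fixing w k = Σ-admissible w (λ π → ⟦ toℕ (π ⟨$⟩ʳ k) ℕ.≟ toℕ k ⟧)

        term : Word (suc n) → Fin (suc n) → Carrier
        term w k = wordWeight w * (1/ zeros w ! * fromNat (fixing w k))

        term′ : ℤ → Word n → Fin (suc n) → Carrier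
        term′ x u k = weight x * (wordWeight u * (1/ zeros (x ∷ u) ! * fromNat (fixing (insertAt u k x) k)))

        inserted : ∀ k x u → term (insertAt u k x) k ≈ term′ x u k
        inserted k x u = trans
          (*-cong (wordWeight-insertAt u k x)
            (*-congʳ (reflexive (≡.cong 1/_! (Counting.count-insertAt (ℤ._≟ +0) u k x)))))
          (*-assoc _ _ _)

        collect : ∀ x u → sum {suc n} (λ k → term′ x u k) ≈
          weight x * (wordWeight u * (1/ zeros (x ∷ u) ! * fromNat (zeros u ! ℕ.* insertedFixedPoints x u)))
        collect x u = begin
          sum {suc n} (λ k → weight x * (wordWeight u * (1/ zeros (x ∷ u) ! * fromNat (fixing (insertAt u k x) k))))
            ≈⟨ *-distribˡ-sum {suc n} (weight x)
                 (λ k → wordWeight u * (1/ zeros (x ∷ u) ! * fromNat (fixing (insertAt u k x) k))) ⟨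
          weight x * sum {suc n} (λ k → wordWeight u * (1/ zeros (x ∷ u) ! * fromNat (fixing (insertAt u k x) k)))
            ≈⟨ *-congˡ (*-distribˡ-sum {suc n} (wordWeight u)
                 (λ k → 1/ zeros (x ∷ u) ! * fromNat (fixing (insertAt u k x) k))) ⟨
          weight x * (wordWeight u * sum {suc n} (λ k → 1/ zeros (x ∷ u) ! * fromNat (fixing (insertAt u k x) k)))
            ≈⟨ *-congˡ (*-congˡ (*-distribˡ-sum {suc n} (1/ zeros (x ∷ u) !)
                 (λ k → fromNat (fixing (insertAt u k x) k)))) ⟨
          weight x * (wordWeight u * (1/ zeros (x ∷ u) ! * sum {suc n} (λ k → fromNat (fixing (insertAt u k x) k))))
            ≈⟨ *-congˡ (*-congˡ (*-congˡ (trans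
                 (sym (fromNat-sum (suc n) (λ k → fixing (insertAt u k x) k)))
                 (fromNat-cong (Σ-insertedFixedPoints x u))))) ⟩
          weight x * (wordWeight u * (1/ zeros (x ∷ u) ! * fromNat (zeros u ! ℕ.* insertedFixedPoints x u))) ∎

-- Finite alphabets exhausting the integers

signedLetters letters : ℕ → List ℤ
signedLetters zero    = []
signedLetters (suc N) = +[1+ N ] ∷ -[1+ N ] ∷ signedLetters N
letters N = +0 ∷ signedLetters N

module Letters where
  open ≡ using (refl)

  positive∈ : ∀ {i N} → i ℕ.< N → +[1+ i ] ∈ signedLetters N
  positive∈ {i} {suc N} i<1+N with ℕ.m≤n⇒m<n∨m≡n (ℕ.≤-pred i<1+N)
  ... | inj₁ i<N  = there (there (positive∈ i<N))
  ... | inj₂ refl = here refl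

  negative∈ : ∀ {i N} → i ℕ.< N → -[1+ i ] ∈ signedLetters N
  negative∈ {i} {suc N} i<1+N with ℕ.m≤n⇒m<n∨m≡n (ℕ.≤-pred i<1+N)
  ... | inj₁ i<N  = there (there (negative∈ i<N))
  ... | inj₂ refl = there (here refl)

  ∈-letters : ∀ x {N} → ℤ.∣ x ∣ ℕ.≤ N → x ∈ letters N
  ∈-letters +0         _   = here refl
  ∈-letters +[1+ i ]   i<N = there (positive∈ i<N)
  ∈-letters (-[1+ i ]) i<N = there (negative∈ i<N)

  signedLetters-bounded : ∀ {x} N → x ∈ signedLetters N → 0 ℕ.< ℤ.∣ x ∣ × ℤ.∣ x ∣ ℕ.≤ N
  signedLetters-bounded (suc N) (here refl)         = z<s , ℕ.≤-refl
  signedLetters-bounded (suc N) (there (here refl)) = z<s , ℕ.≤-refl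
  signedLetters-bounded (suc N) (there (there x∈))  with signedLetters-bounded N x∈
  ... | 0<x , x≤N = 0<x , ℕ.m≤n⇒m≤1+n x≤N

  letters-bounded : ∀ {x} N → x ∈ letters N → ℤ.∣ x ∣ ℕ.≤ N
  letters-bounded N (here refl) = z≤n
  letters-bounded N (there x∈)  = proj₂ (signedLetters-bounded N x∈)

  letters-mono : ∀ {M N} → M ℕ.≤ N → letters M ⊆ letters N
  letters-mono {M} M≤N {x} x∈ = ∈-letters x (ℕ.≤-trans (letters-bounded M x∈) M≤N)

  signedLetters-unique : ∀ N → Unique (signedLetters N)
  signedLetters-unique zero    = []
  signedLetters-unique (suc N) =
    ((λ ()) All.∷ All.tabulate λ x∈ → λ { refl → ℕ.<-irrefl refl (proj₂ (signedLetters-bounded N x∈)) }) ∷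
    (All.tabulate λ x∈ → λ { refl → ℕ.<-irrefl refl (proj₂ (signedLetters-bounded N x∈)) }) ∷
    signedLetters-unique N

  letters-unique : ∀ N → Unique (letters N)
  letters-unique N = (All.tabulate λ x∈ → λ { refl → ℕ.<-irrefl refl (proj₁ (signedLetters-bounded N x∈)) }) ∷
    signedLetters-unique N

  words-unique : ∀ {L} n → Unique L → Unique (words L n)
  words-unique zero    unique = All.[] ∷ []
  words-unique (suc n) unique =
    Unique.cartesianProductWith⁺ _∷_ Vec.∷-injective unique (words-unique n unique)

  words-mono : ∀ {L L′} n → L ⊆ L′ → words L n ⊆ words L′ n
  words-mono           zero    L⊆L′ w∈ = w∈
  words-mono {L} {L′} (suc n) L⊆L′ w∈ with ∈-cartesianProductWith⁻ _∷_ L (words L n) w∈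
  ... | x , u , x∈ , u∈ , refl = ∈-cartesianProductWith⁺ _∷_ (L⊆L′ x∈) (words-mono n L⊆L′ u∈)

  letterBound : ∀ {n} → Word n → ℕ
  letterBound []      = 0
  letterBound (x ∷ w) = ℤ.∣ x ∣ ℕ.⊔ letterBound w

  ∈-words : ∀ {n} (w : Word n) {N} → letterBound w ℕ.≤ N → w ∈ words (letters N) n
  ∈-words []      _  = here refl
  ∈-words (x ∷ w) le = ∈-cartesianProductWith⁺ _∷_
    (∈-letters x (ℕ.≤-trans (ℕ.m≤m⊔n ℤ.∣ x ∣ (letterBound w)) le))
    (∈-words w (ℕ.≤-trans (ℕ.m≤n⊔m ℤ.∣ x ∣ (letterBound w)) le))

  -- Makes the lists `words (letters N) n` cofinal among the finite sets of words, so that a limit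
  -- in N can serve as an unconditional sum.
  words-exhaust : ∀ {n} (G : List (Word n)) → ∃[ M ] (∀ {N} → M ℕ.≤ N → G ⊆ words (letters N) n)
  words-exhaust []      = 0 , λ _ ()
  words-exhaust (w ∷ G) with words-exhaust G
  ... | M , G⊆ = letterBound w ℕ.⊔ M , λ where
    le (here refl) → ∈-words w (ℕ.≤-trans (ℕ.m≤m⊔n (letterBound w) M) le)
    le (there v∈)  → G⊆ (ℕ.≤-trans (ℕ.m≤n⊔m (letterBound w) M) le) v∈

-- Order and convergence, axiomatically

-- A commutative ring with a compatible preorder and a notion of convergent
-- sequence; domination replaces completeness.
record LimitRing : Set₁ where
  infix 4 _≤_ _⟶_
  field
    commutativeRing : CommutativeRing 0ℓ 0ℓ
  open CommutativeRing commutativeRing hiding (zero) public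
  field
    _≤_           : Carrier → Carrier → Set
    ≤-reflexive   : ∀ {x y} → x ≈ y → x ≤ y
    ≤-trans       : ∀ {x y z} → x ≤ y → y ≤ z → x ≤ z
    +-mono-≤      : ∀ {x y u v} → x ≤ y → u ≤ v → x + u ≤ y + v
    *-monoˡ-≤     : ∀ {x y z} → 0# ≤ z → x ≤ y → z * x ≤ z * y
    0≤1           : 0# ≤ 1#
    _⟶_           : (ℕ → Carrier) → Carrier → Set
    ⟶-cong        : ∀ {x y a b} → (∀ n → x n ≈ y n) → a ≈ b → x ⟶ a → y ⟶ b
    ⟶-const       : ∀ a → (λ _ → a) ⟶ a
    ⟶-+           : ∀ {x y a b} → x ⟶ a → y ⟶ b → (λ n → x n + y n) ⟶ a + b
    ⟶-*           : ∀ {x y a b} → x ⟶ a → y ⟶ b → (λ n → x n * y n) ⟶ a * b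
    ⟶-unique      : ∀ {x a b} → x ⟶ a → x ⟶ b → a ≈ b

  Monotone : (ℕ → Carrier) → Set
  Monotone x = ∀ {m n} → m ℕ.≤ n → x m ≤ x n

  field
    monotone⇒≤lim : ∀ {x a} → Monotone x → x ⟶ a → ∀ n → x n ≤ a
    dominated     : ∀ {x y b} → Monotone x → Monotone (λ n → y n - x n) → y ⟶ b → ∃[ a ] x ⟶ a

module LimitRingProperties (L : LimitRing) where
  open LimitRing L
  open Sums commutativeSemiring
  open SemiringExp semiring using (_^_)
  open AbelianGroupProperties +-abelianGroup using (⁻¹-∙-comm)
  open SemiringSolver commutativeSemiring using (solve; _:=_; _:+_)

  ≤-refl : ∀ {x} → x ≤ x
  ≤-refl = ≤-reflexive refl

  ≤-cong : ∀ {x x′ y y′} → x ≈ x′ → y ≈ y′ → x ≤ y → x′ ≤ y′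
  ≤-cong x≈x′ y≈y′ x≤y = ≤-trans (≤-reflexive (sym x≈x′)) (≤-trans x≤y (≤-reflexive y≈y′))

  x≤x+y : ∀ {x y} → 0# ≤ y → x ≤ x + y
  x≤x+y {x} 0≤y = ≤-cong (+-identityʳ x) refl (+-mono-≤ ≤-refl 0≤y)

  x≤y⇒0≤y-x : ∀ {x y} → x ≤ y → 0# ≤ y - x
  x≤y⇒0≤y-x {x} x≤y = ≤-cong (-‿inverseʳ x) refl (+-mono-≤ x≤y ≤-refl)

  0≤* : ∀ {x y} → 0# ≤ x → 0# ≤ y → 0# ≤ x * y
  0≤* {x} 0≤x 0≤y = ≤-cong (zeroʳ x) refl (*-monoˡ-≤ 0≤x 0≤y)

  0≤^ : ∀ {x} n → 0# ≤ x → 0# ≤ x ^ n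
  0≤^ zero    0≤x = 0≤1
  0≤^ (suc n) 0≤x = 0≤* 0≤x (0≤^ n 0≤x)

  ^suc≤ : ∀ {x} n → 0# ≤ x → x ≤ 1# → x ^ suc n ≤ x
  ^suc≤ {x} zero    0≤x x≤1 = ≤-reflexive (*-identityʳ x)
  ^suc≤ {x} (suc n) 0≤x x≤1 = ≤-cong refl (*-identityʳ x)
    (*-monoˡ-≤ 0≤x (≤-trans (^suc≤ n 0≤x x≤1) x≤1))

  step⇒monotone : ∀ {x} → (∀ n → x n ≤ x (suc n)) → Monotone x
  step⇒monotone {x} step m≤n = go (ℕ.≤⇒≤′ m≤n)
    where
    go : ∀ {m n} → m ℕ.≤′ n → x m ≤ x n
    go ℕ.≤′-refl        = ≤-refl
    go (ℕ.≤′-step m≤n)  = ≤-trans (go m≤n) (step _)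

  private variable
    I : Set

  Σ-nonneg : ∀ (xs : List I) {f} → (∀ i → 0# ≤ f i) → 0# ≤ Σ xs f
  Σ-nonneg []       0≤f = ≤-refl
  Σ-nonneg (x ∷ xs) 0≤f = ≤-cong (+-identityˡ 0#) refl (+-mono-≤ (0≤f x) (Σ-nonneg xs 0≤f))

  -- Induction on `F`: its head is cut out of `G`, and as `F` has no repetition, the rest of `F` is
  -- contained in what remains. Repetitions in `G` only add non-negative terms.
  Σ-mono-⊆ : ∀ {F G : List I} {f} → (∀ i → 0# ≤ f i) → Unique F → F ⊆ G → Σ F f ≤ Σ G f
  Σ-mono-⊆ {F = []}    {G} 0≤f _ _ = Σ-nonneg G 0≤f
  Σ-mono-⊆ {F = x ∷ F} {G} {f} 0≤f (x∉F ∷ unique) xF⊆G with ∈-∃++ (xF⊆G (here ≡.refl))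
  ... | ys , zs , ≡.refl = ≤-cong refl
    (trans (+-congˡ (Σ-++ ys zs f))
      (trans (solve 3 (λ a b c → a :+ (b :+ c) := b :+ (a :+ c)) refl (f x) (Σ ys f) (Σ zs f))
        (sym (Σ-++ ys (x ∷ zs) f))))
    (+-mono-≤ ≤-refl (Σ-mono-⊆ 0≤f unique F⊆))
    where
    F⊆ : F ⊆ ys ++ zs
    F⊆ z∈F with ∈-++⁻ ys (xF⊆G (there z∈F))
    ... | inj₁ z∈ys            = ∈-++⁺ˡ z∈ys
    ... | inj₂ (here ≡.refl)   = contradiction ≡.refl (All.lookup x∉F z∈F)
    ... | inj₂ (there z∈zs)    = ∈-++⁺ʳ ys z∈zs

  Σ-distrib-minus : ∀ (xs : List I) f g → Σ xs (λ i → f i - g i) ≈ Σ xs f - Σ xs g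
  Σ-distrib-minus xs f g = trans (Σ-distrib-+ xs f (λ i → - g i)) (+-congˡ (Σ-neg xs))
    where
    Σ-neg : ∀ xs → Σ xs (λ i → - g i) ≈ - Σ xs g
    Σ-neg []       = trans (sym (-‿inverseʳ 0#)) (+-identityˡ _)
    Σ-neg (x ∷ xs) = trans (+-congˡ (Σ-neg xs)) (⁻¹-∙-comm (g x) (Σ xs g))

  sum-snoc : ∀ (f : ℕ → Carrier) N → sum {suc N} (λ i → f (toℕ i)) ≈ sum {N} (λ i → f (toℕ i)) + f N
  sum-snoc f N = trans (sum-init-last {N} (λ i → f (toℕ i)))
    (+-cong (sum-cong-≋ {N} λ i → reflexive (≡.cong f (Fin.toℕ-inject₁ i))) (reflexive (≡.cong f (Fin.toℕ-fromℕ N))))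

  partialSum : (ℕ → Carrier) → ℕ → Carrier
  partialSum f N = sum {N} (λ i → f (toℕ i))

  partialSum-monotone : ∀ {f} → (∀ i → 0# ≤ f i) → Monotone (partialSum f)
  partialSum-monotone {f} 0≤f = step⇒monotone λ N → ≤-cong refl (sym (sum-snoc f N)) (x≤x+y (0≤f N))

  partialSum-minus : ∀ f g N → partialSum f N - partialSum g N ≈ partialSum (λ i → f i - g i) N
  partialSum-minus f g zero    = -‿inverseʳ 0#
  partialSum-minus f g (suc N) = trans
    (+-congˡ (sym (⁻¹-∙-comm (g 0) (partialSum (g ∘ suc) N))))
    (trans (solve 4 (λ a b c d → (a :+ b) :+ (c :+ d) := (a :+ c) :+ (b :+ d)) refl _ _ _ _)
      (+-congˡ (partialSum-minus (f ∘ suc) (g ∘ suc) N)))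

  comparison : ∀ {f g b} → (∀ i → 0# ≤ f i) → (∀ i → f i ≤ g i) → partialSum g ⟶ b → ∃[ a ] partialSum f ⟶ a
  comparison {f} {g} 0≤f f≤g = dominated (partialSum-monotone 0≤f) λ {m} {n} m≤n →
    ≤-cong (sym (partialSum-minus g f m)) (sym (partialSum-minus g f n))
      (partialSum-monotone (λ i → x≤y⇒0≤y-x (f≤g i)) m≤n)

  ⟶-Σ : ∀ (xs : List I) {f : I → ℕ → Carrier} {g} → (∀ i → f i ⟶ g i) → (λ N → Σ xs (λ i → f i N)) ⟶ Σ xs g
  ⟶-Σ []       f⟶g = ⟶-const 0#
  ⟶-Σ (x ∷ xs) f⟶g = ⟶-+ (f⟶g x) (⟶-Σ xs f⟶g)

  ⟶-sum : ∀ {n} {f : Fin n → ℕ → Carrier} {g} → (∀ k → f k ⟶ g k) → (λ N → sum {n} (λ k → f k N)) ⟶ sum {n} g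
  ⟶-sum {zero}  f⟶g = ⟶-const 0#
  ⟶-sum {suc n} f⟶g = ⟶-+ (f⟶g zero) (⟶-sum λ k → f⟶g (suc k))

  ⟶-^ : ∀ {x a} n → x ⟶ a → (λ N → x N ^ n) ⟶ a ^ n
  ⟶-^ zero    x⟶a = ⟶-const 1#
  ⟶-^ (suc n) x⟶a = ⟶-* x⟶a (⟶-^ n x⟶a)

  1^n≈1 : ∀ n → 1# ^ n ≈ 1#
  1^n≈1 zero    = refl
  1^n≈1 (suc n) = trans (*-identityˡ _) (1^n≈1 n)

-- From finite alphabets to the shuffle

module Shuffle (L : LimitRing) where
  open LimitRing L
  open LimitRingProperties L
  open Sums commutativeSemiring
  open SemiringExp semiring using (_^_; ^-congˡ)
  open CommutativeSemiringExp commutativeSemiring using (^-distrib-*)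
  open RingProperties ring using (-1*x≈-x; x[y-z]≈xy-xz)
  open AbelianGroupProperties +-abelianGroup using (⁻¹-involutive)
  open SemiringSolver commutativeSemiring using (solve; _:=_; _:*_; _:+_)
  open SetoidReasoning setoid hiding (start)
  open Blocks using (zeros)
  open Insertion using (Σ-admissible)
  open Counting using (⟦_⟧)
  open Letters

  -1^[2+n]≈-1^n : ∀ n → (- 1#) ^ suc (suc n) ≈ (- 1#) ^ n
  -1^[2+n]≈-1^n n = trans (-1*x≈-x _) (trans (-‿cong (-1*x≈-x _)) (⁻¹-involutive _))

  module Weighted (weight : ℤ → Carrier) (0≤weight : ∀ x → 0# ≤ weight x)
           (1/_! : ℕ → Carrier) (0≤1/! : ∀ m → 0# ≤ 1/ m !) (1/!≤1 : ∀ m → 1/ m ! ≤ 1#) where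
    open WordSums commutativeRing weight

    private
      α β : ℕ → Carrier
      α i = weight +[1+ i ]
      β i = weight -[1+ i ]

    Σ-letters : ∀ N f → Σ (letters N) f ≈ f +0 + partialSum (λ i → f +[1+ i ] + f -[1+ i ]) N
    Σ-letters N f = +-congˡ (go N)
      where
      go : ∀ N → Σ (signedLetters N) f ≈ partialSum (λ i → f +[1+ i ] + f -[1+ i ]) N
      go zero    = refl
      go (suc N) = begin
        f +[1+ N ] + (f -[1+ N ] + Σ (signedLetters N) f)
          ≈⟨ solve 3 (λ a b c → a :+ (b :+ c) := c :+ (a :+ b)) refl _ _ _ ⟩
        Σ (signedLetters N) f + (f +[1+ N ] + f -[1+ N ])
          ≈⟨ +-congʳ (go N) ⟩
        partialSum (λ i → f +[1+ i ] + f -[1+ i ]) N + (f +[1+ N ] + f -[1+ N ])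
          ≈⟨ sum-snoc (λ i → f +[1+ i ] + f -[1+ i ]) N ⟨
        partialSum (λ i → f +[1+ i ] + f -[1+ i ]) (suc N) ∎

    powerTerm : ℕ → ℕ → Carrier
    powerTerm j i = α i ^ j + (- 1#) ^ suc j * β i ^ j

    -- For the last equality of the theorem: γ is absorbed by the first extended power sum, and the
    -- later summands z agree on both sides.
    powerSum-one : ∀ c x y z → c + (x + (- 1#) ^ 2 * y + z) ≈ (c + x + y) + z
    powerSum-one c x y z = trans
      (+-congˡ (+-congʳ (+-congˡ (trans (*-congʳ (-1^[2+n]≈-1^n 0)) (*-identityˡ y)))))
      (solve 4 (λ c x y z → c :+ (x :+ y :+ z) := (c :+ x :+ y) :+ z) refl c x y z)

    negative-power : ∀ j i → β i * (- β i) ^ j ≈ (- 1#) ^ suc (suc j) * β i ^ suc j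
    negative-power j i = begin
      β i * (- β i) ^ j
        ≈⟨ *-congˡ (trans (^-congˡ j (sym (-1*x≈-x (β i)))) (^-distrib-* (- 1#) (β i) j)) ⟩
      β i * ((- 1#) ^ j * β i ^ j)
        ≈⟨ solve 3 (λ a b c → a :* (b :* c) := b :* (a :* c)) refl _ _ _ ⟩
      (- 1#) ^ j * β i ^ suc j
        ≈⟨ *-congʳ (-1^[2+n]≈-1^n j) ⟨
      (- 1#) ^ suc (suc j) * β i ^ suc j ∎

    -- Each signed letter contributes a geometric sum over exponents; exchanging the sums collects
    -- equal exponents from all letters. The weight of the inserted letter itself raises every
    -- exponent by one, so the powers start at 1. The letter 0 stays apart and becomes the summand
    -- γ.
    Σ-letterMean : ∀ 1/!*! N n → let s = total (letters N) in
      Σ (letters N) (λ x → weight x * letterMean (letters N) 1/_! 1/!*! n x) ≈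
      weight +0 * s ^ n + sum {suc n} (λ j → partialSum (powerTerm (suc (toℕ j))) N * s ^ (n ℕ.∸ toℕ j))
    Σ-letterMean 1/!*! N n = trans
      (Σ-letters N (λ x → weight x * letterMean (letters N) 1/_! 1/!*! n x))
      (+-congˡ (begin
        partialSum (λ i → α i * geometric (letters N) (α i) n + β i * geometric (letters N) (- β i) n) N
          ≈⟨ sum-cong-≋ {N} (λ i → combine (toℕ i)) ⟩
        sum {N} (λ i → sum {suc n} (λ j → powerTerm (suc (toℕ j)) (toℕ i) * s ^ (n ℕ.∸ toℕ j)))
          ≈⟨ ∑-comm {N} {suc n} (λ i j → powerTerm (suc (toℕ j)) (toℕ i) * s ^ (n ℕ.∸ toℕ j)) ⟩
        sum {suc n} (λ j → sum {N} (λ i → powerTerm (suc (toℕ j)) (toℕ i) * s ^ (n ℕ.∸ toℕ j)))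
          ≈⟨ sum-cong-≋ {suc n} (λ j → *-distribʳ-sum {N} (s ^ (n ℕ.∸ toℕ j)) (λ i → powerTerm (suc (toℕ j)) (toℕ i))) ⟨
        sum {suc n} (λ j → partialSum (powerTerm (suc (toℕ j))) N * s ^ (n ℕ.∸ toℕ j)) ∎))
      where
      s = total (letters N)
      combine : ∀ i → α i * geometric (letters N) (α i) n + β i * geometric (letters N) (- β i) n ≈
                      sum {suc n} (λ j → powerTerm (suc (toℕ j)) i * s ^ (n ℕ.∸ toℕ j))
      combine i = begin
        α i * geometric (letters N) (α i) n + β i * geometric (letters N) (- β i) n
          ≈⟨ +-cong
               (trans (*-distribˡ-sum {suc n} (α i) (λ j → α i ^ toℕ j * s ^ (n ℕ.∸ toℕ j)))
                 (sum-cong-≋ {suc n} λ j → sym (*-assoc (α i) (α i ^ toℕ j) (s ^ (n ℕ.∸ toℕ j)))))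
               (trans (*-distribˡ-sum {suc n} (β i) (λ j → (- β i) ^ toℕ j * s ^ (n ℕ.∸ toℕ j)))
                 (sum-cong-≋ {suc n} λ j → trans (sym (*-assoc (β i) ((- β i) ^ toℕ j) (s ^ (n ℕ.∸ toℕ j))))
                   (*-congʳ (negative-power (toℕ j) i)))) ⟩
        sum {suc n} (λ j → α i ^ suc (toℕ j) * s ^ (n ℕ.∸ toℕ j)) +
        sum {suc n} (λ j → (- 1#) ^ suc (suc (toℕ j)) * β i ^ suc (toℕ j) * s ^ (n ℕ.∸ toℕ j))
          ≈⟨ ∑-distrib-+ {suc n} (λ j → α i ^ suc (toℕ j) * s ^ (n ℕ.∸ toℕ j))
               (λ j → (- 1#) ^ suc (suc (toℕ j)) * β i ^ suc (toℕ j) * s ^ (n ℕ.∸ toℕ j)) ⟨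
        sum {suc n} (λ j → α i ^ suc (toℕ j) * s ^ (n ℕ.∸ toℕ j) +
                           (- 1#) ^ suc (suc (toℕ j)) * β i ^ suc (toℕ j) * s ^ (n ℕ.∸ toℕ j))
          ≈⟨ sum-cong-≋ {suc n} (λ j → sym (distribʳ (s ^ (n ℕ.∸ toℕ j)) (α i ^ suc (toℕ j))
               ((- 1#) ^ suc (suc (toℕ j)) * β i ^ suc (toℕ j)))) ⟩
        sum {suc n} (λ j → powerTerm (suc (toℕ j)) i * s ^ (n ℕ.∸ toℕ j)) ∎

    private variable
      n : ℕ

    0≤wordWeight : ∀ (w : Word n) → 0# ≤ wordWeight w
    0≤wordWeight []      = 0≤1
    0≤wordWeight (x ∷ w) = 0≤* (0≤weight x) (0≤wordWeight w)

    arrangement : Word n → Permutation′ n → Carrier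
    arrangement w π = if does (admissible? w π) then 1/ zeros w ! else 0#

    0≤arrangement : ∀ (w : Word n) π → 0# ≤ arrangement w π
    0≤arrangement w π with does (admissible? w π)
    ... | true  = 0≤1/! (zeros w)
    ... | false = ≤-refl

    arrangement≤1 : ∀ (w : Word n) π → arrangement w π ≤ 1#
    arrangement≤1 w π with does (admissible? w π)
    ... | true  = 1/!≤1 (zeros w)
    ... | false = 0≤1

    arrangement≈ : ∀ (w : Word n) π → arrangement w π ≈ 1/ zeros w ! * fromNat ⟦ admissible? w π ⟧
    arrangement≈ w π with does (admissible? w π)
    ... | true  = sym (trans (*-congˡ (+-identityʳ 1#)) (*-identityʳ _))
    ... | false = sym (zeroʳ _)

    -- Over the reals this unfolds to the summand of `IsShuffle`.
    jointMass : Permutation′ n → Word n → Carrier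
    jointMass π w = wordWeight w * arrangement w π

    0≤jointMass : ∀ (π : Permutation′ n) w → 0# ≤ jointMass π w
    0≤jointMass π w = 0≤* (0≤wordWeight w) (0≤arrangement w π)

    partialMass : Permutation′ n → ℕ → Carrier
    partialMass {n} π N = Σ (words (letters N) n) (jointMass π)

    Σ-words-monotone : ∀ n {f : Word n → Carrier} → (∀ w → 0# ≤ f w) → Monotone (λ N → Σ (words (letters N) n) f)
    Σ-words-monotone n 0≤f {M} M≤N =
      Σ-mono-⊆ 0≤f (words-unique n (letters-unique M)) (words-mono n (letters-mono M≤N))

    meanFixedPoints : ∀ 1/!*! N n →
      Σ (permutations (suc n)) (λ π → partialMass π N * fromNat (fixedPoints π)) ≈
      Σ (letters N) (λ x → weight x * letterMean (letters N) 1/_! 1/!*! n x)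
    meanFixedPoints 1/!*! N n = begin
      Σ perms (λ π → Σ W (jointMass π) * fromNat (fixedPoints π))
        ≈⟨ Σ-cong perms (λ π → *-distribʳ-Σ (fromNat (fixedPoints π)) W (jointMass π)) ⟩
      Σ perms (λ π → Σ W (λ w → jointMass π w * fromNat (fixedPoints π)))
        ≈⟨ Σ-comm perms W (λ π w → jointMass π w * fromNat (fixedPoints π)) ⟩
      Σ W (λ w → Σ perms (λ π → jointMass π w * fromNat (fixedPoints π)))
        ≈⟨ Σ-cong W (λ w → trans (Σ-cong perms λ π → regroup w π)
             (trans (sym (*-distribˡ-Σ (wordWeight w) perms _)) (*-congˡ
               (trans (sym (*-distribˡ-Σ (1/ zeros w !) perms _)) (*-congˡ
                 (sym (fromNat-Σ perms (λ π → ⟦ admissible? w π ⟧ ℕ.* fixedPoints π)))))))) ⟩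
      Σ W (λ w → wordWeight w * (1/ zeros w ! * fromNat (Σ-admissible w fixedPoints)))
        ≈⟨ fixedPoints-mean (letters N) 1/_! 1/!*! n (letters-unique N) ⟩
      Σ (letters N) (λ x → weight x * letterMean (letters N) 1/_! 1/!*! n x) ∎
      where
      perms = permutations (suc n)
      W = words (letters N) (suc n)
      regroup : ∀ w π → jointMass π w * fromNat (fixedPoints π) ≈
                wordWeight w * (1/ zeros w ! * fromNat (⟦ admissible? w π ⟧ ℕ.* fixedPoints π))
      regroup w π = trans (*-congʳ (*-congˡ (arrangement≈ w π)))
        (trans (solve 4 (λ p q r t → p :* (q :* r) :* t := p :* (q :* (r :* t))) refl _ _ _ _)
          (*-congˡ (*-congˡ (sym (fromNat-* ⟦ admissible? w π ⟧ (fixedPoints π))))))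

    module Normalised {a b : Carrier} (α⟶a : partialSum α ⟶ a) (β⟶b : partialSum β ⟶ b)
             (normalised : weight +0 + a + b ≈ 1#) where

      total⟶1 : (λ N → total (letters N)) ⟶ 1#
      total⟶1 = ⟶-cong
        (λ N → sym (trans (Σ-letters N weight)
          (+-congˡ (∑-distrib-+ {N} (λ i → α (toℕ i)) (λ i → β (toℕ i))))))
        (trans (sym (+-assoc _ _ _)) normalised)
        (⟶-+ (⟶-const (weight +0)) (⟶-+ α⟶a β⟶b))

      total≤1 : ∀ N → total (letters N) ≤ 1#
      total≤1 = monotone⇒≤lim
        (λ {M} M≤N → Σ-mono-⊆ 0≤weight (letters-unique M) (letters-mono M≤N)) total⟶1

      weight≤1 : ∀ x → weight x ≤ 1#
      weight≤1 x = ≤-trans (≤-cong (+-identityʳ _) refl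
        (Σ-mono-⊆ {F = x ∷ []} 0≤weight (All.[] ∷ [])
          (λ { (here ≡.refl) → ∈-letters x (ℕ.≤-refl) })))
        (total≤1 ℤ.∣ x ∣)

      abstract
        -- All weights lie between 0 and 1, so their positive powers are bounded by the weights
        -- themselves and the comparison test applies. Later steps rely on the convergence alone, so
        -- the construction of the limit is kept opaque.
        power-series : ∀ (letter : ℕ → ℤ) {c} → partialSum (λ i → weight (letter i)) ⟶ c →
                       ∀ j → ∃[ d ] partialSum (λ i → weight (letter i) ^ suc j) ⟶ d
        power-series letter = λ ⟶c j → comparison
          (λ i → 0≤^ (suc j) (0≤weight (letter i)))
          (λ i → ^suc≤ j (0≤weight (letter i)) (weight≤1 (letter i)))
          ⟶c

      powerTerm-series : ∀ j {A B} → partialSum (λ i → α i ^ j) ⟶ A → partialSum (λ i → β i ^ j) ⟶ B →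
                         partialSum (powerTerm j) ⟶ A + (- 1#) ^ suc j * B
      powerTerm-series j α⟶ β⟶ = ⟶-cong
        (λ N → trans
          (+-congˡ (*-distribˡ-sum {N} ((- 1#) ^ suc j) (λ i → β (toℕ i) ^ j)))
          (sym (∑-distrib-+ {N} (λ i → α (toℕ i) ^ j) (λ i → (- 1#) ^ suc j * β (toℕ i) ^ j))))
        refl
        (⟶-+ α⟶ (⟶-* (⟶-const ((- 1#) ^ suc j)) β⟶))

      abstract
        -- The joint mass of a word and π is at most the weight of the word, so the mass of the
        -- complement also grows with the alphabet. This dominates the partial masses by
        -- `total (letters N) ^ n`, whose limit is known.
        mass : ∀ (π : Permutation′ n) → ∃[ μ ] partialMass π ⟶ μ
        mass {n} π = dominated (Σ-words-monotone n (0≤jointMass π))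
          (λ {M} {N} M≤N → ≤-cong (complement M) (complement N)
            (Σ-words-monotone n 0≤complement M≤N))
          (⟶-^ n total⟶1)
          where
          0≤complement : ∀ w → 0# ≤ wordWeight w - jointMass π w
          0≤complement w = ≤-cong refl
            (trans (x[y-z]≈xy-xz (wordWeight w) 1# (arrangement w π)) (+-congʳ (*-identityʳ _)))
            (0≤* (0≤wordWeight w) (x≤y⇒0≤y-x (arrangement≤1 w π)))
          complement : ∀ N → Σ (words (letters N) n) (λ w → wordWeight w - jointMass π w) ≈
                             total (letters N) ^ n - partialMass π N
          complement N = trans (Σ-distrib-minus (words (letters N) n) wordWeight (jointMass π))
            (+-congʳ (Σ-wordWeight (letters N) n))

      -- One sequence in N has two descriptions, by masses of permutations and by partial power sums
      -- times powers of `total`; the claim is the uniqueness of its limit.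
      expectation : (∀ m → 1/ m ! * fromNat (m !) ≈ 1#) → ∀ n {μ : Permutation′ (suc n) → Carrier} {s : ℕ → Carrier} →
        (∀ π → partialMass π ⟶ μ π) → (∀ j → partialSum (powerTerm (suc j)) ⟶ s (suc j)) →
        Σ (permutations (suc n)) (λ π → μ π * fromNat (fixedPoints π)) ≈
        weight +0 + sum {suc n} (λ j → s (suc (toℕ j)))
      expectation 1/!*! n {μ} {s} μ⟶ s⟶ = ⟶-unique
        (⟶-Σ (permutations (suc n)) {f = λ π N → partialMass π N * fromNat (fixedPoints π)}
          λ π → ⟶-* (μ⟶ π) (⟶-const (fromNat (fixedPoints π))))
        (⟶-cong
          (λ N → sym (trans (meanFixedPoints 1/!*! N n) (Σ-letterMean 1/!*! N n)))
          (+-cong (times-1 (weight +0) n) (sum-cong-≋ {suc n} λ j → times-1 (s (suc (toℕ j))) (n ℕ.∸ toℕ j)))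
          (⟶-+ (⟶-* (⟶-const (weight +0)) (⟶-^ n total⟶1))
            (⟶-sum {suc n} {f = λ j N → partialSum (powerTerm (suc (toℕ j))) N * total (letters N) ^ (n ℕ.∸ toℕ j)}
              λ j → ⟶-* (s⟶ (toℕ j)) (⟶-^ (n ℕ.∸ toℕ j) total⟶1))))
        where
        times-1 : ∀ c n → c * 1# ^ n ≈ c
        times-1 c n = trans (*-congˡ (1^n≈1 n)) (*-identityʳ c)

-- Estimates for rational numbers

module RationalDistance where
  open ≡ using (refl; sym; trans; cong; cong₂; subst; subst₂)
  open +-*-Solver

  p≤∣p∣ : ∀ p → p ℚ.≤ ℚ.∣ p ∣
  p≤∣p∣ p with ℚ.≤-total 0ℚ p
  ... | inj₁ 0≤p = ℚ.≤-reflexive (sym (ℚ.0≤p⇒∣p∣≡p 0≤p))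
  ... | inj₂ p≤0 = ℚ.≤-trans p≤0 (ℚ.0≤∣p∣ p)

  ∣p∣≤ : ∀ {p c} → p ℚ.≤ c → ℚ.- p ℚ.≤ c → ℚ.∣ p ∣ ℚ.≤ c
  ∣p∣≤ {p} p≤c -p≤c with ℚ.∣p∣≡p∨∣p∣≡-p p
  ... | inj₁ eq = subst (ℚ._≤ _) (sym eq) p≤c
  ... | inj₂ eq = subst (ℚ._≤ _) (sym eq) -p≤c

  dist-sym : ∀ p q {a} → ℚ.∣ p ℚ.- q ∣ ℚ.≤ a → ℚ.∣ q ℚ.- p ∣ ℚ.≤ a
  dist-sym p q {a} = subst (ℚ._≤ a) (trans (sym (ℚ.∣-p∣≡∣p∣ (p ℚ.- q)))
    (cong ℚ.∣_∣ (solve 2 (λ x y → :- (x :- y) := y :- x) refl p q)))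

  dist-trans : ∀ p q r {a b} → ℚ.∣ p ℚ.- q ∣ ℚ.≤ a → ℚ.∣ q ℚ.- r ∣ ℚ.≤ b → ℚ.∣ p ℚ.- r ∣ ℚ.≤ a ℚ.+ b
  dist-trans p q r ≤a ≤b = ℚ.≤-trans
    (subst (λ t → ℚ.∣ t ∣ ℚ.≤ ℚ.∣ p ℚ.- q ∣ ℚ.+ ℚ.∣ q ℚ.- r ∣)
      (solve 3 (λ x y z → (x :- y) :+ (y :- z) := x :- z) refl p q r)
      (ℚ.∣p+q∣≤∣p∣+∣q∣ (p ℚ.- q) (q ℚ.- r)))
    (ℚ.+-mono-≤ ≤a ≤b)

  dist-+ : ∀ p q r s {a b} → ℚ.∣ p ℚ.- r ∣ ℚ.≤ a → ℚ.∣ q ℚ.- s ∣ ℚ.≤ b →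
           ℚ.∣ (p ℚ.+ q) ℚ.- (r ℚ.+ s) ∣ ℚ.≤ a ℚ.+ b
  dist-+ p q r s ≤a ≤b = ℚ.≤-trans
    (subst (λ t → ℚ.∣ t ∣ ℚ.≤ ℚ.∣ p ℚ.- r ∣ ℚ.+ ℚ.∣ q ℚ.- s ∣)
      (solve 4 (λ w x y z → (w :- y) :+ (x :- z) := (w :+ x) :- (y :+ z)) refl p q r s)
      (ℚ.∣p+q∣≤∣p∣+∣q∣ (p ℚ.- r) (q ℚ.- s)))
    (ℚ.+-mono-≤ ≤a ≤b)

  dist⇒≤ : ∀ p q {a} → ℚ.∣ p ℚ.- q ∣ ℚ.≤ a → p ℚ.≤ q ℚ.+ a
  dist⇒≤ p q {a} ≤a = subst (ℚ._≤ q ℚ.+ a)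
    (solve 2 (λ x y → y :+ (x :- y) := x) refl p q)
    (ℚ.+-monoʳ-≤ q (ℚ.≤-trans (p≤∣p∣ (p ℚ.- q)) ≤a))

  ∣p∣≤∣q∣+dist : ∀ p q → ℚ.∣ p ∣ ℚ.≤ ℚ.∣ q ∣ ℚ.+ ℚ.∣ p ℚ.- q ∣
  ∣p∣≤∣q∣+dist p q = subst (λ t → ℚ.∣ t ∣ ℚ.≤ ℚ.∣ q ∣ ℚ.+ ℚ.∣ p ℚ.- q ∣)
    (solve 2 (λ x y → y :+ (x :- y) := x) refl p q) (ℚ.∣p+q∣≤∣p∣+∣q∣ q (p ℚ.- q))

  dist-* : ∀ p q r s → ℚ.∣ p ℚ.* q ℚ.- r ℚ.* s ∣ ℚ.≤
           ℚ.∣ p ∣ ℚ.* ℚ.∣ q ℚ.- s ∣ ℚ.+ ℚ.∣ s ∣ ℚ.* ℚ.∣ p ℚ.- r ∣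
  dist-* p q r s = subst₂ ℚ._≤_
    (cong ℚ.∣_∣ (solve 4 (λ w x y z → w :* (x :- z) :+ z :* (w :- y) := w :* x :- y :* z) refl p q r s))
    (cong₂ ℚ._+_ (ℚ.∣p*q∣≡∣p∣*∣q∣ p (q ℚ.- s)) (ℚ.∣p*q∣≡∣p∣*∣q∣ s (p ℚ.- r)))
    (ℚ.∣p+q∣≤∣p∣+∣q∣ (p ℚ.* (q ℚ.- s)) (s ℚ.* (p ℚ.- r)))

  dist≤ : ∀ p q {c} → p ℚ.≤ q ℚ.+ c → q ℚ.≤ p ℚ.+ c → ℚ.∣ p ℚ.- q ∣ ℚ.≤ c
  dist≤ p q {c} p≤ q≤ = ∣p∣≤
    (subst (p ℚ.- q ℚ.≤_) (solve 2 (λ y z → (y :+ z) :- y := z) refl q c) (ℚ.+-monoˡ-≤ (ℚ.- q) p≤))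
    (subst₂ ℚ._≤_ (solve 2 (λ x y → y :- x := :- (x :- y)) refl p q)
      (solve 2 (λ x z → (x :+ z) :- x := z) refl p c) (ℚ.+-monoˡ-≤ (ℚ.- p) q≤))

  -- Abstract, since type checking would otherwise unfold the arithmetic of ½.
  abstract
    half : ℚ → ℚ
    half ε = ½ ℚ.* ε

    0<half : ∀ {ε} → 0ℚ ℚ.< ε → 0ℚ ℚ.< half ε
    0<half {ε} 0<ε = subst (ℚ._< half ε) (ℚ.*-zeroʳ ½) (ℚ.*-monoʳ-<-pos ½ 0<ε)

    half+half : ∀ ε → half ε ℚ.+ half ε ≡ ε
    half+half ε = trans (sym (ℚ.*-distribʳ-+ ε ½ ½)) (ℚ.*-identityˡ ε)

    half-+ : ∀ ε δ → half ε ℚ.+ half δ ≡ half (ε ℚ.+ δ)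
    half-+ ε δ = sym (ℚ.*-distribˡ-+ ½ ε δ)

  p≤p+ : ∀ p {ε} → 0ℚ ℚ.< ε → p ℚ.≤ p ℚ.+ ε
  p≤p+ p {ε} 0<ε = subst (ℚ._≤ p ℚ.+ ε) (ℚ.+-identityʳ p) (ℚ.+-monoʳ-≤ p (ℚ.<⇒≤ 0<ε))

  half≤ : ∀ {ε} → 0ℚ ℚ.< ε → half ε ℚ.≤ ε
  half≤ {ε} 0<ε = subst (half ε ℚ.≤_) (half+half ε) (p≤p+ (half ε) (0<half 0<ε))

  0<+ : ∀ {p q} → 0ℚ ℚ.< p → 0ℚ ℚ.< q → 0ℚ ℚ.< p ℚ.+ q
  0<+ 0<p 0<q = ℚ.+-mono-< 0<p 0<q

  abstract
    -- 1 / (k + 1)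
    unitFraction : ℕ → ℚ
    unitFraction k = mkℚ (ℤ.+ 1) k (ℕ.1-coprimeTo (suc k))

    0<unitFraction : ∀ k → 0ℚ ℚ.< unitFraction k
    0<unitFraction k = ℚ.*<* (ℤ.+<+ ℕ.z<s)

    archimedean : ∀ {ε} → 0ℚ ℚ.< ε → ∃[ K ] (∀ k → K ℕ.≤ k → unitFraction k ℚ.≤ ε)
    archimedean {mkℚ +[1+ p ] d _} _ = d , λ k d≤k → ℚ.*≤* (ℤ.+≤+
      (ℕ.≤-trans (ℕ.≤-reflexive (ℕ.*-identityˡ (suc d)))
        (ℕ.≤-trans (ℕ.s≤s d≤k) (ℕ.m≤n*m (suc k) (suc p)))))
    archimedean {mkℚ +0 d _}       (ℚ.*<* (ℤ.+<+ ()))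
    archimedean {mkℚ -[1+ p ] d _} (ℚ.*<* ())

  module _ (B : ℚ) (0<B : 0ℚ ℚ.< B) where
    private instance
      B-positive : ℚ.Positive B
      B-positive = ℚ.positive 0<B
      B-nonZero : ℚ.NonZero B
      B-nonZero = ℚ.pos⇒nonZero B

    scale : ℚ → ℚ
    scale ε = (ℚ.1/ B) ℚ.* half ε

    0<scale : ∀ {ε} → 0ℚ ℚ.< ε → 0ℚ ℚ.< scale ε
    0<scale {ε} 0<ε = subst (ℚ._< scale ε) (ℚ.*-zeroʳ (ℚ.1/ B))
      (ℚ.*-monoʳ-<-pos (ℚ.1/ B) {{ℚ.1/pos⇒pos B}} (0<half 0<ε))

    scale-+ : ∀ ε δ → scale ε ℚ.+ scale δ ≡ scale (ε ℚ.+ δ)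
    scale-+ ε δ = trans (sym (ℚ.*-distribˡ-+ (ℚ.1/ B) (half ε) (half δ)))
      (cong ((ℚ.1/ B) ℚ.*_) (half-+ ε δ))

    *-scale-≤ : ∀ {p q} ε → 0ℚ ℚ.≤ q → p ℚ.≤ B → q ℚ.≤ scale ε → p ℚ.* q ℚ.≤ half ε
    *-scale-≤ {p} {q} ε 0≤q p≤B q≤ = ℚ.≤-trans
      (ℚ.*-monoʳ-≤-nonNeg q {{ℚ.nonNegative 0≤q}} p≤B)
      (subst (B ℚ.* q ℚ.≤_) eq (ℚ.*-monoˡ-≤-nonNeg B {{ℚ.pos⇒nonNeg B}} q≤))
      where
      eq : B ℚ.* scale ε ≡ half ε
      eq = trans (sym (ℚ.*-assoc B (ℚ.1/ B) (half ε)))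
        (trans (cong (ℚ._* half ε) (ℚ.*-inverseʳ B)) (ℚ.*-identityˡ (half ε)))

  p-q≤⇒p≤q+ : ∀ p q {r} → p ℚ.- q ℚ.≤ r → p ℚ.≤ q ℚ.+ r
  p-q≤⇒p≤q+ p q {r} le = subst (ℚ._≤ q ℚ.+ r)
    (solve 2 (λ a b → b :+ (a :- b) := a) refl p q) (ℚ.+-monoʳ-≤ q le)

  -- Non-negativity of a real only bounds its late entries below by a small negative number, so r
  -- may be slightly negative. In that case the absolute value of r is tiny and that of p - q is at
  -- most `C`, which makes the error harmless.
  *-monoˡ-≤-approx : ∀ B 0<B C 0<C {ε} → 0ℚ ℚ.< ε → ∀ p q r →
    ℚ.∣ r ∣ ℚ.≤ B → ℚ.∣ p ℚ.- q ∣ ℚ.≤ C → 0ℚ ℚ.≤ r ℚ.+ scale C 0<C ε → p ℚ.≤ q ℚ.+ scale B 0<B ε →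
    r ℚ.* p ℚ.≤ r ℚ.* q ℚ.+ ε
  *-monoˡ-≤-approx B 0<B C 0<C {ε} 0<ε p q r ∣r∣≤B ∣p-q∣≤C -r≤ p≤ with ℚ.≤-total 0ℚ r
  ... | inj₁ 0≤r = ℚ.≤-trans
    (ℚ.*-monoˡ-≤-nonNeg r {{ℚ.nonNegative 0≤r}} p≤)
    (subst (ℚ._≤ r ℚ.* q ℚ.+ ε) (sym (ℚ.*-distribˡ-+ r q (scale B 0<B ε)))
      (ℚ.+-monoʳ-≤ (r ℚ.* q) (ℚ.≤-trans
        (*-scale-≤ B 0<B {r} {scale B 0<B ε} ε (ℚ.<⇒≤ (0<scale B 0<B 0<ε)) (ℚ.≤-trans (p≤∣p∣ r) ∣r∣≤B) ℚ.≤-refl)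
        (half≤ 0<ε))))
  ... | inj₂ r≤0 = p-q≤⇒p≤q+ (r ℚ.* p) (r ℚ.* q) (ℚ.≤-trans
    (ℚ.≤-reflexive (solve 3 (λ a b c → c :* a :- c :* b := c :* (a :- b)) refl p q r))
    (ℚ.≤-trans (p≤∣p∣ (r ℚ.* (p ℚ.- q)))
      (ℚ.≤-trans
        (ℚ.≤-reflexive (trans (ℚ.∣p*q∣≡∣p∣*∣q∣ r (p ℚ.- q)) (ℚ.*-comm ℚ.∣ r ∣ ℚ.∣ p ℚ.- q ∣)))
        (ℚ.≤-trans (*-scale-≤ C 0<C {ℚ.∣ p ℚ.- q ∣} {ℚ.∣ r ∣} ε (ℚ.0≤∣p∣ r) ∣p-q∣≤C ∣r∣≤) (half≤ 0<ε)))))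
    where
    ∣r∣≤ : ℚ.∣ r ∣ ℚ.≤ scale C 0<C ε
    ∣r∣≤ = ∣p∣≤ (ℚ.≤-trans r≤0 (ℚ.<⇒≤ (0<scale C 0<C 0<ε)))
      (subst₂ ℚ._≤_ (ℚ.+-identityˡ (ℚ.- r))
        (solve 2 (λ a b → (a :+ b) :+ (:- a) := b) refl r (scale C 0<C ε))
        (ℚ.+-monoˡ-≤ (ℚ.- r) -r≤))

  -- Two tolerances occur because ε measures the distance of two reals while δ is the slack built
  -- into the order of the reals. As p is within c of r, `A ℚ.+ c` bounds the absolute value of p.
  dist-*-approx : ∀ A B 0<B c (0<A+c : 0ℚ ℚ.< A ℚ.+ c) ε δ p q r s →
    ℚ.∣ r ∣ ℚ.≤ A → ℚ.∣ s ∣ ℚ.≤ B → ℚ.∣ p ℚ.- r ∣ ℚ.≤ c →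
    (ℚ.∣ p ℚ.- r ∣ ℚ.≤ scale B 0<B ε ℚ.+ scale B 0<B δ) ×
    (ℚ.∣ q ℚ.- s ∣ ℚ.≤ scale (A ℚ.+ c) 0<A+c ε ℚ.+ scale (A ℚ.+ c) 0<A+c δ) →
    ℚ.∣ p ℚ.* q ℚ.- r ℚ.* s ∣ ℚ.≤ ε ℚ.+ δ
  dist-*-approx A B 0<B c 0<A+c ε δ p q r s r≤A s≤B p~r′ (p~r , q~s) = ℚ.≤-trans (dist-* p q r s)
    (ℚ.≤-trans
      (ℚ.+-mono-≤
        (*-scale-≤ (A ℚ.+ c) 0<A+c {ℚ.∣ p ∣} {ℚ.∣ q ℚ.- s ∣} (ε ℚ.+ δ) (ℚ.0≤∣p∣ (q ℚ.- s))
          (ℚ.≤-trans (∣p∣≤∣q∣+dist p r) (ℚ.+-mono-≤ r≤A p~r′))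
          (ℚ.≤-trans q~s (ℚ.≤-reflexive (scale-+ (A ℚ.+ c) 0<A+c ε δ))))
        (*-scale-≤ B 0<B {ℚ.∣ s ∣} {ℚ.∣ p ℚ.- r ∣} (ε ℚ.+ δ) (ℚ.0≤∣p∣ (p ℚ.- r)) s≤B
          (ℚ.≤-trans p~r (ℚ.≤-reflexive (scale-+ B 0<B ε δ)))))
      (ℚ.≤-reflexive (half+half (ε ℚ.+ δ))))

open import Defs

-- Convergence and completeness of the reals

module RealLimits where
  open ≡ using (refl; sym; trans; cong; cong₂; subst; subst₂)
  open RationalDistance
  open +-*-Solver using (solve; _:=_; _:+_; _:-_; _:*_; :-_)

  Eventually : (ℕ → Set) → Set
  Eventually P = ∃[ N ] (∀ n → N ℕ.≤ n → P n)

  eventually₁ : ∀ {P Q : ℕ → Set} → (∀ n → P n → Q n) → Eventually P → Eventually Q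
  eventually₁ f (N , p) = N , λ n le → f n (p n le)

  eventually₂ : ∀ {P Q R : ℕ → Set} → (∀ n → P n → Q n → R n) →
                Eventually P → Eventually Q → Eventually R
  eventually₂ f (M , p) (N , q) = M ℕ.⊔ N , λ n le →
    f n (p n (ℕ.≤-trans (ℕ.m≤m⊔n M N) le)) (q n (ℕ.≤-trans (ℕ.m≤n⊔m M N) le))

  eventually₃ : ∀ {P Q R S : ℕ → Set} → (∀ n → P n → Q n → R n → S n) →
                Eventually P → Eventually Q → Eventually R → Eventually S
  eventually₃ f p q r = eventually₂ (λ n g r → g r) (eventually₂ f p q) r

  witness : ∀ {P : ℕ → Set} → Eventually P → ∃[ n ] P n
  witness (N , p) = N , p N ℕ.≤-refl

  bounded : ∀ x → ∃[ B ] (0ℚ ℚ.< B × Eventually (λ n → ℚ.∣ seq x n ∣ ℚ.≤ B))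
  bounded x with cauchy x 1ℚ (ℚ.positive⁻¹ 1ℚ)
  ... | N , close = ℚ.∣ seq x N ∣ ℚ.+ 1ℚ
    , ℚ.<-≤-trans (ℚ.positive⁻¹ 1ℚ)
        (subst (ℚ._≤ ℚ.∣ seq x N ∣ ℚ.+ 1ℚ) (ℚ.+-identityˡ 1ℚ) (ℚ.+-monoˡ-≤ 1ℚ (ℚ.0≤∣p∣ (seq x N))))
    , N , λ n N≤n → ℚ.≤-trans (∣p∣≤∣q∣+dist (seq x n) (seq x N))
        (ℚ.+-monoʳ-≤ ℚ.∣ seq x N ∣ (close n N N≤n ℕ.≤-refl))

  ≡⇒≈ : ∀ x y → (∀ n → seq x n ≡ seq y n) → x ≈ y
  ≡⇒≈ x y eq ε 0<ε = 0 , λ n _ → dist≤ (seq x n) (seq y n)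
    (subst (ℚ._≤ seq y n ℚ.+ ε) (sym (eq n)) (p≤p+ (seq y n) 0<ε))
    (subst (ℚ._≤ seq x n ℚ.+ ε) (eq n) (p≤p+ (seq x n) 0<ε))

  ≈⇒≤ : ∀ x y → x ≈ y → x ≤ y
  ≈⇒≤ x y x≈y ε 0<ε = eventually₁ (λ n → dist⇒≤ (seq x n) (seq y n)) (x≈y ε 0<ε)

  fromℚ-mono : ∀ {p q} → p ℚ.≤ q → fromℚ p ≤ fromℚ q
  fromℚ-mono {p} {q} p≤q ε 0<ε = 0 , λ _ _ → ℚ.≤-trans p≤q (p≤p+ q 0<ε)

  ≤-trans : ∀ x y z → x ≤ y → y ≤ z → x ≤ z
  ≤-trans x y z x≤y y≤z ε 0<ε = eventually₂ (λ n p q → ℚ.≤-trans p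
      (subst (seq y n ℚ.+ half ε ℚ.≤_)
        (trans (ℚ.+-assoc (seq z n) (half ε) (half ε)) (cong (seq z n ℚ.+_) (half+half ε)))
        (ℚ.+-monoˡ-≤ (half ε) q)))
    (x≤y (half ε) (0<half 0<ε)) (y≤z (half ε) (0<half 0<ε))

  +-mono-≤ : ∀ x y u v → x ≤ y → u ≤ v → x + u ≤ y + v
  +-mono-≤ x y u v x≤y u≤v ε 0<ε = eventually₂ (λ n p q → subst (seq x n ℚ.+ seq u n ℚ.≤_)
      (trans (solve 4 (λ a b h g → (a :+ h) :+ (b :+ g) := a :+ b :+ (h :+ g)) refl (seq y n) (seq v n) (half ε) (half ε))
        (cong (seq y n ℚ.+ seq v n ℚ.+_) (half+half ε)))
      (ℚ.+-mono-≤ p q))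
    (x≤y (half ε) (0<half 0<ε)) (u≤v (half ε) (0<half 0<ε))

  *-monoˡ-≤ : ∀ x y z → 0# ≤ z → x ≤ y → z * x ≤ z * y
  *-monoˡ-≤ x y z 0≤z x≤y ε 0<ε =
    let B , 0<B , z≤B   = bounded z
        C , 0<C , x-y≤C = bounded (x - y)
    in eventually₂ (λ n g h → g h)
         (eventually₃ (λ n → *-monoˡ-≤-approx B 0<B C 0<C 0<ε (seq x n) (seq y n) (seq z n))
           z≤B x-y≤C (0≤z (scale C 0<C ε) (0<scale C 0<C 0<ε)))
         (x≤y (scale B 0<B ε) (0<scale B 0<B 0<ε))

  Close : ℝ → ℝ → ℚ → Set
  Close x y ε = ∣ x - y ∣ ≤ fromℚ ε

  -- Shaped so that `Converges (partialSum f) s` unfolds to `SeriesSum f s`, and convergence of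
  -- series passes between the two without conversion.
  Converges : (ℕ → ℝ) → ℝ → Set
  Converges x a = ∀ ε → 0ℚ ℚ.< ε → Eventually (λ n → Close (x n) a ε)

  ≈⇒close : ∀ x y → x ≈ y → ∀ ε → 0ℚ ℚ.< ε → Close x y ε
  ≈⇒close x y x≈y ε 0<ε δ 0<δ = eventually₁ (λ n p → ℚ.≤-trans p (p≤p+ ε 0<δ)) (x≈y ε 0<ε)

  close⇒≈ : ∀ x y → (∀ ε → 0ℚ ℚ.< ε → Close x y ε) → x ≈ y
  close⇒≈ x y close ε 0<ε = eventually₁ (λ n → subst (ℚ.∣ seq x n ℚ.- seq y n ∣ ℚ.≤_) (half+half ε))
    (close (half ε) (0<half 0<ε) (half ε) (0<half 0<ε))

  close-sym : ∀ x y ε → Close x y ε → Close y x ε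
  close-sym x y ε close δ 0<δ = eventually₁ (λ n → dist-sym (seq x n) (seq y n)) (close δ 0<δ)

  close-trans : ∀ x y z ε ε′ → Close x y ε → Close y z ε′ → Close x z (ε ℚ.+ ε′)
  close-trans x y z ε ε′ x~y y~z δ 0<δ = eventually₂
    (λ n p q → subst (ℚ.∣ seq x n ℚ.- seq z n ∣ ℚ.≤_) (merge δ)
      (dist-trans (seq x n) (seq y n) (seq z n) p q))
    (x~y (half δ) (0<half 0<δ)) (y~z (half δ) (0<half 0<δ))
    where
    merge : ∀ δ → (ε ℚ.+ half δ) ℚ.+ (ε′ ℚ.+ half δ) ≡ (ε ℚ.+ ε′) ℚ.+ δ
    merge δ = trans (solve 4 (λ a b h g → (a :+ h) :+ (b :+ g) := (a :+ b) :+ (h :+ g)) refl ε ε′ (half δ) (half δ))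
      (cong ((ε ℚ.+ ε′) ℚ.+_) (half+half δ))

  close-halves : ∀ x y z ε → Close x y (half ε) → Close y z (half ε) → Close x z ε
  close-halves x y z ε x~y y~z = subst (Close x z) (half+half ε) (close-trans x y z (half ε) (half ε) x~y y~z)

  close-+ : ∀ x y u v ε → Close x y (half ε) → Close u v (half ε) → Close (x + u) (y + v) ε
  close-+ x y u v ε x~y u~v δ 0<δ = eventually₂
    (λ n p q → subst (ℚ.∣ (seq x n ℚ.+ seq u n) ℚ.- (seq y n ℚ.+ seq v n) ∣ ℚ.≤_)
      (trans (solve 4 (λ a b h g → (a :+ h) :+ (b :+ g) := (a :+ b) :+ (h :+ g)) refl (half ε) (half ε) (half δ) (half δ))
        (cong₂ ℚ._+_ (half+half ε) (half+half δ)))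
      (dist-+ (seq x n) (seq u n) (seq y n) (seq v n) p q))
    (x~y (half δ) (0<half 0<δ)) (u~v (half δ) (0<half 0<δ))

  converges-cong : ∀ x y a b → (∀ n → x n ≈ y n) → a ≈ b → Converges x a → Converges y b
  converges-cong x y a b x≈y a≈b x⟶a ε 0<ε = eventually₁
    (λ n x~a → close-halves (y n) (x n) b ε
      (close-sym (x n) (y n) (half ε) (≈⇒close (x n) (y n) (x≈y n) (half ε) (0<half 0<ε)))
      (close-halves (x n) a b (half ε) x~a (≈⇒close a b a≈b (half (half ε)) (0<half (0<half 0<ε)))))
    (x⟶a (half (half ε)) (0<half (0<half 0<ε)))

  converges-const : ∀ a → Converges (λ _ → a) a
  converges-const a ε 0<ε = 0 , λ _ _ → ≈⇒close a a (≡⇒≈ a a λ _ → refl) ε 0<ε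

  converges-+ : ∀ x y a b → Converges x a → Converges y b → Converges (λ n → x n + y n) (a + b)
  converges-+ x y a b x⟶a y⟶b ε 0<ε = eventually₂ (λ n → close-+ (x n) a (y n) b ε)
    (x⟶a (half ε) (0<half 0<ε)) (y⟶b (half ε) (0<half 0<ε))

  converges-* : ∀ x y a b → Converges x a → Converges y b → Converges (λ n → x n * y n) (a * b)
  converges-* x y a b x⟶a y⟶b ε 0<ε =
    let A , 0<A , a≤A = bounded a
        B , 0<B , b≤B = bounded b
        -- Bounds the late entries of every late `x n`: one unit for its distance from a, one for
        -- the slack of the order at which that distance is read off.
        X   = A ℚ.+ (1ℚ ℚ.+ 1ℚ)
        0<X = 0<+ 0<A (0<+ 0<1 0<1)
    in eventually₃
      (λ n x~a y~b x~a′ δ 0<δ → eventually₂ (λ k g h → g h)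
        (eventually₃ (λ k → dist-*-approx A B 0<B (1ℚ ℚ.+ 1ℚ) 0<X ε δ (seq (x n) k) (seq (y n) k) (seq a k) (seq b k))
          a≤A b≤B (x~a′ 1ℚ 0<1))
        (eventually₂ (λ k p q → p , q)
          (x~a (scale B 0<B δ) (0<scale B 0<B 0<δ)) (y~b (scale X 0<X δ) (0<scale X 0<X 0<δ))))
      (x⟶a (scale B 0<B ε) (0<scale B 0<B 0<ε)) (y⟶b (scale X 0<X ε) (0<scale X 0<X 0<ε)) (x⟶a 1ℚ 0<1)
    where
    0<1 : 0ℚ ℚ.< 1ℚ
    0<1 = ℚ.positive⁻¹ 1ℚ

  converges-unique : ∀ x a b → Converges x a → Converges x b → a ≈ b
  converges-unique x a b x⟶a x⟶b = close⇒≈ a b λ ε 0<ε →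
    let n , x~a , x~b = witness (eventually₂ (λ _ p q → p , q)
          (x⟶a (half ε) (0<half 0<ε)) (x⟶b (half ε) (0<half 0<ε)))
    in close-halves a (x n) b ε (close-sym (x n) a (half ε) x~a) x~b

  monotone⇒≤limit : ∀ x a → (∀ {m n} → m ℕ.≤ n → x m ≤ x n) → Converges x a → ∀ n → x n ≤ a
  monotone⇒≤limit x a mono x⟶a n ε 0<ε with x⟶a (half (half ε)) (0<half (0<half 0<ε))
  ... | N , close = eventually₂
    (λ k p q → ℚ.≤-trans p (ℚ.≤-trans (ℚ.+-monoˡ-≤ (half ε) (dist⇒≤ (seq (x M) k) (seq a k) q))
      (ℚ.≤-reflexive (trans (solve 4 (λ a h g f → (a :+ (h :+ g)) :+ f := a :+ ((h :+ g) :+ f)) refl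
          (seq a k) (half (half ε)) (half (half ε)) (half ε))
        (cong (seq a k ℚ.+_) (trans (cong (ℚ._+ half ε) (half+half (half ε))) (half+half ε)))))))
    (mono (ℕ.m≤m⊔n n N) (half ε) (0<half 0<ε))
    (close M (ℕ.m≤n⊔m n N) (half (half ε)) (0<half (0<half 0<ε)))
    where M = n ℕ.⊔ N

  -- A diagonal construction: from the sequence member chosen by the modulus at precision 1 / (k +
  -- 1), one entry is taken that is itself accurate to 1 / (k + 1).
  module Completeness (x : ℕ → ℝ) (index : ∀ ε → 0ℚ ℚ.< ε → ℕ)
    (x~ : ∀ ε (0<ε : 0ℚ ℚ.< ε) n → index ε 0<ε ℕ.≤ n → Close (x n) (x (index ε 0<ε)) ε) where

    private
      I : ℕ → ℕ
      I k = index (unitFraction k) (0<unitFraction k)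

      position : ℕ → ℕ
      position k = proj₁ (cauchy (x (I k)) (unitFraction k) (0<unitFraction k))

      diagonal : ℕ → ℚ
      diagonal k = seq (x (I k)) (position k)

      -- diagonal k approximates the late entries of x (I k), and those of all
      -- later x n.
      near : ∀ {θ} k n → 0ℚ ℚ.< θ → unitFraction k ℚ.≤ half θ → I k ℕ.≤ n →
             Eventually (λ i → ℚ.∣ diagonal k ℚ.- seq (x n) i ∣ ℚ.≤ half θ ℚ.+ θ)
      near {θ} k n 0<θ e≤ I≤n = eventually₂
        (λ i p q → dist-trans (diagonal k) (seq (x (I k)) i) (seq (x n) i) (ℚ.≤-trans p e≤)
          (dist-sym (seq (x n) i) (seq (x (I k)) i) (ℚ.≤-trans q
            (subst (unitFraction k ℚ.+ half θ ℚ.≤_) (half+half θ) (ℚ.+-monoˡ-≤ (half θ) e≤)))))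
        (position k , λ i le → proj₂ (cauchy (x (I k)) (unitFraction k) (0<unitFraction k))
          (position k) i ℕ.≤-refl le)
        (x~ (unitFraction k) (0<unitFraction k) n I≤n (half θ) (0<half 0<θ))

      quarter : ℚ → ℚ
      quarter ε = half (half ε)

      0<quarter : ∀ {ε} → 0ℚ ℚ.< ε → 0ℚ ℚ.< quarter ε
      0<quarter 0<ε = 0<half (0<half 0<ε)

      diagonal-close : ∀ {ε} → 0ℚ ℚ.< ε → ∃[ K ] (∀ k m → K ℕ.≤ k → K ℕ.≤ m →
                       ℚ.∣ diagonal k ℚ.- diagonal m ∣ ℚ.≤ ε)
      diagonal-close {ε} 0<ε with archimedean (0<half (0<quarter 0<ε))
      ... | K , e≤ = K , λ k m K≤k K≤m →
        let n = I k ℕ.⊔ I m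
            -- Each of the two `near` estimates is at most θ + θ, so the detour through the common
            -- `x n` costs at most ε.
            θ = quarter ε
            i , p , q = witness (eventually₂ (λ _ p q → p , q)
              (near k n (0<quarter 0<ε) (e≤ k K≤k) (ℕ.m≤m⊔n (I k) (I m)))
              (near m n (0<quarter 0<ε) (e≤ m K≤m) (ℕ.m≤n⊔m (I k) (I m))))
            θ+θ = trans (cong₂ ℚ._+_ (half+half (half ε)) (half+half (half ε))) (half+half ε)
        in ℚ.≤-trans
             (dist-trans (diagonal k) (seq (x n) i) (diagonal m) p (dist-sym (diagonal m) (seq (x n) i) q))
             (ℚ.≤-trans
               (ℚ.+-mono-≤ (ℚ.+-monoˡ-≤ θ (half≤ (0<quarter 0<ε))) (ℚ.+-monoˡ-≤ θ (half≤ (0<quarter 0<ε))))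
               (ℚ.≤-reflexive θ+θ))

    abstract
      limit-cauchy : IsCauchy diagonal
      limit-cauchy ε 0<ε = diagonal-close 0<ε

    limit : ℝ
    limit = mkℝ diagonal limit-cauchy

    converges-limit : Converges x limit
    converges-limit ε 0<ε =
      let K , close = diagonal-close (0<half 0<ε)
          -- Here `near` is used with θ = ε / 8, which keeps its error within ε / 2; the other half
          -- of ε is spent on the distance between two entries of the diagonal.
          K′ , e≤   = archimedean (0<half (0<quarter (0<half 0<ε)))
          k         = K ℕ.⊔ K′
      in I k , λ n I≤n δ 0<δ → eventually₂
        (λ i p i≥ → approx {ε} 0<ε 0<δ (seq (x n) i) (diagonal k) (diagonal i) p (close k i (ℕ.m≤m⊔n K K′) i≥))
        (near k n (0<quarter (0<half 0<ε)) (e≤ k (ℕ.m≤n⊔m K K′)) I≤n)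
        (K , λ i le → le)
      where
      approx : ∀ {ε δ} → 0ℚ ℚ.< ε → 0ℚ ℚ.< δ → ∀ p q r →
        ℚ.∣ q ℚ.- p ∣ ℚ.≤ half (quarter (half ε)) ℚ.+ quarter (half ε) → ℚ.∣ q ℚ.- r ∣ ℚ.≤ half ε →
        ℚ.∣ p ℚ.- r ∣ ℚ.≤ ε ℚ.+ δ
      approx {ε} {δ} 0<ε 0<δ p q r q~p q~r = ℚ.≤-trans
        (dist-trans p q r (dist-sym q p (ℚ.≤-trans q~p small)) q~r)
        (ℚ.≤-trans (ℚ.≤-reflexive (half+half ε)) (p≤p+ ε 0<δ))
        where
        small : half (quarter (half ε)) ℚ.+ quarter (half ε) ℚ.≤ half ε
        small = ℚ.≤-trans
          (ℚ.+-monoˡ-≤ (quarter (half ε)) (half≤ (0<quarter (0<half 0<ε))))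
          (ℚ.≤-trans (ℚ.≤-reflexive (half+half (half (half ε)))) (half≤ (0<half 0<ε)))

  -- For late indices N ≤ n, the increment x n - x N lies between 0 and y n - y N, so the Cauchy
  -- modulus obtained from the convergence of y also serves x.
  converges-dominated : ∀ x y b → (∀ {m n} → m ℕ.≤ n → x m ≤ x n) →
    (∀ {m n} → m ℕ.≤ n → y m - x m ≤ y n - x n) → Converges y b → ∃[ a ] Converges x a
  converges-dominated x y b x-mono y-x-mono y⟶b = Completeness.limit x index x~ , Completeness.converges-limit x index x~
    where
    index : ∀ ε → 0ℚ ℚ.< ε → ℕ
    index ε 0<ε = proj₁ (y⟶b (half ε) (0<half 0<ε))
    x~ : ∀ ε (0<ε : 0ℚ ℚ.< ε) n → index ε 0<ε ℕ.≤ n → Close (x n) (x (index ε 0<ε)) ε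
    x~ ε 0<ε n N≤n δ 0<δ = eventually₃ step
      (x-mono N≤n (half δ) (0<half 0<δ))
      (y-x-mono N≤n (half δ) (0<half 0<δ))
      (close-halves (y n) b (y N) ε (close n N≤n) (close-sym (y N) b (half ε) (close N ℕ.≤-refl)) (half δ) (0<half 0<δ))
      where
      N = index ε 0<ε
      close = proj₂ (y⟶b (half ε) (0<half 0<ε))
      step : ∀ k → seq (x N) k ℚ.≤ seq (x n) k ℚ.+ half δ →
             seq (y N) k ℚ.+ ℚ.- seq (x N) k ℚ.≤ (seq (y n) k ℚ.+ ℚ.- seq (x n) k) ℚ.+ half δ →
             ℚ.∣ seq (y n) k ℚ.- seq (y N) k ∣ ℚ.≤ ε ℚ.+ half δ →
             ℚ.∣ seq (x n) k ℚ.- seq (x N) k ∣ ℚ.≤ ε ℚ.+ δ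
      step k x≤ y-x≤ y~ = dist≤ xn xN
        (ℚ.≤-trans
          (subst₂ ℚ._≤_
            (solve 3 (λ xN xn yN → (yN :+ :- xN) :+ ((xn :+ xN) :- yN) := xn) refl xN xn yN)
            (solve 5 (λ xN xn yN z h → ((z :+ :- xn) :+ h) :+ ((xn :+ xN) :- yN) := z :+ ((h :+ xN) :- yN)) refl
              xN xn yN yn (half δ))
            (ℚ.+-monoˡ-≤ ((xn ℚ.+ xN) ℚ.- yN) y-x≤))
          (subst (yn ℚ.+ ((half δ ℚ.+ xN) ℚ.- yN) ℚ.≤_)
            (trans (solve 5 (λ xN yN e h g → (yN :+ (e :+ h)) :+ ((g :+ xN) :- yN) := xN :+ (e :+ (h :+ g))) refl
                xN yN ε (half δ) (half δ))
              (cong (λ t → xN ℚ.+ (ε ℚ.+ t)) (half+half δ)))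
            (ℚ.+-monoˡ-≤ ((half δ ℚ.+ xN) ℚ.- yN) (dist⇒≤ yn yN y~))))
        (ℚ.≤-trans x≤ (ℚ.+-monoʳ-≤ xn (ℚ.≤-trans (half≤ 0<δ)
          (subst (ℚ._≤ ε ℚ.+ δ) (ℚ.+-identityˡ δ) (ℚ.+-monoˡ-≤ δ (ℚ.<⇒≤ 0<ε))))))
        where
        xn = seq (x n) k
        xN = seq (x N) k
        yn = seq (y n) k
        yN = seq (y N) k

  -- Used for unconditional sums: the sum over an arbitrary finite set of words is enclosed between
  -- the sums over two exhausting alphabets.
  close-squeeze : ∀ x y z a ε → x ≤ y → y ≤ z → Close x a ε → Close z a ε → Close y a ε
  close-squeeze x y z a ε x≤y y≤z x~a z~a δ 0<δ = eventually₂ (λ k g h → g h)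
    (eventually₃ step (x≤y (half δ) (0<half 0<δ)) (y≤z (half δ) (0<half 0<δ)) (x~a (half δ) (0<half 0<δ)))
    (z~a (half δ) (0<half 0<δ))
    where
    merge : ∀ p → (p ℚ.+ (ε ℚ.+ half δ)) ℚ.+ half δ ≡ p ℚ.+ (ε ℚ.+ δ)
    merge p = trans (solve 4 (λ p e h g → (p :+ (e :+ h)) :+ g := p :+ (e :+ (h :+ g))) refl p ε (half δ) (half δ))
      (cong (λ t → p ℚ.+ (ε ℚ.+ t)) (half+half δ))
    step : ∀ k → seq x k ℚ.≤ seq y k ℚ.+ half δ → seq y k ℚ.≤ seq z k ℚ.+ half δ →
           ℚ.∣ seq x k ℚ.- seq a k ∣ ℚ.≤ ε ℚ.+ half δ →
           ℚ.∣ seq z k ℚ.- seq a k ∣ ℚ.≤ ε ℚ.+ half δ →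
           ℚ.∣ seq y k ℚ.- seq a k ∣ ℚ.≤ ε ℚ.+ δ
    step k x≤ y≤ x~ z~ = dist≤ (seq y k) (seq a k)
      (ℚ.≤-trans y≤ (ℚ.≤-trans (ℚ.+-monoˡ-≤ (half δ) (dist⇒≤ (seq z k) (seq a k) z~))
        (ℚ.≤-reflexive (merge (seq a k)))))
      (ℚ.≤-trans (dist⇒≤ (seq a k) (seq x k) (dist-sym (seq x k) (seq a k) x~))
        (ℚ.≤-trans (ℚ.+-monoˡ-≤ (ε ℚ.+ half δ) x≤)
          (ℚ.≤-reflexive (trans (solve 4 (λ p e h g → (p :+ h) :+ (e :+ g) := (p :+ (e :+ g)) :+ h) refl
            (seq y k) ε (half δ) (half δ)) (merge (seq y k))))))

  ℝ-limitRing : LimitRing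
  ℝ-limitRing = record
    { commutativeRing = ℝ-commutativeRing
    ; _≤_             = _≤_
    ; ≤-reflexive     = λ {x} {y} → ≈⇒≤ x y
    ; ≤-trans         = λ {x} {y} {z} → ≤-trans x y z
    ; +-mono-≤        = λ {x} {y} {u} {v} → +-mono-≤ x y u v
    ; *-monoˡ-≤       = λ {x} {y} {z} → *-monoˡ-≤ x y z
    ; 0≤1             = fromℚ-mono (ℚ.<⇒≤ (ℚ.positive⁻¹ 1ℚ))
    ; _⟶_             = Converges
    ; ⟶-cong          = λ {x} {y} {a} {b} → converges-cong x y a b
    ; ⟶-const         = converges-const
    ; ⟶-+             = λ {x} {y} {a} {b} → converges-+ x y a b
    ; ⟶-*             = λ {x} {y} {a} {b} → converges-* x y a b
    ; ⟶-unique        = λ {x} {a} {b} → converges-unique x a b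
    ; monotone⇒≤lim   = λ {x} {a} → monotone⇒≤limit x a
    ; dominated       = λ {x} {y} {b} → converges-dominated x y b
    }

-- Reciprocals of factorials as rationals and reals

module Factorials where
  -- Division in `ℚ` reduces to lowest terms, which blocks computation on variables. In unnormalised
  -- fractions the identities below become cross-multiplications of integers.
  toℚᵘ-/ : ∀ i d .{{_ : ℕ.NonZero d}} → ℚ.toℚᵘ (i ℚ./ d) ℚᵘ.≃ i ℚᵘ./ d
  toℚᵘ-/ i (suc d) = ℚ.toℚᵘ-fromℚᵘ (ℚᵘ.mkℚᵘ i d)

  suc-/1 : ∀ n → 1ℚ ℚ.+ (ℤ.+ n) ℚ./ 1 ≡ (ℤ.+ suc n) ℚ./ 1
  suc-/1 n = ℚ.toℚᵘ-injective (begin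
    ℚ.toℚᵘ (1ℚ ℚ.+ (ℤ.+ n) ℚ./ 1)              ≈⟨ ℚ.toℚᵘ-homo-+ 1ℚ ((ℤ.+ n) ℚ./ 1) ⟩
    ℚᵘ.1ℚᵘ ℚᵘ.+ ℚ.toℚᵘ ((ℤ.+ n) ℚ./ 1)         ≈⟨ ℚᵘ.+-congʳ ℚᵘ.1ℚᵘ (toℚᵘ-/ (ℤ.+ n) 1) ⟩
    ℚᵘ.1ℚᵘ ℚᵘ.+ (ℤ.+ n) ℚᵘ./ 1                 ≈⟨ ℚᵘ.*≡* (cross (ℤ.+ n)) ⟩
    (ℤ.+ suc n) ℚᵘ./ 1                         ≈⟨ toℚᵘ-/ (ℤ.+ suc n) 1 ⟨
    ℚ.toℚᵘ ((ℤ.+ suc n) ℚ./ 1)                 ∎)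
    where
    open ℚᵘ.≃-Reasoning
    cross : ∀ i → ((ℤ.+ 1) ℤ.* (ℤ.+ 1) ℤ.+ i ℤ.* (ℤ.+ 1)) ℤ.* (ℤ.+ 1) ≡
                  ((ℤ.+ 1) ℤ.+ i) ℤ.* ((ℤ.+ 1) ℤ.* (ℤ.+ 1))
    cross = ℤ.solve-∀

  reciprocal : ∀ d .{{_ : ℕ.NonZero d}} → ((ℤ.+ 1) ℚ./ d) ℚ.* ((ℤ.+ d) ℚ./ 1) ≡ 1ℚ
  reciprocal (suc d) = ℚ.toℚᵘ-injective (begin
    ℚ.toℚᵘ (((ℤ.+ 1) ℚ./ suc d) ℚ.* ((ℤ.+ suc d) ℚ./ 1))
      ≈⟨ ℚ.toℚᵘ-homo-* ((ℤ.+ 1) ℚ./ suc d) ((ℤ.+ suc d) ℚ./ 1) ⟩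
    ℚ.toℚᵘ ((ℤ.+ 1) ℚ./ suc d) ℚᵘ.* ℚ.toℚᵘ ((ℤ.+ suc d) ℚ./ 1)
      ≈⟨ ℚᵘ.*-cong (toℚᵘ-/ (ℤ.+ 1) (suc d)) (toℚᵘ-/ (ℤ.+ suc d) 1) ⟩
    ((ℤ.+ 1) ℚᵘ./ suc d) ℚᵘ.* ((ℤ.+ suc d) ℚᵘ./ 1)
      ≈⟨ ℚᵘ.*≡* (cross (ℤ.+ suc d)) ⟩
    ℚᵘ.1ℚᵘ ∎)
    where
    open ℚᵘ.≃-Reasoning
    cross : ∀ i → (ℤ.+ 1) ℤ.* i ℤ.* (ℤ.+ 1) ≡ (ℤ.+ 1) ℤ.* (i ℤ.* (ℤ.+ 1))
    cross = ℤ.solve-∀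

  0≤1/ : ∀ d .{{_ : ℕ.NonZero d}} → 0ℚ ℚ.≤ (ℤ.+ 1) ℚ./ d
  0≤1/ d@(suc _) = ℚ.toℚᵘ-cancel-≤ (ℚᵘ.≤-trans (ℚᵘ.*≤* (ℤ.+≤+ ℕ.z≤n))
    (ℚᵘ.≤-reflexive (ℚᵘ.≃-sym (toℚᵘ-/ (ℤ.+ 1) d))))

  1/≤1 : ∀ d .{{_ : ℕ.NonZero d}} → (ℤ.+ 1) ℚ./ d ℚ.≤ 1ℚ
  1/≤1 d@(suc _) = ℚ.toℚᵘ-cancel-≤ (ℚᵘ.≤-trans (ℚᵘ.≤-reflexive (toℚᵘ-/ (ℤ.+ 1) d))
    (ℚᵘ.*≤* (ℤ.+≤+ (ℕ.s≤s ℕ.z≤n))))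

module InverseFactorials where
  open RealLimits
  open Factorials

  1/_!ᴿ : ℕ → ℝ
  1/ m !ᴿ = fromℚ (1/ℚ m !)

  0≤1/! : ∀ m → 0# ≤ 1/ m !ᴿ
  0≤1/! m = fromℚ-mono (0≤1/ (m !) {{m ℕ.!≢0}})

  1/!≤1 : ∀ m → 1/ m !ᴿ ≤ 1#
  1/!≤1 m = fromℚ-mono (1/≤1 (m !) {{m ℕ.!≢0}})

  module _ (weight : ℤ → ℝ) where
    open WordSums ℝ-commutativeRing weight using (fromNat)

    seq-fromNat : ∀ n k → seq (fromNat n) k ≡ (ℤ.+ n) ℚ./ 1
    seq-fromNat zero    k = ≡.refl
    seq-fromNat (suc n) k = ≡.trans (≡.cong (1ℚ ℚ.+_) (seq-fromNat n k)) (suc-/1 n)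

    fromℕ≈fromNat : ∀ n → fromℕ n ≈ fromNat n
    fromℕ≈fromNat n = ≡⇒≈ (fromℕ n) (fromNat n) λ k → ≡.sym (seq-fromNat n k)

    1/!*! : ∀ m → 1/ m !ᴿ * fromNat (m !) ≈ 1#
    1/!*! m = ≡⇒≈ (1/ m !ᴿ * fromNat (m !)) 1# λ k →
      ≡.trans (≡.cong (1/ℚ m ! ℚ.*_) (seq-fromNat (m !) k)) (reciprocal (m !) {{m ℕ.!≢0}})

-- The shuffle measure and its expected number of fixed points

open InverseFactorials

mainTheorem9 : (α β : ℕ → ℝ) (γ a b : ℝ) →
    (∀ i → 0# ≤ α i) → (∀ i → 0# ≤ β i) → 0# ≤ γ →
    SeriesSum α a → SeriesSum β b → γ + a + b ≈ 1# →
    (n : ℕ) → 1 ℕ.≤ n →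
    Σ[ μ ∈ (Permutation′ n → ℝ) ] Σ[ s ∈ (ℕ → ℝ) ] Σ[ p̃ ∈ (ℕ → ℝ) ]
    ( IsShuffle α β γ μ
    × (∀ j → 1 ℕ.≤ j → SeriesSum (λ i → α i ^ j + (- 1#) ^ suc j * β i ^ j) (s j))
    × (∀ j → 1 ℕ.≤ j → IsPowerSum α β γ j (p̃ j))
    × 𝔼 μ fixedPoints ≈ γ + Σ[1⋯ n ] s
    × γ + Σ[1⋯ n ] s ≈ Σ[1⋯ n ] p̃ )
mainTheorem9 α β γ a b 0≤α 0≤β 0≤γ α⟶a β⟶b normalised (suc m) _ =
  μ , s , p̃ , isShuffle , s-series , p̃-powerSum , expectation≈ , γ+Σs≈Σp̃
  where
  open RealLimits
  open Letters
  open LimitRingProperties ℝ-limitRing using (Σ-mono-⊆; partialSum)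
  open Sums (CommutativeRing.commutativeSemiring ℝ-commutativeRing) using (Σ; Σ-cong; sum-cong-≋)
  open WordSums ℝ-commutativeRing using (fromNat)
  module R = CommutativeRing ℝ-commutativeRing

  weight : ℤ → ℝ
  weight = letterProb α β γ

  0≤weight : ∀ x → 0# ≤ weight x
  0≤weight +0         = 0≤γ
  0≤weight +[1+ i ]   = 0≤α i
  0≤weight (-[1+ i ]) = 0≤β i

  open Shuffle.Weighted ℝ-limitRing weight 0≤weight 1/_!ᴿ 0≤1/! 1/!≤1
  open Normalised {a} {b} α⟶a β⟶b normalised

  mass-converges : ∀ π → ∃[ c ] Converges (partialMass {suc m} π) c
  mass-converges = mass 

  μ : Permutation′ (suc m) → ℝ
  μ π = proj₁ (mass-converges π)

  isShuffle : IsShuffle α β γ μ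
  isShuffle π ε 0<ε =
    let N , close = proj₂ (mass-converges π) ε 0<ε
        W = λ N → words (letters N) (suc m)
        f = jointMass π
        0≤f = 0≤jointMass π
    -- The finite set of words required by `HasSum` is `W N`. Any larger `G` fits into some
    -- `W (N ℕ.⊔ M)`, and both enclosing sums are already within ε of the limit.
    in W N , λ G unique W⊆G →
      let M , G⊆W = words-exhaust G
      in close-squeeze (sumOver (W N) f) (sumOver G f) (sumOver (W (N ℕ.⊔ M)) f) (μ π) ε
           (Σ-mono-⊆ 0≤f (words-unique (suc m) (letters-unique N)) W⊆G)
           (Σ-mono-⊆ 0≤f unique (G⊆W (ℕ.m≤n⊔m N M)))
           (close N ℕ.≤-refl) (close (N ℕ.⊔ M) (ℕ.m≤m⊔n N M))

  A B : ℕ → ℝ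
  -- The value at 0 is a default, as only exponents from 1 on occur. The value at 1 is the given sum
  -- a itself, so that `powerSum-one` compares `s 1` with γ + a + b directly.
  A 0             = 0#
  A 1             = a
  A (suc (suc j)) = proj₁ (power-series +[1+_] {a} α⟶a (suc j))
  B 0             = 0#
  B 1             = b
  B (suc (suc j)) = proj₁ (power-series -[1+_] {b} β⟶b (suc j))

  first-power : ∀ (f : ℕ → ℝ) c → SeriesSum f c → SeriesSum (λ i → f i ^ 1) c
  first-power f c = converges-cong (partialSum f) (partialSum (λ i → f i ^ 1)) c c
    (λ N → sum-cong-≋ {N} λ i → R.sym {f (toℕ i) ^ 1} {f (toℕ i)} (R.*-identityʳ (f (toℕ i)))) (R.refl {c})

  A-series : ∀ j → SeriesSum (λ i → α i ^ suc j) (A (suc j))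
  A-series zero    = first-power α a α⟶a
  A-series (suc j) = proj₂ (power-series +[1+_] {a} α⟶a (suc j))

  B-series : ∀ j → SeriesSum (λ i → β i ^ suc j) (B (suc j))
  B-series zero    = first-power β b β⟶b
  B-series (suc j) = proj₂ (power-series -[1+_] {b} β⟶b (suc j))

  s p̃ : ℕ → ℝ
  s j = A j + (- 1#) ^ suc j * B j
  p̃ 1 = γ + a + b
  p̃ j = s j

  s-series : ∀ j → 1 ℕ.≤ j → SeriesSum (λ i → α i ^ j + (- 1#) ^ suc j * β i ^ j) (s j)
  s-series (suc j) _ = powerTerm-series (suc j) {A (suc j)} {B (suc j)} (A-series j) (B-series j)

  p̃-powerSum : ∀ j → 1 ℕ.≤ j → IsPowerSum α β γ j (p̃ j)
  p̃-powerSum 1             _ = a , b , α⟶a , β⟶b , R.refl {γ + a + b}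
  p̃-powerSum (suc (suc j)) _ = A (suc (suc j)) , B (suc (suc j)) , A-series (suc j) , B-series (suc j) ,
    R.refl {s (suc (suc j))}

  expectation≈ : 𝔼 μ fixedPoints ≈ γ + Σ[1⋯ suc m ] s
  expectation≈ = R.trans {𝔼 μ fixedPoints}
    {Σ (permutations (suc m)) (λ π → μ π * fromNat weight (fixedPoints π))} {γ + Σ[1⋯ suc m ] s}
    (Σ-cong (permutations (suc m)) λ π → *-cong {μ π} {μ π} {fromℕ (fixedPoints π)} {fromNat weight (fixedPoints π)}
      (R.refl {μ π}) (fromℕ≈fromNat weight (fixedPoints π)))
    (expectation (1/!*! weight) m {μ} {s} (λ π → proj₂ (mass-converges π)) (λ j → s-series (suc j) (ℕ.s≤s ℕ.z≤n)))

  γ+Σs≈Σp̃ : γ + Σ[1⋯ suc m ] s ≈ Σ[1⋯ suc m ] p̃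
  γ+Σs≈Σp̃ = powerSum-one γ a b (sum {m} (λ j → s (suc (suc (toℕ j)))))
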